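{- Let $p$ be a prime and let $A, B, C \subset \mathbb{F}_p$ with $|A|=|B|=|C| \leq \sqrt{p}$. Then for any fixed $d \in \mathbb{F}_p$ with $d \neq 0$, $$\max(|AB|, |(A+d)C|) \gg |A|^{1+1/26}.$$ In particular, for $A \subset \mathbb{F}_p$ with $|A| \leq \sqrt{p}$, $$|A(A+1)| \gg |A|^{1+1/26}$$ and $$\max(|AA|, |(A+1)(A+1)|) \gg |A|^{1+1/26}.$$
   Context: $\mathbb{F}_p$ is the field with $p$ elements, $p$ prime. For subsets $X, Y$ of a field and an element $d$, $XY = \{xy : x \in X, y \in Y\}$ and $X + d = \{x + d : x \in X\}$; $|X|$ is the cardinality of $X$. The notation $X \gg Y$ means that there is an absolute constant $c>0$ (here independent of $p, A, B, C, d$) such that $|X| \geq c|Y|$. -}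

module Defs where

open import Data.Bool.Properties using (T-≡)
open import Data.Fin.Base using (Fin; toℕ)
open import Data.Fin.Properties using (any?; _≟_)
open import Data.Fin.Subset using (Subset; _∈_)
open import Data.Fin.Subset.Properties using (_∈?_)
open import Data.Integer.Base using (+_)
open import Data.Nat.Base as ℕ using (ℕ; NonZero)
open import Data.Nat.DivMod using (_mod_)
open import Data.Nat.Primality using (Prime; prime⇒nonZero)
open import Data.Product.Base using (∃; _×_)
open import Data.Rational.Base as ℚ using (ℚ)
open import Data.Vec.Base using (tabulate)
open import Data.Vec.Properties using (lookup∘tabulate; lookup⇒[]=; []=⇒lookup)
open import Function.Bundles using (_⇔_; mk⇔; Equivalence)
open import Level using (0ℓ)
open import Relation.Binary.PropositionalEquality using (_≡_; sym; trans)
open import Relation.Nullary.Decidable using (does; _×-dec_; toWitness; fromWitness; isYes≗does)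
open import Relation.Unary using (Pred; Decidable)

private
  variable
    p : ℕ

𝔽 : (p : ℕ) → .{{Prime p}} → Set
𝔽 p = Fin p

residue : (p : ℕ) → .{{Prime p}} → ℕ → Fin p
residue p {{pr}} n = (n mod p) {{prime⇒nonZero pr}}

module _ .{{_ : Prime p}} where

  infixl 6 _+ₚ_
  infixl 7 _*ₚ_

  0ₚ 1ₚ : 𝔽 p
  0ₚ = residue p 0
  1ₚ = residue p 1

  _+ₚ_ _*ₚ_ : 𝔽 p → 𝔽 p → 𝔽 p
  x +ₚ y = residue p (toℕ x ℕ.+ toℕ y)
  x *ₚ y = residue p (toℕ x ℕ.* toℕ y)

comprehension : {P : Pred (Fin p) 0ℓ} → Decidable P → Subset p
comprehension P? = tabulate (λ z → does (P? z))

∈-comprehension : {P : Pred (Fin p) 0ℓ} (P? : Decidable P) {z : Fin p} →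
                  z ∈ comprehension P? ⇔ P z
∈-comprehension P? {z} = mk⇔
  (λ z∈ → toWitness {a? = P? z} (Equivalence.from T-≡
    (trans (isYes≗does (P? z))
      (trans (sym (lookup∘tabulate _ z)) ([]=⇒lookup z∈)))))
  (λ Pz → lookup⇒[]= z _ (trans (lookup∘tabulate _ z)
    (trans (sym (isYes≗does (P? z)))
      (Equivalence.to T-≡ (fromWitness {a? = P? z} Pz)))))

module _ .{{_ : Prime p}} where

  infixl 7 _·_
  infixl 8 _⊕_

  IsProduct : Subset p → Subset p → 𝔽 p → Set
  IsProduct X Y z = ∃ λ x → x ∈ X × ∃ λ y → y ∈ Y × z ≡ x *ₚ y

  isProduct? : ∀ X Y → Decidable (IsProduct X Y)
  isProduct? X Y z =
    any? λ x → x ∈? X ×-dec any? λ y → y ∈? Y ×-dec z ≟ x *ₚ y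

  IsTranslate : Subset p → 𝔽 p → 𝔽 p → Set
  IsTranslate X d z = ∃ λ x → x ∈ X × z ≡ x +ₚ d

  isTranslate? : ∀ X d → Decidable (IsTranslate X d)
  isTranslate? X d z = any? λ x → x ∈? X ×-dec z ≟ x +ₚ d

  _·_ : Subset p → Subset p → Subset p
  X · Y = comprehension (isProduct? X Y)

  _⊕_ : Subset p → 𝔽 p → Subset p
  X ⊕ d = comprehension (isTranslate? X d)

open import Algebra.Definitions.RawSemiring ℚ.+-*-rawSemiring public
  using () renaming (_^_ to _^ℚ_)

fromℕ : ℕ → ℚ
fromℕ n = + n ℚ./ 1

-- For c ≥ 0 this is c · n^(1 + 1/k) ≤ m, with both sides raised to the
-- k-th power so that the fractional exponent disappears.  Rational c suffice
-- for absolute constants: a positive real one can be lowered to a rational.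
_*_^[1+1/_]≤_ : ℚ → ℕ → (k : ℕ) → .{{NonZero k}} → ℕ → Set
c * n ^[1+1/ k ]≤ m = (c ^ℚ k) ℚ.* (fromℕ n ^ℚ (k ℕ.+ 1)) ℚ.≤ fromℕ m ^ℚ k

{-# OPTIONS --safe #-}
module Submission where

-- Let M bound |AB| and |(A + d)C|, and let n = |A| = |B| = |C|.  The value (a - a′)bc of a quadruple
-- is unchanged when (a, a′, b) moves within a fibre of (ba, ba′) and then (a, a′, c) within a fibre of
-- (c(a + d), c(a′ + d)).  Both fibres contain n³/M² triples on average, so most quadruples admit about
-- (n³/M²)² such double moves, whose end points represent the value in distinct ways as γ(x - x′) with
-- x, x′ ∈ AB and γ ∈ C.  Hence these values lie in a set V with |V| ≪ M⁶/n⁵.  For a, a′ in a large part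
-- A′ of A, most products (a - a′)bc are differences of V in ≫ n ways; there are at most |V⁺| ≪ |V|²/n
-- differences of that kind, and every ratio of differences of A′ maps ≫ n of them into V⁺, so A′ has
-- ≪ |V⁺|²/n such ratios.  By Rédei and Szőnyi the grid A′ × A′, having at most p points, determines
-- ≫ n² slopes.  Altogether n² ≪ |V|⁴/n³, that is n²⁵ ≪ M²⁴, which is more than required.
--
-- For the slopes, let hₘ be the complete homogeneous symmetric polynomials of the N = |A′|² numbers
-- b - ra with a, b ∈ A′.  If r is not a slope then these are distinct, and hₘ vanishes for p - N < m ≤ p - 2, because
-- hₘ is the divided difference of t ↦ tᵐ⁺ᴺ⁻¹ and tᵖ = t.  As hₘ has degree ≤ m in r, too many
-- non-slopes force hₘ = 0 at r = 0 for k = |A′| consecutive m, where ∑ hₘTᵐ = ∏ (1 - bT)⁻ᵏ.  The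
-- logarithmic derivative gives a recurrence of order k which propagates these zeros to all larger
-- m < p.  After multiplication by all factors 1 - bT but two, which must be distinct, the coefficient
-- at m = p - 1 is still 0; but the periodicity tᵖ = t shows that it is 1.

open import Algebra.Bundles using (CommutativeRing; RawRing)
open import Defs
open import Data.Fin.Subset using (Subset; ∣_∣)
open import Data.Nat.Base using (ℕ; _≤_; _^_; _⊔_)
open import Data.Nat.Primality using (Prime)
open import Data.Product.Base using (_×_; ∃-syntax)
open import Data.Rational.Base using (ℚ; 0ℚ) renaming (_<_ to _<ℚ_)
open import Level using (0ℓ)
open import Relation.Binary.PropositionalEquality using (_≡_; _≢_)

-- Ring solver with integer coefficients

module IntegerCoefficients (R : CommutativeRing 0ℓ 0ℓ) where

  open CommutativeRing R
  open import Algebra.Properties.Semiring.Mult semiring using (×-homo-+; ×1-homo-*) renaming (_×_ to _×ᴿ_)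
  open import Algebra.Properties.Ring ring using (-0#≈0#; -‿+-comm; -‿distribˡ-*; -‿involutive)
  open import Algebra.Solver.Ring.AlmostCommutativeRing
  open import Data.Integer.Base as ℤ using (ℤ; +_; -[1+_]; _⊖_)
  import Data.Integer.Properties as ℤ
  open import Data.Maybe.Base using (Maybe; just; nothing)
  open import Data.Nat.Base as ℕ using (ℕ; zero; suc)
  open import Relation.Binary.PropositionalEquality as ≡ using (_≡_)
  open import Relation.Binary.Definitions using (WeaklyDecidable)
  open import Relation.Nullary using (yes; no)
  open import Relation.Binary.Reasoning.Setoid setoid

  private
    ⟦_⟧ : ℤ → Carrier
    ⟦ + n      ⟧ = n ×ᴿ 1#
    ⟦ -[1+ n ] ⟧ = - (suc n ×ᴿ 1#)

    ⟦⊖⟧ : ∀ m n → ⟦ m ⊖ n ⟧ ≈ m ×ᴿ 1# + - (n ×ᴿ 1#)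
    ⟦⊖⟧ zero    zero    = sym (-‿inverseʳ 0#)
    ⟦⊖⟧ zero    (suc n) = sym (+-identityˡ _)
    ⟦⊖⟧ (suc m) zero    = sym (trans (+-congˡ -0#≈0#) (+-identityʳ _))
    ⟦⊖⟧ (suc m) (suc n) = begin
      ⟦ suc m ⊖ suc n ⟧                         ≡⟨ ≡.cong ⟦_⟧ (ℤ.[1+m]⊖[1+n]≡m⊖n m n) ⟩
      ⟦ m ⊖ n ⟧                                 ≈⟨ ⟦⊖⟧ m n ⟩
      M + - N                                   ≈⟨ +-congʳ (+-identityˡ M) ⟨
      0# + M + - N                              ≈⟨ +-congʳ (+-congʳ (-‿inverseʳ 1#)) ⟨
      1# + - 1# + M + - N                       ≈⟨ +-congʳ (trans (+-assoc _ _ _) (trans (+-congˡ (+-comm _ _)) (sym (+-assoc _ _ _)))) ⟩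
      1# + M + - 1# + - N                       ≈⟨ +-assoc _ _ _ ⟩
      1# + M + (- 1# + - N)                     ≈⟨ +-congˡ (-‿+-comm 1# N) ⟩
      1# + M + - (1# + N)                       ∎
      where
      M = m ×ᴿ 1#
      N = n ×ᴿ 1#

    ⟦-⟧ : ∀ i → ⟦ ℤ.- i ⟧ ≈ - ⟦ i ⟧
    ⟦-⟧ (+ zero)   = sym -0#≈0#
    ⟦-⟧ (+ suc n)  = refl
    ⟦-⟧ -[1+ n ]   = sym (-‿involutive _)

    ⟦+⟧ : ∀ i j → ⟦ i ℤ.+ j ⟧ ≈ ⟦ i ⟧ + ⟦ j ⟧
    ⟦+⟧ (+ m)    (+ n)    = ×-homo-+ 1# m n
    ⟦+⟧ (+ m)    -[1+ n ] = ⟦⊖⟧ m (suc n)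
    ⟦+⟧ -[1+ m ] (+ n)    = trans (⟦⊖⟧ n (suc m)) (+-comm _ _)
    ⟦+⟧ -[1+ m ] -[1+ n ] = begin
      - (suc (suc (m ℕ.+ n)) ×ᴿ 1#)    ≡⟨ ≡.cong (λ k → - (k ×ᴿ 1#)) (≡.cong suc (≡.sym (ℕ.+-suc m n))) ⟩
      - ((suc m ℕ.+ suc n) ×ᴿ 1#)      ≈⟨ -‿cong (×-homo-+ 1# (suc m) (suc n)) ⟩
      - (suc m ×ᴿ 1# + suc n ×ᴿ 1#)     ≈⟨ -‿+-comm _ _ ⟨
      - (suc m ×ᴿ 1#) + - (suc n ×ᴿ 1#) ∎
      where import Data.Nat.Properties as ℕ

    ⟦+*⟧ : ∀ m j → ⟦ + m ℤ.* j ⟧ ≈ ⟦ + m ⟧ * ⟦ j ⟧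
    ⟦+*⟧ m (+ n)    = trans (reflexive (≡.cong ⟦_⟧ (≡.sym (ℤ.pos-* m n)))) (×1-homo-* m n)
    ⟦+*⟧ m -[1+ n ] = begin
      ⟦ + m ℤ.* (ℤ.- + suc n) ⟧     ≡⟨ ≡.cong ⟦_⟧ (ℤ.*-comm (+ m) -[1+ n ]) ⟩
      ⟦ (ℤ.- + suc n) ℤ.* + m ⟧     ≡⟨ ≡.cong ⟦_⟧ (ℤ.neg-distribˡ-* (+ suc n) (+ m)) ⟨
      ⟦ ℤ.- (+ suc n ℤ.* + m) ⟧     ≈⟨ ⟦-⟧ (+ suc n ℤ.* + m) ⟩
      - ⟦ + suc n ℤ.* + m ⟧         ≡⟨ ≡.cong (λ i → - ⟦ i ⟧) (ℤ.pos-* (suc n) m) ⟨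
      - ((suc n ℕ.* m) ×ᴿ 1#)        ≈⟨ -‿cong (×1-homo-* (suc n) m) ⟩
      - (suc n ×ᴿ 1# * (m ×ᴿ 1#))     ≈⟨ -‿distribˡ-* _ _ ⟩
      - (suc n ×ᴿ 1#) * (m ×ᴿ 1#)     ≈⟨ *-comm _ _ ⟩
      m ×ᴿ 1# * - (suc n ×ᴿ 1#)       ∎

    ⟦*⟧ : ∀ i j → ⟦ i ℤ.* j ⟧ ≈ ⟦ i ⟧ * ⟦ j ⟧
    ⟦*⟧ (+ m)    j = ⟦+*⟧ m j
    ⟦*⟧ -[1+ m ] j = begin
      ⟦ (ℤ.- + suc m) ℤ.* j ⟧  ≡⟨ ≡.cong ⟦_⟧ (ℤ.neg-distribˡ-* (+ suc m) j) ⟨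
      ⟦ ℤ.- (+ suc m ℤ.* j) ⟧  ≈⟨ ⟦-⟧ (+ suc m ℤ.* j) ⟩
      - ⟦ + suc m ℤ.* j ⟧      ≈⟨ -‿cong (⟦+*⟧ (suc m) j) ⟩
      - (⟦ + suc m ⟧ * ⟦ j ⟧)  ≈⟨ -‿distribˡ-* _ _ ⟩
      - ⟦ + suc m ⟧ * ⟦ j ⟧    ∎

    ℤ-raw : RawRing 0ℓ 0ℓ
    ℤ-raw = CommutativeRing.rawRing ℤ.+-*-commutativeRing

    morphism : ℤ-raw -Raw-AlmostCommutative⟶ fromCommutativeRing R
    morphism = record
      { ⟦_⟧    = ⟦_⟧
      ; +-homo = ⟦+⟧
      ; *-homo = ⟦*⟧
      ; -‿homo = ⟦-⟧
      ; 0-homo = refl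
      ; 1-homo = +-identityʳ 1#
      }

    -- Integers compare by computation even over an abstract ring, so equal coefficients in normal
    -- forms are recognised. The answer `nothing` for distinct integers leaves open whether their
    -- images in the ring agree.
    _coeff≟_ : WeaklyDecidable (Induced-equivalence morphism)
    i coeff≟ j with i ℤ.≟ j
    ... | yes i≡j = just (reflexive (≡.cong ⟦_⟧ i≡j))
    ... | no  _   = nothing

  open import Algebra.Solver.Ring ℤ-raw (fromCommutativeRing R) morphism _coeff≟_ public
    using (solve; con; _:+_; _:*_; _:-_; :-_; _:=_)

import Algebra.Definitions.RawMonoid as RawMonoid
import Algebra.Properties.CommutativeSemiring.Exp as Exp
open import Algebra.Structures using (IsCommutativeRing)
open import Data.Empty using (⊥-elim)
open import Data.Fin.Base using (Fin; zero; suc; toℕ)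
import Data.Fin.Properties as Fin
import Data.Fin.Subset as Subset
open Subset using (inside; outside)
open import Data.Fin.Subset.Properties using (drop-there)
open import Data.Integer.Base as ℤ using (0ℤ)
import Data.Integer.Properties as ℤ
open import Data.List.Base using (List; []; _∷_; _++_; allFin; cartesianProduct; filter; foldr; length; map; take)
import Data.List.Membership.DecPropositional as DecMembership
open import Data.List.Membership.Propositional using (_∈_; find; lose)
open import Data.List.Membership.Propositional.Properties
  using (∈-++⁺ˡ; ∈-allFin; ∈-cartesianProduct⁺; ∈-cartesianProduct⁻; ∈-filter⁺; ∈-filter⁻; ∈-map⁺; ∈-map⁻)
open import Data.List.Membership.Propositional.Properties.WithK using (unique∧set⇒bag)
open import Data.List.Properties
  using (++-assoc; ++-identityʳ; length-++; length-filter; length-map; length-tabulate; length-take;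
         map-++; map-∘; map-cong; map-id; take++drop≡id)
open import Data.List.Relation.Binary.BagAndSetEquality using (∼bag⇒↭)
open import Data.List.Relation.Binary.Permutation.Propositional using (_↭_; ↭⇒↭ₛ)
import Data.List.Relation.Binary.Permutation.Setoid.Properties as Permutation
open import Data.List.Relation.Unary.All as All using (All; []; _∷_)
import Data.List.Relation.Unary.All.Properties as All
open import Data.List.Relation.Unary.AllPairs using ([]; _∷_)
open import Data.List.Relation.Unary.Any using (here; there; any?)
open import Data.List.Relation.Unary.Unique.Propositional using (Unique)
import Data.List.Relation.Unary.Unique.Propositional.Properties as Unique
open import Data.Nat.Base as ℕ hiding (_/_)
open import Data.Nat.DivMod using (_%_; %-distribˡ-+; %-distribˡ-*; m<n⇒m%n≡m; n%n≡0; m%n<n)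
open import Data.Nat.Divisibility using (_∣_; m%n≡0⇒n∣m; n∣m⇒m%n≡0)
open import Data.Nat.Primality using (prime⇒nonZero; prime⇒nonTrivial; euclidsLemma)
import Data.Nat.Properties as ℕₚ
open ℕₚ using (≤-trans; ≤-reflexive; _≤?_; _<?_)
open import Data.Nat.Solver using (module +-*-Solver)
open import Data.Product.Base using (_,_; proj₁; proj₂; ∃)
open import Data.Product.Properties using (≡-dec; ,-injective)
open import Data.Rational.Base as ℚ using (1ℚ; toℚᵘ)
import Data.Rational.Properties as ℚ
import Data.Rational.Unnormalised.Base as ℚᵘ
import Data.Rational.Unnormalised.Properties as ℚᵘ
open import Data.Sum.Base as Sum using (_⊎_; inj₁; inj₂; [_,_]′)
import Data.Vec.Base as Vec
open import Function.Base using (_∘_; id)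
open import Function.Bundles using (mk⇔; Equivalence)
open import Relation.Binary.Definitions using (DecidableEquality)
open import Relation.Binary.PropositionalEquality
  using (_≗_; refl; sym; trans; cong; cong₂; subst; setoid; module ≡-Reasoning)
open import Relation.Binary.PropositionalEquality.Algebra using (isMagma)
open import Relation.Nullary using (Dec; yes; no; ¬_; ¬?; contradiction; map′; _×-dec_; _⊎-dec_)
open import Relation.Unary using (Pred; Decidable)

-- Sums over lists

private
  variable
    I J : Set
    P Q : Set

𝟙 : Dec P → ℕ
𝟙 (yes _) = 1
𝟙 (no  _) = 0

𝟙-yes : (P? : Dec P) → P → 𝟙 P? ≡ 1
𝟙-yes (yes _) _ = refl
𝟙-yes (no ¬p) p = contradiction p ¬p

𝟙-no : (P? : Dec P) → ¬ P → 𝟙 P? ≡ 0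
𝟙-no (yes p) ¬p = contradiction p ¬p
𝟙-no (no _)  _  = refl

𝟙≤1 : (P? : Dec P) → 𝟙 P? ≤ 1
𝟙≤1 (yes _) = ℕₚ.≤-refl
𝟙≤1 (no  _) = z≤n

𝟙*≤ : (P? : Dec P) {k m : ℕ} → (P → k ≤ m) → 𝟙 P? * k ≤ m
𝟙*≤ (yes p) {k} f = ≤-trans (≤-reflexive (ℕₚ.*-identityˡ k)) (f p)
𝟙*≤ (no _)  f = z≤n

𝟙+¬≡1 : (P? : Dec P) → 𝟙 P? + 𝟙 (¬? P?) ≡ 1
𝟙+¬≡1 (yes _) = refl
𝟙+¬≡1 (no _)  = refl

∑ : List I → (I → ℕ) → ℕ
∑ []       f = 0
∑ (x ∷ xs) f = f x + ∑ xs f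

infix 5 ∑
syntax ∑ xs (λ x → e) = ∑[ x ∈ xs ] e

∑-mono : (xs : List I) {f g : I → ℕ} → (∀ {x} → x ∈ xs → f x ≤ g x) → ∑ xs f ≤ ∑ xs g
∑-mono []       f≤g = z≤n
∑-mono (x ∷ xs) f≤g = ℕₚ.+-mono-≤ (f≤g (here refl)) (∑-mono xs (f≤g ∘ there))

∑-cong : (xs : List I) {f g : I → ℕ} → (∀ x → f x ≡ g x) → ∑ xs f ≡ ∑ xs g
∑-cong []       f≡g = refl
∑-cong (x ∷ xs) f≡g = cong₂ _+_ (f≡g x) (∑-cong xs f≡g)

∑-const : (xs : List I) (c : ℕ) → ∑[ _ ∈ xs ] c ≡ length xs * c
∑-const []       c = refl
∑-const (x ∷ xs) c = cong (c +_) (∑-const xs c)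

∑-≤const : (xs : List I) {f : I → ℕ} (c : ℕ) → (∀ {x} → x ∈ xs → f x ≤ c) → ∑ xs f ≤ length xs * c
∑-≤const xs c f≤c = ≤-trans (∑-mono xs f≤c) (≤-reflexive (∑-const xs c))

∑-≥const : (xs : List I) {f : I → ℕ} (c : ℕ) → (∀ {x} → x ∈ xs → c ≤ f x) → length xs * c ≤ ∑ xs f
∑-≥const xs c c≤f = ≤-trans (≤-reflexive (sym (∑-const xs c))) (∑-mono xs c≤f)

∑-distrib-+ : (xs : List I) (f g : I → ℕ) → ∑[ x ∈ xs ] (f x + g x) ≡ ∑ xs f + ∑ xs g
∑-distrib-+ []       f g = refl
∑-distrib-+ (x ∷ xs) f g = trans (cong (f x + g x +_) (∑-distrib-+ xs f g))
  (solve 4 (λ a b c d → (a :+ b) :+ (c :+ d) := (a :+ c) :+ (b :+ d)) refl (f x) (g x) (∑ xs f) (∑ xs g))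
  where open +-*-Solver

*-∑ : (c : ℕ) (xs : List I) (f : I → ℕ) → c * ∑ xs f ≡ ∑[ x ∈ xs ] (c * f x)
*-∑ c []       f = ℕₚ.*-zeroʳ c
*-∑ c (x ∷ xs) f = trans (ℕₚ.*-distribˡ-+ c (f x) (∑ xs f)) (cong (c * f x +_) (*-∑ c xs f))

∑-* : (xs : List I) (f : I → ℕ) (c : ℕ) → ∑ xs f * c ≡ ∑[ x ∈ xs ] (f x * c)
∑-* []       f c = refl
∑-* (x ∷ xs) f c = trans (ℕₚ.*-distribʳ-+ c (f x) (∑ xs f)) (cong (f x * c +_) (∑-* xs f c))

∑-swap : (xs : List I) (ys : List J) (f : I → J → ℕ) →
         ∑[ x ∈ xs ] ∑[ y ∈ ys ] f x y ≡ ∑[ y ∈ ys ] ∑[ x ∈ xs ] f x y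
∑-swap []       ys f = sym (trans (∑-const ys 0) (ℕₚ.*-zeroʳ (length ys)))
∑-swap (x ∷ xs) ys f = trans (cong (∑ ys (f x) +_) (∑-swap xs ys f))
  (sym (∑-distrib-+ ys (f x) (λ y → ∑[ x′ ∈ xs ] f x′ y)))

∑-++ : (xs ys : List I) (f : I → ℕ) → ∑ (xs ++ ys) f ≡ ∑ xs f + ∑ ys f
∑-++ []       ys f = refl
∑-++ (x ∷ xs) ys f = trans (cong (f x +_) (∑-++ xs ys f)) (sym (ℕₚ.+-assoc (f x) _ _))

∑-map : (xs : List I) (h : I → J) (f : J → ℕ) → ∑ (map h xs) f ≡ ∑ xs (f ∘ h)
∑-map []       h f = refl
∑-map (x ∷ xs) h f = cong (f (h x) +_) (∑-map xs h f)

∑-× : (xs : List I) (ys : List J) (f : I × J → ℕ) →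
      ∑ (cartesianProduct xs ys) f ≡ ∑[ x ∈ xs ] ∑[ y ∈ ys ] f (x , y)
∑-× []       ys f = refl
∑-× (x ∷ xs) ys f = trans (∑-++ (map (x ,_) ys) (cartesianProduct xs ys) f)
  (cong₂ _+_ (∑-map ys (x ,_) f) (∑-× xs ys f))

length-∑ : (xs : List I) → length xs ≡ ∑[ _ ∈ xs ] 1
length-∑ xs = sym (trans (∑-const xs 1) (ℕₚ.*-identityʳ (length xs)))

length-× : (xs : List I) (ys : List J) → length (cartesianProduct xs ys) ≡ length xs * length ys
length-× xs ys = trans (length-∑ (cartesianProduct xs ys)) (trans (∑-× xs ys _)
  (trans (∑-cong xs (λ _ → sym (length-∑ ys))) (∑-const xs (length ys))))

∑-filter : {R : Pred I _} (R? : Decidable R) (xs : List I) (f : I → ℕ) →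
           ∑ (filter R? xs) f ≡ ∑[ x ∈ xs ] (𝟙 (R? x) * f x)
∑-filter R? []       f = refl
∑-filter R? (x ∷ xs) f with R? x
... | yes _ = cong₂ _+_ (sym (ℕₚ.*-identityˡ (f x))) (∑-filter R? xs f)
... | no  _ = ∑-filter R? xs f

length-filter-∑ : {R : Pred I _} (R? : Decidable R) (xs : List I) →
                  length (filter R? xs) ≡ ∑[ x ∈ xs ] 𝟙 (R? x)
length-filter-∑ R? xs = trans (length-∑ (filter R? xs))
  (trans (∑-filter R? xs _) (∑-cong xs (λ x → ℕₚ.*-identityʳ (𝟙 (R? x)))))

∈⇒≤∑ : {xs : List I} {x : I} (f : I → ℕ) → x ∈ xs → f x ≤ ∑ xs f
∈⇒≤∑ f (here refl) = ℕₚ.m≤m+n _ _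
∈⇒≤∑ f (there x∈)  = ≤-trans (∈⇒≤∑ f x∈) (ℕₚ.m≤n+m _ _)

∑-none : {R : Pred I _} (R? : Decidable R) (xs : List I) → (∀ {x} → x ∈ xs → ¬ R x) → ∑[ x ∈ xs ] 𝟙 (R? x) ≡ 0
∑-none R? []       none = refl
∑-none R? (x ∷ xs) none = cong₂ _+_ (𝟙-no (R? x) (none (here refl))) (∑-none R? xs (none ∘ there))

∑-atMostOne : {R : Pred I _} (R? : Decidable R) {xs : List I} → Unique xs →
              (∀ {x y} → x ∈ xs → y ∈ xs → R x → R y → x ≡ y) → ∑[ x ∈ xs ] 𝟙 (R? x) ≤ 1
∑-atMostOne R? []        one = z≤n
∑-atMostOne R? {x ∷ xs} (x∉ ∷ u) one with R? x
... | yes r = ≤-reflexive (cong suc (∑-none R? xs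
  (λ y∈ r′ → All.lookup x∉ y∈ (one (here refl) (there y∈) r r′))))
... | no _  = ∑-atMostOne R? u (λ x∈ y∈ → one (there x∈) (there y∈))

-- Counting along the fibres of a map

module Fibres (_≟_ : DecidableEquality J) where

  -- Here `zs` must cover the image; in the reverse inequality below it must be free of repetitions
  -- instead.
  ∑-fibres-≤ : (xs : List I) (zs : List J) (π : I → J) (f : I → ℕ) → (∀ {x} → x ∈ xs → π x ∈ zs) →
               ∑ xs f ≤ ∑[ z ∈ zs ] ∑[ x ∈ xs ] (𝟙 (π x ≟ z) * f x)
  ∑-fibres-≤ xs zs π f π∈ = ≤-trans (∑-mono xs pointwise) (≤-reflexive (∑-swap xs zs _))
    where
    pointwise : ∀ {x} → x ∈ xs → f x ≤ ∑[ z ∈ zs ] (𝟙 (π x ≟ z) * f x)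
    pointwise {x} x∈ = ≤-trans
      (≤-reflexive (sym (trans (cong (_* f x) (𝟙-yes (π x ≟ π x) refl)) (ℕₚ.*-identityˡ (f x)))))
      (∈⇒≤∑ (λ z → 𝟙 (π x ≟ z) * f x) (π∈ x∈))

  ∑-fibres-≥ : (xs : List I) {zs : List J} → Unique zs → (π : I → J) (f : I → ℕ) →
               ∑[ z ∈ zs ] ∑[ x ∈ xs ] (𝟙 (π x ≟ z) * f x) ≤ ∑ xs f
  ∑-fibres-≥ xs {zs} u π f = ≤-trans (≤-reflexive (∑-swap zs xs _)) (∑-mono xs λ {x} _ → begin
      ∑[ z ∈ zs ] (𝟙 (π x ≟ z) * f x) ≡⟨ ∑-* zs _ (f x) ⟨
      (∑[ z ∈ zs ] 𝟙 (π x ≟ z)) * f x ≤⟨ ℕₚ.*-monoˡ-≤ (f x) (∑-atMostOne (π x ≟_) u (λ _ _ p q → trans (sym p) q)) ⟩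
      1 * f x                         ≡⟨ ℕₚ.*-identityˡ (f x) ⟩
      f x                             ∎)
    where open ℕₚ.≤-Reasoning

  fibre : (xs : List I) (π : I → J) → J → ℕ
  fibre xs π z = ∑[ x ∈ xs ] 𝟙 (π x ≟ z)

  fibre-weighted : (xs : List I) (π : I → J) (g : J → ℕ) (z : J) →
                   ∑[ x ∈ xs ] (𝟙 (π x ≟ z) * g (π x)) ≡ g z * fibre xs π z
  fibre-weighted xs π g z = trans (∑-cong xs pointwise)
    (trans (sym (∑-* xs _ (g z))) (ℕₚ.*-comm (fibre xs π z) (g z)))
    where
    pointwise : ∀ x → 𝟙 (π x ≟ z) * g (π x) ≡ 𝟙 (π x ≟ z) * g z
    pointwise x with π x ≟ z
    ... | yes refl = refl
    ... | no  _    = refl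

  -- There are at most `w` fibres, and the small ones have fewer than |xs|/kw elements each, so
  -- together they hold at most the fraction 1/k of `xs`. The product is passed as a separate `kw`
  -- so that callers can use a variable for it.
  small-fibres : (xs : List I) (zs : List J) (π : I → J) → (∀ {x} → x ∈ xs → π x ∈ zs) →
    (k w : ℕ) .{{_ : NonZero w}} → length zs ≤ w → {kw : ℕ} → kw ≡ k * w →
    k * (∑[ x ∈ xs ] 𝟙 (kw * fibre xs π (π x) <? length xs)) ≤ length xs
  small-fibres xs zs π π∈ k w zs≤w refl = ℕₚ.*-cancelˡ-≤ w (begin
      w * (k * (∑[ x ∈ xs ] g (π x)))           ≡⟨ solve 3 (λ a b c → a :* (b :* c) := b :* a :* c) refl w k _ ⟩
      k * w * (∑[ x ∈ xs ] g (π x))             ≤⟨ ℕₚ.*-monoʳ-≤ (k * w) (∑-fibres-≤ xs zs π (g ∘ π) π∈) ⟩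
      k * w * (∑[ z ∈ zs ] ∑[ x ∈ xs ] (𝟙 (π x ≟ z) * g (π x)))
                                                ≡⟨ cong (k * w *_) (∑-cong zs (fibre-weighted xs π g)) ⟩
      k * w * (∑[ z ∈ zs ] (g z * fibre xs π z)) ≡⟨ *-∑ (k * w) zs _ ⟩
      ∑[ z ∈ zs ] (k * w * (g z * fibre xs π z)) ≤⟨ ∑-≤const zs (length xs) (λ {z} _ → bound z) ⟩
      length zs * length xs                     ≤⟨ ℕₚ.*-monoˡ-≤ (length xs) zs≤w ⟩
      w * length xs                             ∎)
    where
    open ℕₚ.≤-Reasoning
    open +-*-Solver
    g : J → ℕ
    g z = 𝟙 (k * w * fibre xs π z <? length xs)
    bound : ∀ z → k * w * (g z * fibre xs π z) ≤ length xs
    bound z = ≤-trans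
      (≤-reflexive (solve 3 (λ a b c → a :* (b :* c) := b :* (a :* c)) refl (k * w) (g z) (fibre xs π z)))
      (𝟙*≤ (k * w * fibre xs π z <? length xs) ℕₚ.<⇒≤)

  -- Markov's inequality fibre by fibre: a fibre counted on the left has size at most twice its
  -- weight under `f`, and the weights of all fibres add up to at most `∑ xs f`. It serves with `f`
  -- the indicator of a rare event.
  majority-fibres : (xs : List I) {zs : List J} → Unique zs → (π : I → J) → (∀ {x} → x ∈ xs → π x ∈ zs) →
    (f : I → ℕ) →
    ∑[ x ∈ xs ] 𝟙 (fibre xs π (π x) ≤? 2 * (∑[ y ∈ xs ] (𝟙 (π y ≟ π x) * f y))) ≤ 2 * ∑ xs f
  majority-fibres xs {zs} u π π∈ f = begin
      ∑[ x ∈ xs ] g (π x)                                     ≤⟨ ∑-fibres-≤ xs zs π (g ∘ π) π∈ ⟩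
      ∑[ z ∈ zs ] ∑[ x ∈ xs ] (𝟙 (π x ≟ z) * g (π x))         ≡⟨ ∑-cong zs (fibre-weighted xs π g) ⟩
      ∑[ z ∈ zs ] (g z * fibre xs π z)                        ≤⟨ ∑-mono zs (λ {z} _ → 𝟙*≤ (fibre xs π z ≤? 2 * fib-f z) (λ le → le)) ⟩
      ∑[ z ∈ zs ] (2 * fib-f z)                               ≡⟨ *-∑ 2 zs fib-f ⟨
      2 * ∑ zs fib-f                                          ≤⟨ ℕₚ.*-monoʳ-≤ 2 (∑-fibres-≥ xs u π f) ⟩
      2 * ∑ xs f                                              ∎
    where
    open ℕₚ.≤-Reasoning
    fib-f : J → ℕ
    fib-f z = ∑[ y ∈ xs ] (𝟙 (π y ≟ z) * f y)
    g : J → ℕ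
    g z = 𝟙 (fibre xs π z ≤? 2 * fib-f z)

-- Prime fields

-- No inverses are listed: `integral` provides all cancellation. `×1-≢0` lets the recurrence for
-- power series coefficients divide by the index; it spells out the multiple by `RawMonoid` because
-- the ring bundle is built only after the fields.
record PrimeField : Set₁ where
  infixl 6 _+ᶠ_ _-ᶠ_
  infixl 7 _*ᶠ_
  infix  8 -ᶠ_
  field
    F                 : Set
    _+ᶠ_ _*ᶠ_         : F → F → F
    -ᶠ_               : F → F
    0ᶠ 1ᶠ             : F
    isCommutativeRing : IsCommutativeRing _≡_ _+ᶠ_ _*ᶠ_ -ᶠ_ 0ᶠ 1ᶠ
    integral          : ∀ {x y} → x *ᶠ y ≡ 0ᶠ → x ≡ 0ᶠ ⊎ y ≡ 0ᶠ
    1≢0               : 1ᶠ ≢ 0ᶠ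
    _≟_               : DecidableEquality F
    elements          : List F
    elements!         : Unique elements
    ∈-elements        : ∀ x → x ∈ elements
    p                 : ℕ
    p-length          : length elements ≡ p
    ×1-≢0             : ∀ {m} → 0 < m → m < p →
                        RawMonoid._×_ (record { _≈_ = _≡_ ; _∙_ = _+ᶠ_ ; ε = 0ᶠ }) m 1ᶠ ≢ 0ᶠ

  commutativeRing : CommutativeRing 0ℓ 0ℓ
  commutativeRing = record { isCommutativeRing = isCommutativeRing }

  open CommutativeRing commutativeRing public
    using (+-assoc; +-comm; +-identityˡ; +-identityʳ; *-assoc; *-comm; *-identityˡ; *-identityʳ;
           zeroˡ; zeroʳ; distribʳ; -‿inverseʳ)
  open import Algebra.Properties.Semiring.Mult (CommutativeRing.semiring commutativeRing) public
    using () renaming (_×_ to _×ᶠ_)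
  open import Algebra.Properties.Semiring.Exp (CommutativeRing.semiring commutativeRing) public
    using () renaming (_^_ to _^ᶠ_)

  _-ᶠ_ : F → F → F
  x -ᶠ y = x +ᶠ -ᶠ y

  module 𝕊 = IntegerCoefficients commutativeRing

  x-x≡0 : ∀ x → x -ᶠ x ≡ 0ᶠ
  x-x≡0 = -‿inverseʳ

  x-y≡0⇒x≡y : ∀ {x y} → x -ᶠ y ≡ 0ᶠ → x ≡ y
  x-y≡0⇒x≡y {x} {y} eq = begin
    x             ≡⟨ solve 2 (λ x y → x := (x :- y) :+ y) refl x y ⟩
    x -ᶠ y +ᶠ y   ≡⟨ cong (_+ᶠ y) eq ⟩
    0ᶠ +ᶠ y       ≡⟨ +-identityˡ y ⟩
    y             ∎
    where
    open ≡-Reasoning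
    open 𝕊

  *-cancelˡ : ∀ {x y z} → x ≢ 0ᶠ → x *ᶠ y ≡ x *ᶠ z → y ≡ z
  *-cancelˡ {x} {y} {z} x≢0 eq = [ (λ x≡0 → contradiction x≡0 x≢0) , x-y≡0⇒x≡y ]′ (integral (begin
    x *ᶠ (y -ᶠ z)       ≡⟨ solve 3 (λ x y z → x :* (y :- z) := x :* y :- x :* z) refl x y z ⟩
    x *ᶠ y -ᶠ x *ᶠ z    ≡⟨ cong (_-ᶠ x *ᶠ z) eq ⟩
    x *ᶠ z -ᶠ x *ᶠ z    ≡⟨ x-x≡0 (x *ᶠ z) ⟩
    0ᶠ                  ∎))
    where
    open ≡-Reasoning
    open 𝕊

  *-cancelʳ : ∀ {x y z} → x ≢ 0ᶠ → y *ᶠ x ≡ z *ᶠ x → y ≡ z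
  *-cancelʳ {x} {y} {z} x≢0 eq = *-cancelˡ x≢0 (trans (*-comm x y) (trans eq (*-comm z x)))

  *-≢0 : ∀ {x y} → x ≢ 0ᶠ → y ≢ 0ᶠ → x *ᶠ y ≢ 0ᶠ
  *-≢0 x≢0 y≢0 xy≡0 = [ x≢0 , y≢0 ]′ (integral xy≡0)

  -- If `z` were missing from `ys`, then `ys` together with `z` would occupy `length ys + 1` places
  -- of `xs`: for each `x` of `xs`, the occurrences in `ys` plus one for `z` never exceed 1.
  ⊆∧length⇒⊇ : {xs ys : List F} → Unique xs → Unique ys → (∀ {y} → y ∈ ys → y ∈ xs) →
               length xs ≤ length ys → ∀ {z} → z ∈ xs → z ∈ ys
  ⊆∧length⇒⊇ {xs} {ys} xs! ys! ys⊆xs xs≤ys {z} z∈xs with DecMembership._∈?_ _≟_ z ys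
  ... | yes z∈ys = z∈ys
  ... | no  z∉ys = contradiction (≤-trans ys<xs xs≤ys) (ℕₚ.<-irrefl refl)
    where
    open ℕₚ.≤-Reasoning
    open Fibres _≟_
    f : F → ℕ
    f x = ∑[ y ∈ ys ] 𝟙 (y ≟ x)
    f+δ≤1 : ∀ x → f x + 𝟙 (z ≟ x) ≤ 1
    f+δ≤1 x with z ≟ x
    ... | yes refl = ≤-reflexive (cong (_+ 1) (∑-none (_≟ z) ys (λ { y∈ refl → z∉ys y∈ })))
    ... | no  _    = ≤-trans (≤-reflexive (ℕₚ.+-identityʳ (f x)))
                       (∑-atMostOne (_≟ x) ys! (λ _ _ p q → trans p (sym q)))
    ys<xs : suc (length ys) ≤ length xs
    ys<xs = begin
      suc (length ys)                            ≡⟨ ℕₚ.+-comm 1 (length ys) ⟩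
      length ys + 1                              ≡⟨ cong₂ _+_ (length-∑ ys) (sym (𝟙-yes (z ≟ z) refl)) ⟩
      (∑[ _ ∈ ys ] 1) + 𝟙 (z ≟ z)                ≤⟨ ℕₚ.+-mono-≤ (∑-fibres-≤ ys xs id (λ _ → 1) ys⊆xs) (∈⇒≤∑ (λ x → 𝟙 (z ≟ x)) z∈xs) ⟩
      (∑[ x ∈ xs ] ∑[ y ∈ ys ] (𝟙 (y ≟ x) * 1)) + (∑[ x ∈ xs ] 𝟙 (z ≟ x))
                                                 ≡⟨ cong (_+ _) (∑-cong xs (λ x → ∑-cong ys (λ y → ℕₚ.*-identityʳ (𝟙 (y ≟ x))))) ⟩
      (∑[ x ∈ xs ] f x) + (∑[ x ∈ xs ] 𝟙 (z ≟ x)) ≡⟨ ∑-distrib-+ xs f _ ⟨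
      ∑[ x ∈ xs ] (f x + 𝟙 (z ≟ x))              ≤⟨ ∑-≤const xs 1 (λ {x} _ → f+δ≤1 x) ⟩
      length xs * 1                              ≡⟨ ℕₚ.*-identityʳ (length xs) ⟩
      length xs                                  ∎

  module _ where

    private
      nonzero? : ∀ x → Dec (x ≢ 0ᶠ)
      nonzero? x = ¬? (x ≟ 0ᶠ)

      units : List F
      units = filter nonzero? elements

      units! : Unique units
      units! = Unique.filter⁺ nonzero? elements!

      ∏ : List F → F
      ∏ = foldr _*ᶠ_ 1ᶠ

      ∏-map-* : ∀ x ys → ∏ (map (x *ᶠ_) ys) ≡ x ^ᶠ length ys *ᶠ ∏ ys
      ∏-map-* x []       = sym (*-identityˡ 1ᶠ)
      ∏-map-* x (y ∷ ys) = trans (cong (x *ᶠ y *ᶠ_) (∏-map-* x ys))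
        (solve 4 (λ x y u v → x :* y :* (u :* v) := x :* u :* (y :* v)) refl x y (x ^ᶠ length ys) (∏ ys))
        where open 𝕊

      ∏-≢0 : ∀ ys → (∀ {y} → y ∈ ys → y ≢ 0ᶠ) → ∏ ys ≢ 0ᶠ
      ∏-≢0 []       ≢0 = 1≢0
      ∏-≢0 (y ∷ ys) ≢0 = *-≢0 (≢0 (here refl)) (∏-≢0 ys (≢0 ∘ there))

      unit⇒≢0 : ∀ {y} → y ∈ units → y ≢ 0ᶠ
      unit⇒≢0 = proj₂ ∘ ∈-filter⁻ nonzero? {xs = elements}

      length-units : suc (length units) ≡ p
      length-units = trans (ℕₚ.≤-antisym upper lower) p-length
        where
        open ℕₚ.≤-Reasoning
        total : (∑[ x ∈ elements ] 𝟙 (x ≟ 0ᶠ)) + length units ≡ length elements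
        total = trans (cong ((∑[ x ∈ elements ] 𝟙 (x ≟ 0ᶠ)) +_) (length-filter-∑ nonzero? elements))
          (trans (sym (∑-distrib-+ elements _ _)) (trans (∑-cong elements (λ x → 𝟙+¬≡1 (x ≟ 0ᶠ))) (sym (length-∑ elements))))
        upper : suc (length units) ≤ length elements
        upper = begin
          suc (length units)                                  ≡⟨ cong (_+ length units) (𝟙-yes (0ᶠ ≟ 0ᶠ) refl) ⟨
          𝟙 (0ᶠ ≟ 0ᶠ) + length units                          ≤⟨ ℕₚ.+-monoˡ-≤ _ (∈⇒≤∑ (λ x → 𝟙 (x ≟ 0ᶠ)) (∈-elements 0ᶠ)) ⟩
          (∑[ x ∈ elements ] 𝟙 (x ≟ 0ᶠ)) + length units       ≡⟨ total ⟩
          length elements                                     ∎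
        lower : length elements ≤ suc (length units)
        lower = begin
          length elements                                     ≡⟨ total ⟨
          (∑[ x ∈ elements ] 𝟙 (x ≟ 0ᶠ)) + length units       ≤⟨ ℕₚ.+-monoˡ-≤ _ (∑-atMostOne (_≟ 0ᶠ) elements! (λ _ _ p q → trans p (sym q))) ⟩
          suc (length units)                                  ∎

    -- Fermat's argument: multiplication by x ≠ 0 permutes the units, so their product P satisfies P
    -- = x^(p-1) P, and P cancels.
    x^p≡x : ∀ x → x ^ᶠ p ≡ x
    x^p≡x x with x ≟ 0ᶠ
    ... | yes refl = subst (λ k → 0ᶠ ^ᶠ k ≡ 0ᶠ) length-units (zeroˡ _)
    ... | no  x≢0  = begin
      x ^ᶠ p                     ≡⟨ cong (x ^ᶠ_) length-units ⟨
      x *ᶠ x ^ᶠ length units     ≡⟨ cong (x *ᶠ_) x^units≡1 ⟩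
      x *ᶠ 1ᶠ                    ≡⟨ *-identityʳ x ⟩
      x                          ∎
      where
      open ≡-Reasoning
      image : List F
      image = map (x *ᶠ_) units
      image! : Unique image
      image! = Unique.map⁺ (*-cancelˡ x≢0) units!
      image⊆units : ∀ {y} → y ∈ image → y ∈ units
      image⊆units y∈ with ∈-map⁻ (x *ᶠ_) y∈
      ... | z , z∈ , refl = ∈-filter⁺ nonzero? (∈-elements _) (*-≢0 x≢0 (unit⇒≢0 z∈))
      image↭units : image ↭ units
      image↭units = ∼bag⇒↭ (unique∧set⇒bag image! units! (mk⇔ image⊆units
        (⊆∧length⇒⊇ units! image! image⊆units (≤-reflexive (sym (length-map (x *ᶠ_) units))))))
      x^units≡1 : x ^ᶠ length units ≡ 1ᶠ
      x^units≡1 = *-cancelʳ (∏-≢0 units unit⇒≢0) (begin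
        x ^ᶠ length units *ᶠ ∏ units  ≡⟨ ∏-map-* x units ⟨
        ∏ image                       ≡⟨ Permutation.foldr-commMonoid (setoid F) (CommutativeRing.*-isCommutativeMonoid commutativeRing) (↭⇒↭ₛ image↭units) ⟩
        ∏ units                       ≡⟨ *-identityˡ (∏ units) ⟨
        1ᶠ *ᶠ ∏ units                 ∎)

-- Slopes of a grid

unique-map : {I J : Set} {f : I → J} {xs : List I} →
             (∀ {x y} → x ∈ xs → y ∈ xs → f x ≡ f y → x ≡ y) → Unique xs → Unique (map f xs)
unique-map {xs = []}     inj []        = []
unique-map {xs = x ∷ xs} inj (x∉ ∷ xs!) =
  All.map⁺ (All.tabulate (λ y∈ fx≡fy → All.lookup x∉ y∈ (inj (here refl) (there y∈) fx≡fy)))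
  ∷ unique-map (λ x∈ y∈ → inj (there x∈) (there y∈)) xs!

module RédeiSzőnyi (𝔽ₚ : PrimeField) where

  open PrimeField 𝔽ₚ

  -- dd l j is the divided difference at the points of l of the function t ↦ tʲ, and h l m is the
  -- complete homogeneous symmetric polynomial of degree m in the entries of l.  They agree up to an
  -- index shift (dd≡h); dd sees that tᵖ = t, h has a controlled degree.
  dd : List F → ℕ → F
  dd []          j       = 0ᶠ
  dd (x ∷ [])    j       = x ^ᶠ j
  dd (x ∷ y ∷ l) zero    = 0ᶠ
  dd (x ∷ y ∷ l) (suc j) = x *ᶠ dd (x ∷ y ∷ l) j +ᶠ dd (y ∷ l) j

  h : List F → ℕ → F
  h []      zero    = 1ᶠ
  h []      (suc m) = 0ᶠ
  h (x ∷ l) zero    = 1ᶠ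
  h (x ∷ l) (suc m) = x *ᶠ h (x ∷ l) m +ᶠ h l (suc m)

  h-0 : ∀ l → h l 0 ≡ 1ᶠ
  h-0 []      = refl
  h-0 (x ∷ l) = refl

  private
    x0+y≡y : ∀ {x z y} → z ≡ 0ᶠ → x *ᶠ z +ᶠ y ≡ y
    x0+y≡y {x} {y = y} refl = trans (cong (_+ᶠ y) (zeroʳ x)) (+-identityˡ y)

    x0+0≡0 : ∀ {x z y} → z ≡ 0ᶠ → y ≡ 0ᶠ → x *ᶠ z +ᶠ y ≡ 0ᶠ
    x0+0≡0 z≡0 y≡0 = trans (x0+y≡y z≡0) y≡0

    x-y0≡0 : ∀ {x y z} → x ≡ 0ᶠ → z ≡ 0ᶠ → x -ᶠ y *ᶠ z ≡ 0ᶠ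
    x-y0≡0 {y = y} refl refl = trans (cong (λ t → 0ᶠ -ᶠ t) (zeroʳ y)) (x-x≡0 0ᶠ)

    x-y0≡x : ∀ {x y z} → z ≡ 0ᶠ → x -ᶠ y *ᶠ z ≡ x
    x-y0≡x {x} {y} refl = solve 2 (λ x y → x :- y :* con 0ℤ := x) refl x y
      where open 𝕊

  dd-low : ∀ x l {j} → j < length l → dd (x ∷ l) j ≡ 0ᶠ
  dd-low x (y ∷ l) {zero}  _         = refl
  dd-low x (y ∷ l) {suc j} (s≤s j<l) = x0+0≡0 (dd-low x (y ∷ l) (ℕₚ.m<n⇒m<1+n j<l)) (dd-low y l j<l)

  dd≡h : ∀ x l m → dd (x ∷ l) (m + length l) ≡ h (x ∷ l) m
  dd≡h x []      zero    = refl
  dd≡h x []      (suc m) = trans (cong (x *ᶠ_) (dd≡h x [] m)) (sym (+-identityʳ _))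
  dd≡h x (y ∷ l) zero    = trans (x0+y≡y (dd-low x (y ∷ l) (ℕₚ.n<1+n _))) (trans (dd≡h y l 0) (h-0 (y ∷ l)))
  dd≡h x (y ∷ l) (suc m) = cong₂ (λ u v → x *ᶠ u +ᶠ v) (dd≡h x (y ∷ l) m)
    (trans (cong (dd (y ∷ l)) (ℕₚ.+-suc m (length l))) (dd≡h y l (suc m)))

  -- This is the usual quotient formula for divided differences. The definition of `dd` follows the
  -- Leibniz rule for t · tʲ instead, which avoids division.
  dd-difference : ∀ x y l j → (x -ᶠ y) *ᶠ dd (x ∷ y ∷ l) j ≡ dd (x ∷ l) j -ᶠ dd (y ∷ l) j
  dd-difference x y []      zero    = trans (zeroʳ _) (sym (x-x≡0 1ᶠ))
  dd-difference x y (z ∷ l) zero    = trans (zeroʳ _) (sym (x-x≡0 0ᶠ))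
  dd-difference x y []      (suc j) = begin
    (x -ᶠ y) *ᶠ (x *ᶠ d +ᶠ v)
      ≡⟨ solve 4 (λ x y d v → (x :- y) :* (x :* d :+ v) := x :* ((x :- y) :* d) :+ (x :- y) :* v) refl x y d v ⟩
    x *ᶠ ((x -ᶠ y) *ᶠ d) +ᶠ (x -ᶠ y) *ᶠ v
      ≡⟨ cong (λ t → x *ᶠ t +ᶠ (x -ᶠ y) *ᶠ v) (dd-difference x y [] j) ⟩
    x *ᶠ (u -ᶠ v) +ᶠ (x -ᶠ y) *ᶠ v
      ≡⟨ solve 4 (λ x y u v → x :* (u :- v) :+ (x :- y) :* v := x :* u :- y :* v) refl x y u v ⟩
    x *ᶠ u -ᶠ y *ᶠ v ∎
    where
    open ≡-Reasoning
    open 𝕊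
    d = dd (x ∷ y ∷ []) j
    u = x ^ᶠ j
    v = y ^ᶠ j
  dd-difference x y (z ∷ l) (suc j) = begin
    (x -ᶠ y) *ᶠ (x *ᶠ d +ᶠ v)
      ≡⟨ solve 4 (λ x y d v → (x :- y) :* (x :* d :+ v) := x :* ((x :- y) :* d) :+ (x :- y) :* v) refl x y d v ⟩
    x *ᶠ ((x -ᶠ y) *ᶠ d) +ᶠ (x -ᶠ y) *ᶠ v
      ≡⟨ cong (λ t → x *ᶠ t +ᶠ (x -ᶠ y) *ᶠ v) (dd-difference x y (z ∷ l) j) ⟩
    x *ᶠ (u -ᶠ v) +ᶠ (x -ᶠ y) *ᶠ v
      ≡⟨ solve 5 (λ x y u v w → x :* (u :- v) :+ (x :- y) :* v := (x :* u :+ w) :- (y :* v :+ w)) refl x y u v w ⟩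
    x *ᶠ u +ᶠ w -ᶠ (y *ᶠ v +ᶠ w) ∎
    where
    open ≡-Reasoning
    open 𝕊
    d = dd (x ∷ y ∷ z ∷ l) j
    u = dd (x ∷ z ∷ l) j
    v = dd (y ∷ z ∷ l) j
    w = dd (z ∷ l) j

  ^ᶠ-period : ∀ x j → x ^ᶠ (j + p) ≡ x ^ᶠ suc j
  ^ᶠ-period x zero    = trans (x^p≡x x) (sym (*-identityʳ x))
  ^ᶠ-period x (suc j) = cong (x *ᶠ_) (^ᶠ-period x j)

  -- At distinct points a divided difference depends only on the values of the function, and t^(j+p)
  -- and t^(j+1) have the same values. The quotient formula carries this through the induction,
  -- since x - y can be cancelled.
  dd-period : ∀ {l} → Unique l → ∀ j → dd l (j + p) ≡ dd l (suc j)
  dd-period {[]}        _                              j = refl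
  dd-period {x ∷ []}    _                              j = ^ᶠ-period x j
  dd-period {x ∷ y ∷ l} ((x≢y ∷ x∉) ∷ yl!@(_ ∷ l!)) j = *-cancelˡ (x≢y ∘ x-y≡0⇒x≡y) (begin
    (x -ᶠ y) *ᶠ dd (x ∷ y ∷ l) (j + p)         ≡⟨ dd-difference x y l (j + p) ⟩
    dd (x ∷ l) (j + p) -ᶠ dd (y ∷ l) (j + p)   ≡⟨ cong₂ _-ᶠ_ (dd-period (x∉ ∷ l!) j) (dd-period yl! j) ⟩
    dd (x ∷ l) (suc j) -ᶠ dd (y ∷ l) (suc j)   ≡⟨ dd-difference x y l (suc j) ⟨
    (x -ᶠ y) *ᶠ dd (x ∷ y ∷ l) (suc j)         ∎)
    where open ≡-Reasoning

  -- With N = `length l`, the polynomial h of degree s + i + 1 is the divided difference of t to the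
  -- power s + i + 1 + (N - 1) = i + p. Periodicity lowers this exponent to i + 1 < N - 1, where
  -- divided differences at N points vanish.
  h-gap : ∀ {l s i} → Unique l → s + length l ≡ p → suc (suc i) < length l → h l (s + suc i) ≡ 0ᶠ
  h-gap {x ∷ l} {s} {i} l! s+l≡p i<l = begin
    h (x ∷ l) (s + suc i)               ≡⟨ dd≡h x l (s + suc i) ⟨
    dd (x ∷ l) (s + suc i + length l)   ≡⟨ cong (dd (x ∷ l)) index ⟩
    dd (x ∷ l) (i + p)                  ≡⟨ dd-period l! i ⟩
    dd (x ∷ l) (suc i)                  ≡⟨ dd-low x l (s≤s⁻¹ i<l) ⟩
    0ᶠ                                  ∎
    where
    open ≡-Reasoning
    index : s + suc i + length l ≡ i + p
    index = trans (solve 3 (λ s i l → s :+ (con 1 :+ i) :+ l := i :+ (s :+ (con 1 :+ l))) refl s i (length l)) (cong (i +_) s+l≡p)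
      where open +-*-Solver

  -- Polynomial functions of degree ≤ d, described by divided differences instead of coefficients.
  Deg : ℕ → (F → F) → Set
  Deg zero    f = ∀ u y → f y ≡ f u
  Deg (suc d) f = ∀ u → ∃ λ g → Deg d g × (∀ y → f y ≡ f u +ᶠ (y -ᶠ u) *ᶠ g y)

  Deg-const : ∀ d c → Deg d (λ _ → c)
  Deg-const zero    c u y = refl
  Deg-const (suc d) c u   = (λ _ → 0ᶠ) , Deg-const d 0ᶠ , λ y → sym (trans (cong (c +ᶠ_) (zeroʳ _)) (+-identityʳ c))

  Deg-suc : ∀ d {f} → Deg d f → Deg (suc d) f
  Deg-suc zero    f-deg u = (λ _ → 0ᶠ) , Deg-const 0 0ᶠ , λ y →
    trans (f-deg u y) (sym (trans (cong (_ +ᶠ_) (zeroʳ _)) (+-identityʳ _)))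
  Deg-suc (suc d) f-deg u with f-deg u
  ... | g , g-deg , eq = g , Deg-suc d g-deg , eq

  Deg-+ : ∀ d {f g} → Deg d f → Deg d g → Deg d (λ y → f y +ᶠ g y)
  Deg-+ zero    f-deg g-deg u y = cong₂ _+ᶠ_ (f-deg u y) (g-deg u y)
  Deg-+ (suc d) {f} {g} f-deg g-deg u with f-deg u | g-deg u
  ... | f′ , f′-deg , f-eq | g′ , g′-deg , g-eq = _ , Deg-+ d f′-deg g′-deg , λ y → trans (cong₂ _+ᶠ_ (f-eq y) (g-eq y))
    (solve 5 (λ a b c v w → (a :+ c :* v) :+ (b :+ c :* w) := (a :+ b) :+ c :* (v :+ w)) refl (f u) (g u) (y -ᶠ u) (f′ y) (g′ y))
    where open 𝕊

  Deg-scale : ∀ d {f} c → Deg d f → Deg d (λ y → c *ᶠ f y)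
  Deg-scale zero    c f-deg u y = cong (c *ᶠ_) (f-deg u y)
  Deg-scale (suc d) {f} c f-deg u with f-deg u
  ... | f′ , f′-deg , eq = _ , Deg-scale d c f′-deg , λ y → trans (cong (c *ᶠ_) (eq y))
    (solve 4 (λ c a b v → c :* (a :+ b :* v) := c :* a :+ b :* (c :* v)) refl c (f u) (y -ᶠ u) (f′ y))
    where open 𝕊

  -- Product rule for difference quotients: the linear factor has the constant quotient -a, so the
  -- product has the quotient -a f(y) + (b - ua) f′(y), whose degree is bounded by that of `f`.
  Deg-linear : ∀ d {f} a b → Deg d f → Deg (suc d) (λ y → (b -ᶠ y *ᶠ a) *ᶠ f y)
  Deg-linear zero    {f} a b f-deg u = _ , Deg-scale 0 (-ᶠ a) f-deg , λ y → begin
    (b -ᶠ y *ᶠ a) *ᶠ f y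
      ≡⟨ solve 5 (λ a b u y v → (b :- y :* a) :* v := (b :- u :* a) :* v :+ (y :- u) :* ((:- a) :* v)) refl a b u y (f y) ⟩
    (b -ᶠ u *ᶠ a) *ᶠ f y +ᶠ (y -ᶠ u) *ᶠ (-ᶠ a *ᶠ f y)
      ≡⟨ cong (λ t → (b -ᶠ u *ᶠ a) *ᶠ t +ᶠ (y -ᶠ u) *ᶠ (-ᶠ a *ᶠ f y)) (f-deg u y) ⟩
    (b -ᶠ u *ᶠ a) *ᶠ f u +ᶠ (y -ᶠ u) *ᶠ (-ᶠ a *ᶠ f y) ∎
    where
    open ≡-Reasoning
    open 𝕊
  Deg-linear (suc d) {f} a b f-deg u with f-deg u
  ... | f′ , f′-deg , eq = _ , Deg-+ (suc d) (Deg-scale (suc d) (-ᶠ a) f-deg) (Deg-suc d (Deg-scale d (b -ᶠ u *ᶠ a) f′-deg)) , λ y → begin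
    (b -ᶠ y *ᶠ a) *ᶠ f y
      ≡⟨ solve 5 (λ a b u y v → (b :- y :* a) :* v := (b :- u :* a) :* v :+ (y :- u) :* ((:- a) :* v)) refl a b u y (f y) ⟩
    (b -ᶠ u *ᶠ a) *ᶠ f y +ᶠ (y -ᶠ u) *ᶠ (-ᶠ a *ᶠ f y)
      ≡⟨ cong (λ t → (b -ᶠ u *ᶠ a) *ᶠ t +ᶠ (y -ᶠ u) *ᶠ (-ᶠ a *ᶠ f y)) (eq y) ⟩
    (b -ᶠ u *ᶠ a) *ᶠ (f u +ᶠ (y -ᶠ u) *ᶠ f′ y) +ᶠ (y -ᶠ u) *ᶠ (-ᶠ a *ᶠ f y)
      ≡⟨ solve 5 (λ c fu e v w → c :* (fu :+ e :* v) :+ e :* w := c :* fu :+ e :* (w :+ c :* v)) refl (b -ᶠ u *ᶠ a) (f u) (y -ᶠ u) (f′ y) (-ᶠ a *ᶠ f y) ⟩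
    (b -ᶠ u *ᶠ a) *ᶠ f u +ᶠ (y -ᶠ u) *ᶠ (-ᶠ a *ᶠ f y +ᶠ (b -ᶠ u *ᶠ a) *ᶠ f′ y) ∎
    where
    open ≡-Reasoning
    open 𝕊

  -- Splitting off a root u leaves f(y) = (y - u) g(y). The other roots differ from u, so they are
  -- roots of `g`, whose degree bound is lower by one.
  Deg-roots : ∀ d {f us} → Deg d f → Unique us → d < length us → (∀ {u} → u ∈ us → f u ≡ 0ᶠ) → ∀ y → f y ≡ 0ᶠ
  Deg-roots zero    {f} {u ∷ us} f-deg _ _ roots y = trans (f-deg u y) (roots (here refl))
  Deg-roots (suc d) {f} {u ∷ us} f-deg (u∉ ∷ us!) (s≤s d<us) roots y with f-deg u
  ... | g , g-deg , eq = begin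
    f y                           ≡⟨ eq y ⟩
    f u +ᶠ (y -ᶠ u) *ᶠ g y        ≡⟨ cong₂ (λ a b → a +ᶠ (y -ᶠ u) *ᶠ b) (roots (here refl)) (Deg-roots d g-deg us! d<us g-roots y) ⟩
    0ᶠ +ᶠ (y -ᶠ u) *ᶠ 0ᶠ          ≡⟨ trans (+-identityˡ _) (zeroʳ _) ⟩
    0ᶠ                            ∎
    where
    open ≡-Reasoning
    g-roots : ∀ {v} → v ∈ us → g v ≡ 0ᶠ
    g-roots {v} v∈ = *-cancelˡ {v -ᶠ u} (λ eq′ → All.lookup u∉ v∈ (sym (x-y≡0⇒x≡y eq′))) (begin
      (v -ᶠ u) *ᶠ g v             ≡⟨ +-identityˡ _ ⟨
      0ᶠ +ᶠ (v -ᶠ u) *ᶠ g v       ≡⟨ cong (_+ᶠ _) (roots (here refl)) ⟨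
      f u +ᶠ (v -ᶠ u) *ᶠ g v      ≡⟨ eq v ⟨
      f v                         ≡⟨ roots (there v∈) ⟩
      0ᶠ                          ≡⟨ zeroʳ _ ⟨
      (v -ᶠ u) *ᶠ 0ᶠ              ∎)

  -- The intercept of the line of slope y through (a , b): points on a common line of slope y have
  -- the same value.
  ℓ : F → F × F → F
  ℓ y (a , b) = b -ᶠ y *ᶠ a

  -- The recursion of `h` multiplies by one entry, linear in y, each time the index grows by one.
  -- The bound is therefore m, however many points there are.
  h-Deg : ∀ ps m → Deg m (λ y → h (map (ℓ y) ps) m)
  h-Deg []             zero    = Deg-const 0 1ᶠ
  h-Deg []             (suc m) = Deg-const (suc m) 0ᶠ
  h-Deg (_ ∷ ps)       zero    = Deg-const 0 1ᶠ
  h-Deg ((a , b) ∷ ps) (suc m) = Deg-+ (suc m) (Deg-linear m a b (h-Deg ((a , b) ∷ ps) m)) (h-Deg ps (suc m))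

  -- A sequence u stands for the power series ∑ uₘTᵐ: multiplication by T, by 1 - bT and by ∏ (1 - bT) for
  -- b ∈ β, and the derivation T d/dT.
  shift : (ℕ → F) → ℕ → F
  shift u zero    = 0ᶠ
  shift u (suc m) = u m

  D : F → (ℕ → F) → ℕ → F
  D b u m = u m -ᶠ b *ᶠ shift u m

  D* : List F → (ℕ → F) → ℕ → F
  D* []      u = u
  D* (b ∷ β) u = D b (D* β u)

  θ : (ℕ → F) → ℕ → F
  θ u m = (m ×ᶠ 1ᶠ) *ᶠ u m

  -- R β is multiplication by -T Q′ where Q = ∏ (1 - bT) for b ∈ β.
  R : List F → (ℕ → F) → ℕ → F
  R []      u m = 0ᶠ
  R (b ∷ β) u m = b *ᶠ shift (D* β u) m +ᶠ D b (R β u) m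

  shift-cong : ∀ {u v} → u ≗ v → shift u ≗ shift v
  shift-cong u≗v zero    = refl
  shift-cong u≗v (suc m) = u≗v m

  D-cong : ∀ b {u v} → u ≗ v → D b u ≗ D b v
  D-cong b u≗v m = cong₂ (λ x y → x -ᶠ b *ᶠ y) (u≗v m) (shift-cong u≗v m)

  D*-cong : ∀ β {u v} → u ≗ v → D* β u ≗ D* β v
  D*-cong []      u≗v = u≗v
  D*-cong (b ∷ β) u≗v = D-cong b (D*-cong β u≗v)

  R-cong : ∀ β {u v} → u ≗ v → R β u ≗ R β v
  R-cong []      u≗v m = refl
  R-cong (b ∷ β) u≗v m = cong₂ (λ x y → b *ᶠ x +ᶠ y) (shift-cong (D*-cong β u≗v) m) (D-cong b (R-cong β u≗v) m)

  -- The factor 1 - bT has constant term 1, so the coefficients of u can be recovered one after the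
  -- other.
  D-injective : ∀ b {u v} → D b u ≗ D b v → u ≗ v
  D-injective b {u} {v} eq m = begin
    u m                             ≡⟨ solve 2 (λ x y → x := x :- y :+ y) refl (u m) (b *ᶠ shift u m) ⟩
    D b u m +ᶠ b *ᶠ shift u m       ≡⟨ cong₂ (λ x y → x +ᶠ b *ᶠ y) (eq m) (shift-eq m) ⟩
    D b v m +ᶠ b *ᶠ shift v m       ≡⟨ solve 2 (λ x y → x :- y :+ y := x) refl (v m) (b *ᶠ shift v m) ⟩
    v m                             ∎
    where
    open ≡-Reasoning
    open 𝕊
    shift-eq : shift u ≗ shift v
    shift-eq zero    = refl
    shift-eq (suc m) = D-injective b eq m

  D*-injective : ∀ β {u v} → D* β u ≗ D* β v → u ≗ v
  D*-injective []      eq = eq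
  D*-injective (b ∷ β) eq = D*-injective β (D-injective b eq)

  D-+ : ∀ b u v → D b (λ m → u m +ᶠ v m) ≗ (λ m → D b u m +ᶠ D b v m)
  D-+ b u v zero    = solve 3 (λ b x y → x :+ y :- b :* con 0ℤ := (x :- b :* con 0ℤ) :+ (y :- b :* con 0ℤ)) refl b (u 0) (v 0)
    where open 𝕊
  D-+ b u v (suc m) = solve 5 (λ b x y z w → x :+ y :- b :* (z :+ w) := (x :- b :* z) :+ (y :- b :* w)) refl b (u (suc m)) (v (suc m)) (u m) (v m)
    where open 𝕊

  D-scale : ∀ b c u → D b (λ m → c *ᶠ u m) ≗ (λ m → c *ᶠ D b u m)
  D-scale b c u zero    = solve 3 (λ b c x → c :* x :- b :* con 0ℤ := c :* (x :- b :* con 0ℤ)) refl b c (u 0)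
    where open 𝕊
  D-scale b c u (suc m) = solve 4 (λ b c x y → c :* x :- b :* (c :* y) := c :* (x :- b :* y)) refl b c (u (suc m)) (u m)
    where open 𝕊

  D*-+ : ∀ β u v → D* β (λ m → u m +ᶠ v m) ≗ (λ m → D* β u m +ᶠ D* β v m)
  D*-+ []      u v m = refl
  D*-+ (b ∷ β) u v m = trans (D-cong b (D*-+ β u v) m) (D-+ b (D* β u) (D* β v) m)

  D*-scale : ∀ β c u → D* β (λ m → c *ᶠ u m) ≗ (λ m → c *ᶠ D* β u m)
  D*-scale []      c u m = refl
  D*-scale (b ∷ β) c u m = trans (D-cong b (D*-scale β c u) m) (D-scale b c (D* β u) m)

  D-comm : ∀ b c u → D b (D c u) ≗ D c (D b u)
  D-comm b c u zero          = solve 3 (λ b c x → x :- c :* con 0ℤ :- b :* con 0ℤ := x :- b :* con 0ℤ :- c :* con 0ℤ) refl b c (u 0)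
    where open 𝕊
  D-comm b c u (suc zero)    = solve 4 (λ b c x y → x :- c :* y :- b :* (y :- c :* con 0ℤ) := x :- b :* y :- c :* (y :- b :* con 0ℤ)) refl b c (u 1) (u 0)
    where open 𝕊
  D-comm b c u (suc (suc m)) = solve 5 (λ b c x y z → x :- c :* y :- b :* (y :- c :* z) := x :- b :* y :- c :* (y :- b :* z)) refl b c (u (suc (suc m))) (u (suc m)) (u m)
    where open 𝕊

  D-D*-comm : ∀ b β u → D b (D* β u) ≗ D* β (D b u)
  D-D*-comm b []      u m = refl
  D-D*-comm b (c ∷ β) u m = trans (D-comm b c (D* β u) m) (D-cong c (D-D*-comm b β u) m)

  D-shift : ∀ b c u → D b (λ m → c *ᶠ shift u m) ≗ (λ m → c *ᶠ shift (D b u) m)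
  D-shift b c u zero          = solve 2 (λ b c → c :* con 0ℤ :- b :* con 0ℤ := c :* con 0ℤ) refl b c
    where open 𝕊
  D-shift b c u (suc zero)    = solve 3 (λ b c x → c :* x :- b :* (c :* con 0ℤ) := c :* (x :- b :* con 0ℤ)) refl b c (u 0)
    where open 𝕊
  D-shift b c u (suc (suc m)) = solve 4 (λ b c x y → c :* x :- b :* (c :* y) := c :* (x :- b :* y)) refl b c (u (suc m)) (u m)
    where open 𝕊

  D-R-comm : ∀ b β u → D b (R β u) ≗ R β (D b u)
  D-R-comm b []      u zero    = x-y0≡0 refl refl
  D-R-comm b []      u (suc m) = x-y0≡0 refl refl
  D-R-comm b (c ∷ β) u m = begin
    D b (λ k → c *ᶠ shift (D* β u) k +ᶠ D c (R β u) k) m             ≡⟨ D-+ b _ _ m ⟩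
    D b (λ k → c *ᶠ shift (D* β u) k) m +ᶠ D b (D c (R β u)) m       ≡⟨ cong₂ _+ᶠ_ (D-shift b c (D* β u) m) (D-comm b c (R β u) m) ⟩
    c *ᶠ shift (D b (D* β u)) m +ᶠ D c (D b (R β u)) m
      ≡⟨ cong₂ (λ x y → c *ᶠ x +ᶠ y) (shift-cong (D-D*-comm b β u) m) (D-cong c (D-R-comm b β u) m) ⟩
    R (c ∷ β) (D b u) m                                               ∎
    where open ≡-Reasoning

  D*-R-comm : ∀ γ β u → D* γ (R β u) ≗ R β (D* γ u)
  D*-R-comm []      β u m = refl
  D*-R-comm (c ∷ γ) β u m = trans (D-cong c (D*-R-comm γ β u) m) (D-R-comm c β (D* γ u) m)

  -- Leibniz rule: the derivation sends 1 - bT to -bT, which gives the correction term.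
  θ-D : ∀ b u → D b (θ u) ≗ (λ m → θ (D b u) m +ᶠ b *ᶠ shift u m)
  θ-D b u zero    = solve 2 (λ b x → con 0ℤ :* x :- b :* con 0ℤ := con 0ℤ :* (x :- b :* con 0ℤ) :+ b :* con 0ℤ) refl b (u 0)
    where open 𝕊
  θ-D b u (suc m) = trans
    -- `suc m ×ᶠ 1ᶠ` is `1ᶠ +ᶠ (m ×ᶠ 1ᶠ)`; the solver treats this `1ᶠ` as an unknown `o`, and the
    -- factor left over is removed afterwards.
    (solve 5 (λ o b k x y → (o :+ k) :* x :- b :* (k :* y) := (o :+ k) :* (x :- b :* y) :+ o :* (b :* y))
      refl 1ᶠ b (m ×ᶠ 1ᶠ) (u (suc m)) (u m))
    (cong (θ (D b u) (suc m) +ᶠ_) (*-identityˡ (b *ᶠ u m)))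
    where open 𝕊

  -- Iterated Leibniz rule: Qθu = θ(Qu) - (θQ)u, and -θQ = -TQ′ is the multiplier of `R`.
  D*-θ : ∀ β u → D* β (θ u) ≗ (λ m → θ (D* β u) m +ᶠ R β u m)
  D*-θ []      u m = sym (+-identityʳ _)
  D*-θ (b ∷ β) u m = begin
    D b (D* β (θ u)) m                                                   ≡⟨ D-cong b (D*-θ β u) m ⟩
    D b (λ k → θ (D* β u) k +ᶠ R β u k) m                                ≡⟨ D-+ b _ _ m ⟩
    D b (θ (D* β u)) m +ᶠ D b (R β u) m                                  ≡⟨ cong (_+ᶠ D b (R β u) m) (θ-D b (D* β u) m) ⟩
    θ (D* (b ∷ β) u) m +ᶠ b *ᶠ shift (D* β u) m +ᶠ D b (R β u) m         ≡⟨ +-assoc _ _ _ ⟩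
    θ (D* (b ∷ β) u) m +ᶠ R (b ∷ β) u m                                  ∎
    where open ≡-Reasoning

  -- In terms of power series this is Q T Φ′ = k (- T Q′) Φ for Φ = Q⁻ᵏ.
  logarithmic-derivative : ∀ β k u v → D* β u ≗ v → D* β (θ v) ≗ (λ m → (k ×ᶠ 1ᶠ) *ᶠ R β v m) →
                           D* β (θ u) ≗ (λ m → (suc k ×ᶠ 1ᶠ) *ᶠ R β u m)
  -- Both sides are multiplied by Q once more. The Leibniz rule turns Q(Qθu) into Qθv + Q(Ru), where
  -- `IH` replaces Qθv by k Rv, and Rv = Q(Ru) because `R` commutes with Q.
  logarithmic-derivative β k u v D*u≗v IH = D*-injective β λ m → begin
    D* β (D* β (θ u)) m                                         ≡⟨ D*-cong β (D*-θ β u) m ⟩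
    D* β (λ i → θ (D* β u) i +ᶠ R β u i) m                      ≡⟨ D*-+ β _ _ m ⟩
    D* β (θ (D* β u)) m +ᶠ D* β (R β u) m                       ≡⟨ cong (_+ᶠ D* β (R β u) m) (D*-cong β (λ i → cong ((i ×ᶠ 1ᶠ) *ᶠ_) (D*u≗v i)) m) ⟩
    D* β (θ v) m +ᶠ D* β (R β u) m                              ≡⟨ cong (_+ᶠ D* β (R β u) m) (IH m) ⟩
    (k ×ᶠ 1ᶠ) *ᶠ R β v m +ᶠ D* β (R β u) m
      ≡⟨ cong (λ t → (k ×ᶠ 1ᶠ) *ᶠ t +ᶠ D* β (R β u) m) (trans (D*-R-comm β β u m) (R-cong β D*u≗v m)) ⟨
    (k ×ᶠ 1ᶠ) *ᶠ D* β (R β u) m +ᶠ D* β (R β u) m               ≡⟨ cong (((k ×ᶠ 1ᶠ) *ᶠ D* β (R β u) m) +ᶠ_) (*-identityˡ _) ⟨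
    (k ×ᶠ 1ᶠ) *ᶠ D* β (R β u) m +ᶠ 1ᶠ *ᶠ D* β (R β u) m         ≡⟨ trans (+-comm _ _) (sym (distribʳ _ _ _)) ⟩
    (suc k ×ᶠ 1ᶠ) *ᶠ D* β (R β u) m                             ≡⟨ D*-scale β (suc k ×ᶠ 1ᶠ) (R β u) m ⟨
    D* β (λ i → (suc k ×ᶠ 1ᶠ) *ᶠ R β u i) m                     ∎
    where open ≡-Reasoning

  -- Zero k m: the k coefficients before the m-th vanish, so multiplication by a polynomial of degree ≤ k
  -- with constant term c multiplies the m-th coefficient by c.
  module Window (u : ℕ → F) where

    Zero : ℕ → ℕ → Set
    Zero k m = ∀ i → i < m → m ≤ i + k → u i ≡ 0ᶠ

    Zero-pred : ∀ {k m} → Zero (suc k) (suc m) → Zero k m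
    Zero-pred {k} {m} zero-um i i<m m≤i+k = zero-um i (ℕₚ.m<n⇒m<1+n i<m) (subst (suc m ≤_) (sym (ℕₚ.+-suc i k)) (s≤s m≤i+k))

    Zero-weaken : ∀ {k m} → Zero (suc k) m → Zero k m
    Zero-weaken {k} zero-um i i<m m≤i+k = zero-um i i<m (ℕₚ.≤-trans m≤i+k (ℕₚ.+-monoʳ-≤ i (ℕₚ.n≤1+n k)))

    D*-window : ∀ β {m} → Zero (length β) m → D* β u m ≡ u m
    shift-D*-window : ∀ β {m} → Zero (suc (length β)) m → shift (D* β u) m ≡ 0ᶠ

    D*-window []      zero-u = refl
    D*-window (b ∷ β) zero-u = trans (x-y0≡x (shift-D*-window β zero-u)) (D*-window β (Zero-weaken zero-u))

    shift-D*-window β {zero}  zero-u = refl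
    shift-D*-window β {suc m} zero-u = trans (D*-window β (Zero-pred zero-u))
      (zero-u m (ℕₚ.n<1+n m) (ℕₚ.m<m+n m z<s))

    -- The multiplier -TQ′ has degree at most |β| and constant term 0.
    R-window : ∀ β {m} → Zero (length β) m → R β u m ≡ 0ᶠ
    R-window []      zero-u = refl
    R-window (b ∷ β) {m} zero-u = x0+0≡0 (shift-D*-window β zero-u)
      (x-y0≡0 (R-window β (Zero-weaken zero-u)) (shift-zero m zero-u))
      where
      shift-zero : ∀ m → Zero (suc (length β)) m → shift (R β u) m ≡ 0ᶠ
      shift-zero zero    _      = refl
      shift-zero (suc m) zero-u = R-window β (Zero-pred zero-u)

  -- Compare the coefficients of Tᵐ in Qθu = kRu: after a window of zeros the left one is m uₘ and
  -- the right one is 0, and m is nonzero in the field because 0 < m < p.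
  zero-window : ∀ β {k u m} → D* β (θ u) ≗ (λ i → k *ᶠ R β u i) → 0 < m → m < p →
                Window.Zero u (length β) m → u m ≡ 0ᶠ
  zero-window β {k} {u} {m} eq 0<m m<p zero-u = *-cancelˡ (×1-≢0 0<m m<p) (begin
    θ u m                     ≡⟨ Window.D*-window (θ u) β (λ i i<m m≤ → trans (cong ((i ×ᶠ 1ᶠ) *ᶠ_) (zero-u i i<m m≤)) (zeroʳ _)) ⟨
    D* β (θ u) m              ≡⟨ eq m ⟩
    k *ᶠ R β u m              ≡⟨ cong (k *ᶠ_) (Window.R-window u β zero-u) ⟩
    k *ᶠ 0ᶠ                   ≡⟨ trans (zeroʳ k) (sym (zeroʳ _)) ⟩
    (m ×ᶠ 1ᶠ) *ᶠ 0ᶠ           ∎)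
    where open ≡-Reasoning

  zeros-extend : ∀ β {k u s} → D* β (θ u) ≗ (λ i → k *ᶠ R β u i) →
                 (∀ {m} → s < m → m ≤ s + length β → u m ≡ 0ᶠ) →
                 ∀ {m} → s < m → m < p → u m ≡ 0ᶠ
  zeros-extend β {k} {u} {s} eq zeros {m} s<m m<p = below (suc m) s<m (ℕₚ.n<1+n m) m<p
    where
    -- `t` bounds m for a course-of-values induction. Once m exceeds s + |β|, the |β| indices before
    -- it all exceed s, so their coefficients are already known to vanish.
    below : ∀ t {m} → s < m → m < t → m < p → u m ≡ 0ᶠ
    below (suc t) {m} s<m (s≤s m≤t) m<p with m ≤? s + length β
    ... | yes m≤ = zeros s<m m≤
    ... | no  m≰ = zero-window β eq (ℕₚ.≤-<-trans z≤n s<m) m<p λ i i<m m≤i+β →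
      below t (ℕₚ.+-cancelʳ-< (length β) s i (ℕₚ.<-≤-trans (ℕₚ.≰⇒> m≰) m≤i+β)) (ℕₚ.<-≤-trans i<m m≤t) (ℕₚ.<-trans i<m m<p)

  -- The series of `h (x ∷ l)` is the product of 1/(1 - yT) over all entries y, and multiplication
  -- by 1 - xT cancels one factor.
  D-h : ∀ x l → D x (h (x ∷ l)) ≗ h l
  D-h x l zero    = trans (x-y0≡x refl) (sym (h-0 l))
  D-h x l (suc m) = solve 2 (λ a b → a :+ b :- a := b) refl (x *ᶠ h (x ∷ l) m) (h l (suc m))
    where open 𝕊

  D*-h : ∀ β l → D* β (h (β ++ l)) ≗ h l
  D*-h []      l m = refl
  D*-h (b ∷ β) l m = trans (D-D*-comm b β (h (b ∷ β ++ l)) m) (trans (D*-cong β (D-h b (β ++ l)) m) (D*-h β l m))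

  copies : ℕ → List F → List F
  copies zero    β = []
  copies (suc k) β = β ++ copies k β

  -- The series of `h (copies k β)` is Q⁻ᵏ, so this is the equation for its logarithmic derivative.
  -- The induction on k starts from the constant series 1, which the derivation kills.
  h-copies : ∀ β k → D* β (θ (h (copies k β))) ≗ (λ m → (k ×ᶠ 1ᶠ) *ᶠ R β (h (copies k β)) m)
  h-copies β zero    m = trans (D*-cong β θδ≗0 m) (trans (D*-scale β 0ᶠ (λ _ → 0ᶠ) m) (trans (zeroˡ _) (sym (zeroˡ _))))
    where
    θδ≗0 : θ (h []) ≗ (λ _ → 0ᶠ *ᶠ 0ᶠ)
    θδ≗0 zero    = trans (zeroˡ _) (sym (zeroˡ _))
    θδ≗0 (suc m) = trans (zeroʳ _) (sym (zeroˡ _))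
  h-copies β (suc k) = logarithmic-derivative β k (h (copies (suc k) β)) (h (copies k β)) (D*-h β (copies k β)) (h-copies β k)

  -- Multiplication by 1 - xT mixes the coefficients at m and m - 1, so each stripped entry costs
  -- the lowest index of the interval of zeros.
  strip : ∀ l {r t} → (∀ {m} → t < m → m < p → h (l ++ r) m ≡ 0ᶠ) → ∀ {m} → t + length l < m → m < p → h r m ≡ 0ᶠ
  strip []      {r} {t} zeros {m} t<m m<p = zeros (subst (_< m) (ℕₚ.+-identityʳ t) t<m) m<p
  strip (x ∷ l) {r} {t} zeros {m} t<m m<p = strip l {t = suc t} step (subst (_< m) (ℕₚ.+-suc t (length l)) t<m) m<p
    where
    step : ∀ {m} → suc t < m → m < p → h (l ++ r) m ≡ 0ᶠ
    step {suc m} (s≤s t<m) m<p = trans (sym (D-h x (l ++ r) (suc m)))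
      (x-y0≡0 (zeros (ℕₚ.m<n⇒m<1+n t<m) m<p) (zeros t<m (ℕₚ.<-trans (ℕₚ.n<1+n m) m<p)))

  last-two : ∀ x y l → Unique (x ∷ y ∷ l) → ∃ λ (l′ : List F) → ∃ λ (a : F) → ∃ λ (b : F) → a ≢ b × x ∷ y ∷ l ≡ l′ ++ a ∷ b ∷ []
  last-two x y []      ((x≢y ∷ _) ∷ _) = [] , x , y , x≢y , refl
  last-two x y (z ∷ l) (_ ∷ l!) with last-two y z l l!
  ... | l′ , a , b , a≢b , eq = x ∷ l′ , a , b , a≢b , cong (x ∷_) eq

  copies-snoc : ∀ k β → copies (suc k) β ≡ copies k β ++ β
  copies-snoc zero    β = ++-identityʳ β
  copies-snoc (suc k) β = trans (cong (β ++_) (copies-snoc k β)) (sym (++-assoc β (copies k β) β))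

  length-copies : ∀ k β → length (copies k β) ≡ k * length β
  length-copies zero    β = refl
  length-copies (suc k) β = trans (length-++ β) (cong (length β +_) (length-copies k β))

  -- t ↦ tᵖ is the identity, and the divided difference of the identity at two points is 1.
  h-pair : ∀ {a b m} → a ≢ b → suc m ≡ p → h (a ∷ b ∷ []) m ≡ 1ᶠ
  h-pair {a} {b} {m} a≢b eq = begin
    h (a ∷ b ∷ []) m                ≡⟨ dd≡h a (b ∷ []) m ⟨
    dd (a ∷ b ∷ []) (m + 1)         ≡⟨ cong (dd (a ∷ b ∷ [])) (trans (ℕₚ.+-comm m 1) eq) ⟩
    dd (a ∷ b ∷ []) p               ≡⟨ dd-period ((a≢b ∷ []) ∷ [] ∷ []) 0 ⟩
    a *ᶠ 0ᶠ +ᶠ 1ᶠ                   ≡⟨ x0+y≡y refl ⟩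
    1ᶠ                              ∎
    where open ≡-Reasoning

  -- By the recurrence the zeros spread to all indices strictly between s and p. Stripping all
  -- entries except the final a and b retains a zero at p - 1, against `h-pair`.
  h-copies-≢0 : ∀ β l′ {a b} → a ≢ b → β ≡ l′ ++ a ∷ b ∷ [] → ∀ k s → s + suc k * length β ≡ p →
                ¬ (∀ {m} → s < m → m ≤ s + length β → h (copies (suc k) β) m ≡ 0ᶠ)
  h-copies-≢0 β l′ {a} {b} a≢b β≡ k s s+N≡p zeros =
    1≢0 (trans (sym (h-pair a≢b suc-t≡p)) (strip pre zeros′ t< (ℕₚ.≤-reflexive suc-t≡p)))
    where
    pre : List F
    pre = copies k β ++ l′
    all≡ : copies (suc k) β ≡ pre ++ a ∷ b ∷ []
    all≡ = trans (copies-snoc k β) (trans (cong (copies k β ++_) β≡) (sym (++-assoc (copies k β) l′ _)))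
    zeros′ : ∀ {m} → s < m → m < p → h (pre ++ a ∷ b ∷ []) m ≡ 0ᶠ
    zeros′ {m} s<m m<p = subst (λ l → h l m ≡ 0ᶠ) all≡ (zeros-extend β (h-copies β (suc k)) zeros s<m m<p)
    -- With N entries in all, N - 2 are stripped, so the remaining zeros lie above s + N - 2 = p -
    -- 2: exactly the index p - 1 survives.
    suc-t≡p : suc (suc (s + length pre)) ≡ p
    suc-t≡p = begin
      suc (suc (s + length pre))              ≡⟨ ℕₚ.+-comm 2 (s + length pre) ⟩
      s + length pre + 2                      ≡⟨ ℕₚ.+-assoc s (length pre) 2 ⟩
      s + (length pre + 2)                    ≡⟨ cong (s +_) (length-++ pre) ⟨
      s + length (pre ++ a ∷ b ∷ [])          ≡⟨ cong (λ l → s + length l) all≡ ⟨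
      s + length (copies (suc k) β)           ≡⟨ cong (s +_) (length-copies (suc k) β) ⟩
      s + suc k * length β                    ≡⟨ s+N≡p ⟩
      p                                       ∎
      where open ≡-Reasoning
    t< : s + length pre < suc (s + length pre)
    t< = ℕₚ.n<1+n _

  -- Slopes determined by a grid of at most p points

  IsSlope : List F → F → Set
  IsSlope A r = ∃ λ q → q ∈ cartesianProduct A A × ∃ λ q′ → q′ ∈ cartesianProduct A A ×
                proj₁ q ≢ proj₁ q′ × proj₂ q -ᶠ proj₂ q′ ≡ r *ᶠ (proj₁ q -ᶠ proj₁ q′)

  isSlope? : ∀ A → Decidable (IsSlope A)
  isSlope? A r = map′
    (λ any → let q , q∈ , any′ = find any ; q′ , q′∈ , slope = find any′ in q , q∈ , q′ , q′∈ , slope)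
    (λ (q , q∈ , q′ , q′∈ , slope) → lose q∈ (lose q′∈ slope))
    (any? (λ q → any? (λ q′ → ¬? (proj₁ q ≟ proj₁ q′) ×-dec (proj₂ q -ᶠ proj₂ q′) ≟ (r *ᶠ (proj₁ q -ᶠ proj₁ q′)))
      (cartesianProduct A A)) (cartesianProduct A A))

  slopes : List F → List F
  slopes A = filter (isSlope? A) elements

  -- For slope 0 the intercept of a point is its second coordinate. This is how the power Q⁻ᵏ, with
  -- k the length of `xs`, arises from the grid.
  map-ℓ0 : ∀ xs ys → map (ℓ 0ᶠ) (cartesianProduct xs ys) ≡ copies (length xs) ys
  map-ℓ0 []       ys = refl
  map-ℓ0 (x ∷ xs) ys = trans (map-++ (ℓ 0ᶠ) (map (x ,_) ys) (cartesianProduct xs ys))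
    (cong₂ _++_ (trans (sym (map-∘ ys)) (trans (map-cong ℓ0 ys) (map-id ys))) (map-ℓ0 xs ys))
    where
    ℓ0 : ∀ y → ℓ 0ᶠ (x , y) ≡ y
    ℓ0 y = solve 2 (λ x y → y :- con 0ℤ :* x := y) refl x y
      where open 𝕊

  -- Two grid points with equal intercepts either witness the slope r or share the first coordinate,
  -- and then also the second.
  ℓ-injective : ∀ {A r} → ¬ IsSlope A r → ∀ {q q′} → q ∈ cartesianProduct A A → q′ ∈ cartesianProduct A A →
                ℓ r q ≡ ℓ r q′ → q ≡ q′
  ℓ-injective {A} {r} ¬slope {a , b} {a′ , b′} q∈ q′∈ eq with a ≟ a′
  ... | no  a≢a′ = contradiction ((a , b) , q∈ , (a′ , b′) , q′∈ , a≢a′ , (begin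
      b -ᶠ b′                                   ≡⟨ solve 5 (λ a b a′ b′ r → b :- b′ := (b :- r :* a) :- (b′ :- r :* a′) :+ r :* (a :- a′)) refl a b a′ b′ r ⟩
      ℓ r (a , b) -ᶠ ℓ r (a′ , b′) +ᶠ r *ᶠ (a -ᶠ a′) ≡⟨ cong (λ t → t -ᶠ ℓ r (a′ , b′) +ᶠ r *ᶠ (a -ᶠ a′)) eq ⟩
      ℓ r (a′ , b′) -ᶠ ℓ r (a′ , b′) +ᶠ r *ᶠ (a -ᶠ a′) ≡⟨ trans (cong (_+ᶠ r *ᶠ (a -ᶠ a′)) (x-x≡0 _)) (+-identityˡ _) ⟩
      r *ᶠ (a -ᶠ a′)                            ∎)) ¬slope
    where
    open ≡-Reasoning
    open 𝕊
  ... | yes refl = cong (a ,_) (begin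
      b                          ≡⟨ solve 2 (λ b c → b := b :- c :+ c) refl b (r *ᶠ a) ⟩
      ℓ r (a , b) +ᶠ r *ᶠ a      ≡⟨ cong (_+ᶠ r *ᶠ a) eq ⟩
      ℓ r (a , b′) +ᶠ r *ᶠ a     ≡⟨ solve 2 (λ b c → b :- c :+ c := b) refl b′ (r *ᶠ a) ⟩
      b′                         ∎)
    where
    open ≡-Reasoning
    open 𝕊

  -- Let s = p - n². With too few slopes there are more than s + n non-slopes. For s < m ≤ s + n
  -- each of them is a root of the function sending r to hₘ of the intercepts, which has degree at
  -- most m. So this function vanishes at r = 0 too, and the n consecutive zeros contradict
  -- `h-copies-≢0`.
  many-slopes : ∀ {A} → Unique A → 2 ≤ length A → length A * length A ≤ p →
                length A * length A ≤ length A + length (slopes A)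
  many-slopes {A} A! 2≤n n²≤p with length A * length A ≤? length A + length (slopes A)
  ... | yes le = le
  ... | no  ¬le = ⊥-elim (vanish A A! 2≤n (ℕₚ.m∸n+n≡m n²≤p) zeros)
    where
    open ℕₚ.≤-Reasoning
    n N s : ℕ
    n = length A
    N = n * n
    s = p ∸ N
    -- The list is quantified afresh so that two leading entries can be split off by matching.
    vanish : ∀ A → Unique A → 2 ≤ length A → p ∸ length A * length A + length A * length A ≡ p →
             ¬ (∀ {m} → p ∸ length A * length A < m → m ≤ p ∸ length A * length A + length A → h (copies (length A) A) m ≡ 0ᶠ)
    vanish (x ∷ y ∷ l) A! _ s+N≡p = let l′ , _ , _ , a≢b , A≡ = last-two x y l A! in
      h-copies-≢0 (x ∷ y ∷ l) l′ a≢b A≡ (suc (length l)) _ s+N≡p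
    vanish (_ ∷ []) _ (s≤s ())
    non-slopes : List F
    non-slopes = filter (¬? ∘ isSlope? A) elements
    count : length (slopes A) + length non-slopes ≡ p
    count = trans (cong₂ _+_ (length-filter-∑ (isSlope? A) elements) (length-filter-∑ (¬? ∘ isSlope? A) elements))
      (trans (sym (∑-distrib-+ elements _ _)) (trans (∑-cong elements (λ x → 𝟙+¬≡1 (isSlope? A x))) (trans (sym (length-∑ elements)) p-length)))
    -- This uses n ≥ 2 and places m ≤ s + n inside the range m ≤ s + N - 2 of `h-gap`.
    n+2≤N : n + 2 ≤ N
    n+2≤N = begin
      n + 2     ≤⟨ ℕₚ.+-monoʳ-≤ n 2≤n ⟩
      n + n     ≡⟨ cong (n +_) (ℕₚ.+-identityʳ n) ⟨
      2 * n     ≤⟨ ℕₚ.*-monoˡ-≤ n 2≤n ⟩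
      n * n     ∎
    s+n<non-slopes : s + n < length non-slopes
    s+n<non-slopes = ℕₚ.+-cancelˡ-< (length (slopes A)) _ _ (begin-strict
      length (slopes A) + (s + n)   ≡⟨ solve 3 (λ a b c → a :+ (b :+ c) := b :+ (c :+ a)) refl (length (slopes A)) s n ⟩
      s + (n + length (slopes A))   <⟨ ℕₚ.+-monoʳ-< s (ℕₚ.≰⇒> ¬le) ⟩
      s + N                         ≡⟨ ℕₚ.m∸n+n≡m n²≤p ⟩
      p                             ≡⟨ count ⟨
      length (slopes A) + length non-slopes ∎)
      where open +-*-Solver
    zeros : ∀ {m} → s < m → m ≤ s + n → h (copies n A) m ≡ 0ᶠ
    zeros {m} s<m m≤s+n = subst (λ l → h l m ≡ 0ᶠ) (map-ℓ0 A A)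
      (Deg-roots m (h-Deg (cartesianProduct A A) m) (Unique.filter⁺ (¬? ∘ isSlope? A) elements!)
        (ℕₚ.≤-<-trans m≤s+n s+n<non-slopes) root 0ᶠ)
      where
      root : ∀ {r} → r ∈ non-slopes → h (map (ℓ r) (cartesianProduct A A)) m ≡ 0ᶠ
      root {r} r∈ = subst (λ k → h points k ≡ 0ᶠ) s+suc-i≡m (h-gap points! s+points≡p i<points)
        where
        points : List F
        points = map (ℓ r) (cartesianProduct A A)
        points! : Unique points
        points! = unique-map (ℓ-injective {A} {r} (proj₂ (∈-filter⁻ (¬? ∘ isSlope? A) {xs = elements} r∈))) (Unique.cartesianProduct⁺ A! A!)
        length-points : length points ≡ N
        length-points = trans (length-map (ℓ r) (cartesianProduct A A)) (length-× A A)
        i : ℕ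
        i = m ∸ suc s
        s+suc-i≡m : s + suc i ≡ m
        s+suc-i≡m = trans (ℕₚ.+-suc s i) (ℕₚ.m+[n∸m]≡n s<m)
        s+points≡p : s + length points ≡ p
        s+points≡p = trans (cong (s +_) length-points) (ℕₚ.m∸n+n≡m n²≤p)
        i<points : suc (suc i) < length points
        i<points = begin
          suc (suc (suc i))    ≤⟨ s≤s (s≤s (ℕₚ.+-cancelˡ-≤ s _ _ (ℕₚ.≤-trans (ℕₚ.≤-reflexive s+suc-i≡m) m≤s+n))) ⟩
          suc (suc n)          ≡⟨ ℕₚ.+-comm 2 n ⟩
          n + 2                ≤⟨ n+2≤N ⟩
          N                    ≡⟨ length-points ⟨
          length points        ∎

-- Popular differences

𝟙-⊎ : (P? : Dec P) (Q? : Dec Q) → 𝟙 (P? ⊎-dec Q?) ≤ 𝟙 P? + 𝟙 Q?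
𝟙-⊎ (yes _) Q?      = s≤s z≤n
𝟙-⊎ (no _)  (yes _) = ≤-reflexive refl
𝟙-⊎ (no _)  (no _)  = z≤n

𝟙-× : (P? : Dec P) (Q? : Dec Q) → 𝟙 (P? ×-dec Q?) ≡ 𝟙 P? * 𝟙 Q?
𝟙-× (yes _) (yes _) = refl
𝟙-× (yes _) (no _)  = refl
𝟙-× (no _)  Q?      = refl

module Injections (_≟_ : DecidableEquality J) where

  open Fibres _≟_

  injection-≤ : {xs : List I} (zs : List J) (f : I → J) {S : Pred J _} (S? : Decidable S) → Unique xs →
                (∀ {x} → x ∈ xs → f x ∈ zs) → (∀ {x} → x ∈ xs → S (f x)) →
                (∀ {x y} → x ∈ xs → y ∈ xs → f x ≡ f y → x ≡ y) →
                length xs ≤ ∑[ z ∈ zs ] 𝟙 (S? z)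
  injection-≤ {xs = xs} zs f S? xs! f∈ S-f inj = begin
    length xs                                       ≡⟨ length-∑ xs ⟩
    ∑[ _ ∈ xs ] 1                                   ≤⟨ ∑-fibres-≤ xs zs f (λ _ → 1) f∈ ⟩
    ∑[ z ∈ zs ] ∑[ x ∈ xs ] (𝟙 (f x ≟ z) * 1)       ≤⟨ ∑-mono zs (λ {z} _ → fibre≤ z) ⟩
    ∑[ z ∈ zs ] 𝟙 (S? z)                            ∎
    where
    open ℕₚ.≤-Reasoning
    fibre≤ : ∀ z → ∑[ x ∈ xs ] (𝟙 (f x ≟ z) * 1) ≤ 𝟙 (S? z)
    fibre≤ z = ≤-trans (≤-reflexive (∑-cong xs (λ x → ℕₚ.*-identityʳ (𝟙 (f x ≟ z))))) (by (S? z))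
      where
      by : (d : Dec _) → ∑[ x ∈ xs ] 𝟙 (f x ≟ z) ≤ 𝟙 d
      by (yes _) = ∑-atMostOne (λ x → f x ≟ z) xs! (λ x∈ y∈ p q → inj x∈ y∈ (trans p (sym q)))
      by (no ¬s) = ≤-reflexive (∑-none (λ x → f x ≟ z) xs (λ { x∈ refl → ¬s (S-f x∈) }))

  injection-length-≤ : {xs : List I} (zs : List J) (f : I → J) → Unique xs → (∀ {x} → x ∈ xs → f x ∈ zs) →
                       (∀ {x y} → x ∈ xs → y ∈ xs → f x ≡ f y → x ≡ y) → length xs ≤ length zs
  injection-length-≤ zs f xs! f∈ inj = ≤-trans
    (injection-≤ zs f (λ z → DecMembership._∈?_ _≟_ z zs) xs! f∈ f∈ inj)
    (≤-trans (∑-≤const zs 1 (λ {z} _ → 𝟙≤1 _)) (≤-reflexive (ℕₚ.*-identityʳ (length zs))))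

module _ (𝔽ₚ : PrimeField) where

  open PrimeField 𝔽ₚ

  -- V holds (a - a′)bc for all but a small proportion of the quadruples; the dilates by bc of every difference of A′ are then differences
  -- of V in many ways, which bounds the number of ratios of differences of A′.
  module PopularDifferences
    {A B C V : List F} (A! : Unique A) (B! : Unique B) (C! : Unique C) (V! : Unique V) {n : ℕ}
    (A≡n : length A ≡ n) (B≡n : length B ≡ n) (C≡n : length C ≡ n) .{{_ : NonZero n}}
    (B≢0 : ∀ {b} → b ∈ B → b ≢ 0ᶠ) (C≢0 : ∀ {c} → c ∈ C → c ≢ 0ᶠ)
    {Bad : F → F → F → F → Set} (bad? : ∀ a a′ b c → Dec (Bad a a′ b c))
    (good∈V : ∀ {a a′ b c} → a ∈ A → a′ ∈ A → b ∈ B → c ∈ C → ¬ Bad a a′ b c → (a -ᶠ a′) *ᶠ (b *ᶠ c) ∈ V)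
    (few-bad : 32 * (∑[ a ∈ A ] ∑[ a′ ∈ A ] ∑[ b ∈ B ] ∑[ c ∈ C ] 𝟙 (bad? a a′ b c)) ≤ n * (n * (n * n)))
    where

    open RédeiSzőnyi 𝔽ₚ using (slopes; isSlope?; IsSlope)
    open Injections _≟_
    open DecMembership _≟_ using (_∈?_)

    bads : F → ℕ
    bads a = ∑[ a′ ∈ A ] ∑[ b ∈ B ] ∑[ c ∈ C ] 𝟙 (bad? a a′ b c)

    A′ : List F
    A′ = filter (λ a → 16 * bads a ≤? n * (n * n)) A

    A′! : Unique A′
    A′! = Unique.filter⁺ (λ a → 16 * bads a ≤? n * (n * n)) A!

    A′⊆A : ∀ {a} → a ∈ A′ → a ∈ A
    A′⊆A = proj₁ ∘ ∈-filter⁻ (λ a → 16 * bads a ≤? n * (n * n)) {xs = A}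

    A′-bads : ∀ {a} → a ∈ A′ → 16 * bads a ≤ n * (n * n)
    A′-bads = proj₂ ∘ ∈-filter⁻ (λ a → 16 * bads a ≤? n * (n * n)) {xs = A}

    private
      instance
        n²-nonZero : NonZero (n * n)
        n²-nonZero = ℕₚ.m*n≢0 n n
        n³-nonZero : NonZero (n * (n * n))
        n³-nonZero = ℕₚ.m*n≢0 n (n * n)

    -- Markov's inequality: each discarded a accounts for more than n³/16 of the at most n⁴/32 bad
    -- quadruples, so at most n/2 are discarded.
    n≤2A′ : n ≤ 2 * length A′
    n≤2A′ = ℕₚ.+-cancelʳ-≤ n n (2 * length A′) (begin
      n + n                                       ≡⟨ cong (n +_) (ℕₚ.+-identityʳ n) ⟨
      2 * n                                       ≡⟨ cong (2 *_) A≡n ⟨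
      2 * length A                                ≡⟨ cong (2 *_) split ⟩
      2 * (length A′ + (∑[ a ∈ A ] 𝟙 (¬? (few? a)))) ≡⟨ ℕₚ.*-distribˡ-+ 2 (length A′) _ ⟩
      2 * length A′ + 2 * (∑[ a ∈ A ] 𝟙 (¬? (few? a))) ≤⟨ ℕₚ.+-monoʳ-≤ (2 * length A′) removed ⟩
      2 * length A′ + n                           ∎)
      where
      open ℕₚ.≤-Reasoning
      few? : ∀ a → Dec (16 * bads a ≤ n * (n * n))
      few? a = 16 * bads a ≤? n * (n * n)
      split : length A ≡ length A′ + (∑[ a ∈ A ] 𝟙 (¬? (few? a)))
      split = trans (length-∑ A) (trans (∑-cong A (λ a → sym (𝟙+¬≡1 (few? a))))
        (trans (∑-distrib-+ A _ _) (cong (_+ (∑[ a ∈ A ] 𝟙 (¬? (few? a)))) (sym (length-filter-∑ few? A)))))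
      removed : 2 * (∑[ a ∈ A ] 𝟙 (¬? (few? a))) ≤ n
      removed = ℕₚ.*-cancelʳ-≤ _ n (n * (n * n)) (begin
        2 * (∑[ a ∈ A ] 𝟙 (¬? (few? a))) * (n * (n * n))     ≡⟨ ℕₚ.*-assoc 2 (∑[ a ∈ A ] 𝟙 (¬? (few? a))) (n * (n * n)) ⟩
        2 * ((∑[ a ∈ A ] 𝟙 (¬? (few? a))) * (n * (n * n)))   ≡⟨ cong (2 *_) (∑-* A _ (n * (n * n))) ⟩
        2 * (∑[ a ∈ A ] (𝟙 (¬? (few? a)) * (n * (n * n))))   ≤⟨ ℕₚ.*-monoʳ-≤ 2 (∑-mono A (λ {a} _ → 𝟙*≤ (¬? (few? a)) (ℕₚ.<⇒≤ ∘ ℕₚ.≰⇒>))) ⟩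
        2 * (∑[ a ∈ A ] (16 * bads a))                       ≡⟨ cong (2 *_) (*-∑ 16 A bads) ⟨
        2 * (16 * (∑[ a ∈ A ] bads a))                       ≡⟨ ℕₚ.*-assoc 2 16 (∑ A bads) ⟨
        32 * (∑[ a ∈ A ] bads a)                             ≤⟨ few-bad ⟩
        n * (n * (n * n))                                    ∎)

    -- The sum is the number of representations of w as a difference of two elements of `V`; popular
    -- means at least n/2 of them.
    popular? : ∀ w → Dec (n ≤ 2 * (∑[ v ∈ V ] 𝟙 ((v -ᶠ w) ∈? V)))
    popular? w = n ≤? 2 * (∑[ v ∈ V ] 𝟙 ((v -ᶠ w) ∈? V))

    V⁺ : List F
    V⁺ = filter popular? elements

    V⁺! : Unique V⁺
    V⁺! = Unique.filter⁺ popular? elements!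

    -- Double counting of the pairs (v , w) with v - w in `V`: each popular w has at least n/2
    -- partners v, and each v has at most |V| partners because v - w determines w.
    few-popular : length V⁺ * n ≤ 2 * (length V * length V)
    few-popular = begin
      length V⁺ * n                                              ≤⟨ ∑-≥const V⁺ n (λ w∈ → proj₂ (∈-filter⁻ popular? {xs = elements} w∈)) ⟩
      ∑[ w ∈ V⁺ ] (2 * (∑[ v ∈ V ] 𝟙 ((v -ᶠ w) ∈? V)))           ≡⟨ *-∑ 2 V⁺ _ ⟨
      2 * (∑[ w ∈ V⁺ ] ∑[ v ∈ V ] 𝟙 ((v -ᶠ w) ∈? V))             ≡⟨ cong (2 *_) (∑-swap V⁺ V _) ⟩
      2 * (∑[ v ∈ V ] ∑[ w ∈ V⁺ ] 𝟙 ((v -ᶠ w) ∈? V))             ≤⟨ ℕₚ.*-monoʳ-≤ 2 (∑-≤const V (length V) (λ {v} _ → translates v)) ⟩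
      2 * (length V * length V)                                  ∎
      where
      open ℕₚ.≤-Reasoning
      translates : ∀ v → ∑[ w ∈ V⁺ ] 𝟙 ((v -ᶠ w) ∈? V) ≤ length V
      translates v = ≤-trans (≤-reflexive (sym (length-filter-∑ (λ w → (v -ᶠ w) ∈? V) V⁺)))
        (injection-length-≤ V (λ w → v -ᶠ w) (Unique.filter⁺ (λ w → (v -ᶠ w) ∈? V) V⁺!)
          (proj₂ ∘ ∈-filter⁻ (λ w → (v -ᶠ w) ∈? V) {xs = V⁺})
          (λ {x} {y} _ _ eq → trans (solve 2 (λ v x → x := v :- (v :- x)) refl v x)
            (trans (cong (λ t → v -ᶠ t) eq) (solve 2 (λ v y → v :- (v :- y) := y) refl v y))))
        where open 𝕊

    module _ {a₁ a₂ : F} (a₁∈ : a₁ ∈ A′) (a₂∈ : a₂ ∈ A′) where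

      private
        bad₂? : ∀ a j → Dec (Bad a₁ a (proj₁ j) (proj₂ j) ⊎ Bad a₂ a (proj₁ j) (proj₂ j))
        bad₂? a (b , c) = bad? a₁ a b c ⊎-dec bad? a₂ a b c

        bads₂ : F × F → ℕ
        bads₂ j = ∑[ a ∈ A ] 𝟙 (bad₂? a j)

      -- For a heavy pair (b , c), more than half of the possible second entries spoil the quadruple
      -- beginning with `a₁` or the one beginning with `a₂`.
      heavy? : ∀ j → Dec (n < 2 * bads₂ j)
      heavy? j = n <? 2 * bads₂ j

      -- By the choice of `A′`, at most n³/16 bad quadruples begin with `a₁` and as many with `a₂`;
      -- a heavy pair uses up more than n/2 of these n³/8.
      few-heavy : 4 * (∑[ j ∈ cartesianProduct B C ] 𝟙 (heavy? j)) ≤ n * n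
      few-heavy = ℕₚ.*-cancelˡ-≤ (4 * n) {{ℕₚ.m*n≢0 4 n}} (begin
        4 * n * (4 * h)                                           ≡⟨ solve 2 (λ n h → con 4 :* n :* (con 4 :* h) := con 16 :* (h :* n)) refl n h ⟩
        16 * (h * n)                                              ≡⟨ cong (16 *_) (∑-* BC _ n) ⟩
        16 * (∑[ j ∈ BC ] (𝟙 (heavy? j) * n))                     ≤⟨ ℕₚ.*-monoʳ-≤ 16 (∑-mono BC (λ {j} _ → 𝟙*≤ (heavy? j) ℕₚ.<⇒≤)) ⟩
        16 * (∑[ j ∈ BC ] (2 * bads₂ j))                          ≤⟨ ℕₚ.*-monoʳ-≤ 16 (≤-trans (≤-reflexive (sym (*-∑ 2 BC bads₂))) (ℕₚ.*-monoʳ-≤ 2 total)) ⟩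
        16 * (2 * (bads a₁ + bads a₂))                            ≡⟨ solve 2 (λ x y → con 16 :* (con 2 :* (x :+ y)) := con 2 :* (con 16 :* x :+ con 16 :* y)) refl (bads a₁) (bads a₂) ⟩
        2 * (16 * bads a₁ + 16 * bads a₂)                         ≤⟨ ℕₚ.*-monoʳ-≤ 2 (ℕₚ.+-mono-≤ (A′-bads a₁∈) (A′-bads a₂∈)) ⟩
        2 * (n * (n * n) + n * (n * n))                           ≡⟨ solve 1 (λ n → con 2 :* (n :* (n :* n) :+ n :* (n :* n)) := con 4 :* n :* (n :* n)) refl n ⟩
        4 * n * (n * n)                                           ∎)
        where
        open ℕₚ.≤-Reasoning
        open +-*-Solver
        BC : List (F × F)
        BC = cartesianProduct B C
        h : ℕ
        h = ∑[ j ∈ BC ] 𝟙 (heavy? j)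
        bads-BC : ∀ a → ∑[ j ∈ BC ] ∑[ a′ ∈ A ] 𝟙 (bad? a a′ (proj₁ j) (proj₂ j)) ≡ bads a
        bads-BC a = trans (∑-swap BC A _) (∑-cong A (λ a′ → ∑-× B C _))
        total : ∑ BC bads₂ ≤ bads a₁ + bads a₂
        total = begin
          ∑[ j ∈ BC ] ∑[ a ∈ A ] 𝟙 (bad₂? a j)
            ≤⟨ ∑-mono BC (λ {j} _ → ≤-trans (∑-mono A (λ {a} _ → 𝟙-⊎ (bad? a₁ a (proj₁ j) (proj₂ j)) _)) (≤-reflexive (∑-distrib-+ A _ _))) ⟩
          ∑[ j ∈ BC ] ((∑[ a ∈ A ] 𝟙 (bad? a₁ a (proj₁ j) (proj₂ j))) + (∑[ a ∈ A ] 𝟙 (bad? a₂ a (proj₁ j) (proj₂ j))))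
            ≡⟨ ∑-distrib-+ BC _ _ ⟩
          (∑[ j ∈ BC ] ∑[ a ∈ A ] 𝟙 (bad? a₁ a (proj₁ j) (proj₂ j))) + (∑[ j ∈ BC ] ∑[ a ∈ A ] 𝟙 (bad? a₂ a (proj₁ j) (proj₂ j)))
            ≡⟨ cong₂ _+_ (bads-BC a₁) (bads-BC a₂) ⟩
          bads a₁ + bads a₂ ∎

      -- The identity is (a₁ - a₂)bc = (a₁ - a)bc - (a₂ - a)bc. At least n/2 entries a make both
      -- terms good, and distinct a give distinct representations because bc ≠ 0.
      light⇒popular : ∀ {b c} → b ∈ B → c ∈ C → ¬ (n < 2 * bads₂ (b , c)) → (a₁ -ᶠ a₂) *ᶠ (b *ᶠ c) ∈ V⁺
      light⇒popular {b} {c} b∈ c∈ light = ∈-filter⁺ popular? (∈-elements _) (ℕₚ.+-cancelˡ-≤ n _ _ (begin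
        n + n                                           ≡⟨ cong (n +_) (ℕₚ.+-identityʳ n) ⟨
        2 * n                                           ≡⟨ cong (2 *_) (trans (sym A≡n) split) ⟩
        2 * (bads₂ (b , c) + length goods)              ≡⟨ ℕₚ.*-distribˡ-+ 2 (bads₂ (b , c)) (length goods) ⟩
        2 * bads₂ (b , c) + 2 * length goods            ≤⟨ ℕₚ.+-mono-≤ (ℕₚ.≮⇒≥ light) (ℕₚ.*-monoʳ-≤ 2 representations) ⟩
        n + 2 * (∑[ v ∈ V ] 𝟙 ((v -ᶠ w) ∈? V))          ∎))
        where
        open ℕₚ.≤-Reasoning
        w : F
        w = (a₁ -ᶠ a₂) *ᶠ (b *ᶠ c)
        good? : ∀ a → Dec (¬ (Bad a₁ a b c ⊎ Bad a₂ a b c))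
        good? a = ¬? (bad₂? a (b , c))
        goods : List F
        goods = filter good? A
        split : length A ≡ bads₂ (b , c) + length goods
        split = trans (length-∑ A) (trans (∑-cong A (λ a → sym (𝟙+¬≡1 (bad₂? a (b , c)))))
          (trans (∑-distrib-+ A _ _) (cong (bads₂ (b , c) +_) (sym (length-filter-∑ good? A)))))
        goods∈A : ∀ {a} → a ∈ goods → a ∈ A
        goods∈A = proj₁ ∘ ∈-filter⁻ good? {xs = A}
        goods-good : ∀ {a} → a ∈ goods → ¬ (Bad a₁ a b c ⊎ Bad a₂ a b c)
        goods-good = proj₂ ∘ ∈-filter⁻ good? {xs = A}
        shifted : ∀ a → (a₁ -ᶠ a) *ᶠ (b *ᶠ c) -ᶠ w ≡ (a₂ -ᶠ a) *ᶠ (b *ᶠ c)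
        shifted a = solve 4 (λ a₁ a₂ a k → (a₁ :- a) :* k :- (a₁ :- a₂) :* k := (a₂ :- a) :* k) refl a₁ a₂ a (b *ᶠ c)
          where open 𝕊
        representations : length goods ≤ ∑[ v ∈ V ] 𝟙 ((v -ᶠ w) ∈? V)
        representations = injection-≤ V (λ a → (a₁ -ᶠ a) *ᶠ (b *ᶠ c)) (λ v → (v -ᶠ w) ∈? V) (Unique.filter⁺ good? A!)
          (λ a∈ → good∈V (A′⊆A a₁∈) (goods∈A a∈) b∈ c∈ (goods-good a∈ ∘ inj₁))
          (λ {a} a∈ → subst (_∈ V) (sym (shifted a)) (good∈V (A′⊆A a₂∈) (goods∈A a∈) b∈ c∈ (goods-good a∈ ∘ inj₂)))
          (λ {x} {y} _ _ eq → trans (solve 2 (λ a x → x := a :- (a :- x)) refl a₁ x)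
            (trans (cong (λ t → a₁ -ᶠ t) (*-cancelʳ (*-≢0 (B≢0 b∈) (C≢0 c∈)) eq)) (solve 2 (λ a y → a :- (a :- y) := y) refl a₁ y)))
          where open 𝕊

    witness? : ∀ r w → Dec (w ≢ 0ᶠ × r *ᶠ w ∈ V⁺)
    witness? r w = ¬? (w ≟ 0ᶠ) ×-dec ((r *ᶠ w) ∈? V⁺)

    -- Write r = (a₁ - a₂)/(a₃ - a₄). A pair (b , c) light for both differences makes w = (a₃ -
    -- a₄)bc and rw = (a₁ - a₂)bc popular. There are at least n²/2 such pairs, and each w comes from
    -- at most n of them.
    slope-witnesses : ∀ {r} → IsSlope A′ r → n ≤ 2 * (∑[ w ∈ V⁺ ] 𝟙 (witness? r w))
    slope-witnesses {r} ((a₃ , a₁) , q∈ , (a₄ , a₂) , q′∈ , a₃≢a₄ , slope) = ℕₚ.*-cancelˡ-≤ n (begin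
      n * n                                                      ≤⟨ many-light ⟩
      2 * length light                                           ≤⟨ ℕₚ.*-monoʳ-≤ 2 light-fibres ⟩
      2 * (∑[ w ∈ V⁺ ] (𝟙 (witness? r w) * n))                   ≡⟨ cong (2 *_) (∑-* V⁺ _ n) ⟨
      2 * ((∑[ w ∈ V⁺ ] 𝟙 (witness? r w)) * n)                   ≡⟨ solve 2 (λ s n → con 2 :* (s :* n) := n :* (con 2 :* s)) refl (∑[ w ∈ V⁺ ] 𝟙 (witness? r w)) n ⟩
      n * (2 * (∑[ w ∈ V⁺ ] 𝟙 (witness? r w)))                   ∎)
      where
      open ℕₚ.≤-Reasoning
      open +-*-Solver
      open Fibres _≟_
      a₁∈ : a₁ ∈ A′
      a₁∈ = proj₂ (∈-cartesianProduct⁻ A′ A′ q∈)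
      a₂∈ : a₂ ∈ A′
      a₂∈ = proj₂ (∈-cartesianProduct⁻ A′ A′ q′∈)
      a₃∈ : a₃ ∈ A′
      a₃∈ = proj₁ (∈-cartesianProduct⁻ A′ A′ q∈)
      a₄∈ : a₄ ∈ A′
      a₄∈ = proj₁ (∈-cartesianProduct⁻ A′ A′ q′∈)
      BC : List (F × F)
      BC = cartesianProduct B C
      h? : ∀ j → Dec _
      h? j = heavy? a₁∈ a₂∈ j ⊎-dec heavy? a₃∈ a₄∈ j
      light : List (F × F)
      light = filter (¬? ∘ h?) BC
      light! : Unique light
      light! = Unique.filter⁺ (¬? ∘ h?) (Unique.cartesianProduct⁺ B! C!)
      light∈ : ∀ {j} → j ∈ light → proj₁ j ∈ B × proj₂ j ∈ C
      light∈ j∈ = ∈-cartesianProduct⁻ B C (proj₁ (∈-filter⁻ (¬? ∘ h?) {xs = BC} j∈))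
      ¬heavy : ∀ {j} → j ∈ light → ¬ _
      ¬heavy j∈ = proj₂ (∈-filter⁻ (¬? ∘ h?) {xs = BC} j∈)
      many-light : n * n ≤ 2 * length light
      many-light = ℕₚ.+-cancelˡ-≤ (n * n) _ _ (begin
        n * n + n * n                                                      ≡⟨ cong (n * n +_) (ℕₚ.+-identityʳ (n * n)) ⟨
        2 * (n * n)                                                        ≡⟨ cong (2 *_) (trans (sym (trans (length-× B C) (cong₂ _*_ B≡n C≡n))) split) ⟩
        2 * ((∑[ j ∈ BC ] 𝟙 (h? j)) + length light)                        ≡⟨ ℕₚ.*-distribˡ-+ 2 (∑[ j ∈ BC ] 𝟙 (h? j)) (length light) ⟩
        2 * (∑[ j ∈ BC ] 𝟙 (h? j)) + 2 * length light                      ≤⟨ ℕₚ.+-monoˡ-≤ (2 * length light) few ⟩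
        n * n + 2 * length light                                           ∎)
        where
        split : length BC ≡ (∑[ j ∈ BC ] 𝟙 (h? j)) + length light
        split = trans (length-∑ BC) (trans (∑-cong BC (λ j → sym (𝟙+¬≡1 (h? j))))
          (trans (∑-distrib-+ BC _ _) (cong ((∑[ j ∈ BC ] 𝟙 (h? j)) +_) (sym (length-filter-∑ (¬? ∘ h?) BC)))))
        -- Each of the two differences has at most n²/4 heavy pairs.
        few : 2 * (∑[ j ∈ BC ] 𝟙 (h? j)) ≤ n * n
        few = ℕₚ.*-cancelˡ-≤ 2 (begin
          2 * (2 * (∑[ j ∈ BC ] 𝟙 (h? j)))       ≡⟨ ℕₚ.*-assoc 2 2 (∑[ j ∈ BC ] 𝟙 (h? j)) ⟨
          4 * (∑[ j ∈ BC ] 𝟙 (h? j))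
            ≤⟨ ℕₚ.*-monoʳ-≤ 4 (≤-trans (∑-mono BC (λ {j} _ → 𝟙-⊎ (heavy? a₁∈ a₂∈ j) (heavy? a₃∈ a₄∈ j))) (≤-reflexive (∑-distrib-+ BC _ _))) ⟩
          4 * ((∑[ j ∈ BC ] 𝟙 (heavy? a₁∈ a₂∈ j)) + (∑[ j ∈ BC ] 𝟙 (heavy? a₃∈ a₄∈ j)))
            ≡⟨ ℕₚ.*-distribˡ-+ 4 (∑[ j ∈ BC ] 𝟙 (heavy? a₁∈ a₂∈ j)) (∑[ j ∈ BC ] 𝟙 (heavy? a₃∈ a₄∈ j)) ⟩
          4 * (∑[ j ∈ BC ] 𝟙 (heavy? a₁∈ a₂∈ j)) + 4 * (∑[ j ∈ BC ] 𝟙 (heavy? a₃∈ a₄∈ j))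
            ≤⟨ ℕₚ.+-mono-≤ (few-heavy a₁∈ a₂∈) (few-heavy a₃∈ a₄∈) ⟩
          n * n + n * n                           ≡⟨ cong (n * n +_) (ℕₚ.+-identityʳ (n * n)) ⟨
          2 * (n * n)                             ∎)
      π : F × F → F
      π (b , c) = (a₃ -ᶠ a₄) *ᶠ (b *ᶠ c)
      a₃-a₄≢0 : a₃ -ᶠ a₄ ≢ 0ᶠ
      a₃-a₄≢0 = a₃≢a₄ ∘ x-y≡0⇒x≡y
      π∈V⁺ : ∀ {j} → j ∈ light → π j ∈ V⁺
      π∈V⁺ j∈ = let b∈ , c∈ = light∈ j∈ in light⇒popular a₃∈ a₄∈ b∈ c∈ (¬heavy j∈ ∘ inj₂)
      π-witness : ∀ {j} → j ∈ light → π j ≢ 0ᶠ × r *ᶠ π j ∈ V⁺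
      π-witness {b , c} j∈ = let b∈ , c∈ = light∈ j∈ in
        *-≢0 a₃-a₄≢0 (*-≢0 (B≢0 b∈) (C≢0 c∈)) ,
        subst (_∈ V⁺) (trans (cong (_*ᶠ (b *ᶠ c)) slope) (*-assoc _ _ _)) (light⇒popular a₁∈ a₂∈ b∈ c∈ (¬heavy j∈ ∘ inj₁))
      light-fibres : length light ≤ ∑[ w ∈ V⁺ ] (𝟙 (witness? r w) * n)
      light-fibres = begin
        length light                                             ≡⟨ length-∑ light ⟩
        ∑[ _ ∈ light ] 1                                         ≤⟨ ∑-fibres-≤ light V⁺ π (λ _ → 1) π∈V⁺ ⟩
        ∑[ w ∈ V⁺ ] ∑[ j ∈ light ] (𝟙 (π j ≟ w) * 1)             ≤⟨ ∑-mono V⁺ (λ {w} _ → fibre≤ w) ⟩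
        ∑[ w ∈ V⁺ ] (𝟙 (witness? r w) * n)                       ∎
        where
        fibre≤ : ∀ w → ∑[ j ∈ light ] (𝟙 (π j ≟ w) * 1) ≤ 𝟙 (witness? r w) * n
        fibre≤ w = ≤-trans (≤-reflexive (∑-cong light (λ j → ℕₚ.*-identityʳ (𝟙 (π j ≟ w))))) (by (witness? r w))
          where
          by : (d : Dec (w ≢ 0ᶠ × r *ᶠ w ∈ V⁺)) → ∑[ j ∈ light ] 𝟙 (π j ≟ w) ≤ 𝟙 d * n
          by (no ¬wit) = ≤-reflexive (∑-none (λ j → π j ≟ w) light (λ { j∈ refl → ¬wit (π-witness j∈) }))
          -- Within a fibre of `π` the entry b determines c, so `proj₁` injects the fibre into `B`.
          by (yes _)   = ≤-trans (≤-reflexive (sym (length-filter-∑ (λ j → π j ≟ w) light)))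
            (≤-trans (injection-length-≤ B proj₁ (Unique.filter⁺ (λ j → π j ≟ w) light!)
                (proj₁ ∘ light∈ ∘ fibre∈)
                (λ { {b , c} {.b , c′} x∈ y∈ refl → cong (b ,_) (*-cancelˡ (B≢0 (proj₁ (light∈ (fibre∈ x∈))))
                  (*-cancelˡ a₃-a₄≢0 (trans (fibre-eq x∈) (sym (fibre-eq y∈))))) }))
              (≤-reflexive (trans B≡n (sym (ℕₚ.*-identityˡ n)))))
            where
            fibre∈ : ∀ {j} → j ∈ filter (λ j → π j ≟ w) light → j ∈ light
            fibre∈ = proj₁ ∘ ∈-filter⁻ (λ j → π j ≟ w) {xs = light}
            fibre-eq : ∀ {j} → j ∈ filter (λ j → π j ≟ w) light → π j ≡ w
            fibre-eq = proj₂ ∘ ∈-filter⁻ (λ j → π j ≟ w) {xs = light}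

    -- Count the pairs (r , w): every slope has at least n/2 witnesses w, and for given w ≠ 0 the
    -- slope is determined by the element rw of `V⁺`.
    few-slopes : length (slopes A′) * n ≤ 2 * (length V⁺ * length V⁺)
    few-slopes = begin
      length (slopes A′) * n                                            ≤⟨ ∑-≥const (slopes A′) n (λ r∈ → slope-witnesses (proj₂ (∈-filter⁻ (isSlope? A′) {xs = elements} r∈))) ⟩
      ∑[ r ∈ slopes A′ ] (2 * (∑[ w ∈ V⁺ ] 𝟙 (witness? r w)))           ≡⟨ *-∑ 2 (slopes A′) _ ⟨
      2 * (∑[ r ∈ slopes A′ ] ∑[ w ∈ V⁺ ] 𝟙 (witness? r w))             ≡⟨ cong (2 *_) (∑-swap (slopes A′) V⁺ _) ⟩
      2 * (∑[ w ∈ V⁺ ] ∑[ r ∈ slopes A′ ] 𝟙 (witness? r w))             ≤⟨ ℕₚ.*-monoʳ-≤ 2 (∑-≤const V⁺ (length V⁺) (λ {w} _ → multiples w)) ⟩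
      2 * (length V⁺ * length V⁺)                                       ∎
      where
      open ℕₚ.≤-Reasoning
      multiples : ∀ w → ∑[ r ∈ slopes A′ ] 𝟙 (witness? r w) ≤ length V⁺
      multiples w = ≤-trans (≤-reflexive (sym (length-filter-∑ (λ r → witness? r w) (slopes A′))))
        (injection-length-≤ V⁺ (_*ᶠ w) (Unique.filter⁺ (λ r → witness? r w) (Unique.filter⁺ (isSlope? A′) elements!))
          (proj₂ ∘ wit) (λ r∈ _ → *-cancelʳ (proj₁ (wit r∈))))
        where
        wit : ∀ {r} → r ∈ filter (λ r → witness? r w) (slopes A′) → w ≢ 0ᶠ × r *ᶠ w ∈ V⁺
        wit = proj₂ ∘ ∈-filter⁻ (λ r → witness? r w) {xs = slopes A′}

-- Moves preserving (a - a′)bc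

module MoveAlgebra (𝔽ₚ : PrimeField) where

  open PrimeField 𝔽ₚ
  open ≡-Reasoning
  open 𝕊

  -- Multiply `eqC` by β and substitute βα₁ = x; the terms with βd collect to d(γ - c)β. The right
  -- side involves only c, x and the end point (βα , γ).
  scale : ∀ {x c d α₁ β α γ} → β *ᶠ α₁ ≡ x → γ *ᶠ (α +ᶠ d) ≡ c *ᶠ (α₁ +ᶠ d) →
          d *ᶠ (γ -ᶠ c) *ᶠ β ≡ c *ᶠ x -ᶠ γ *ᶠ (β *ᶠ α)
  scale {x} {c} {d} {α₁} {β} {α} {γ} eqB eqC = begin
    d *ᶠ (γ -ᶠ c) *ᶠ β
      ≡⟨ solve 5 (λ d γ c β α → d :* (γ :- c) :* β := β :* (γ :* (α :+ d)) :- c :* (β :* d) :- γ :* (β :* α)) refl d γ c β α ⟩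
    β *ᶠ (γ *ᶠ (α +ᶠ d)) -ᶠ c *ᶠ (β *ᶠ d) -ᶠ γ *ᶠ (β *ᶠ α)
      ≡⟨ cong (λ t → β *ᶠ t -ᶠ c *ᶠ (β *ᶠ d) -ᶠ γ *ᶠ (β *ᶠ α)) eqC ⟩
    β *ᶠ (c *ᶠ (α₁ +ᶠ d)) -ᶠ c *ᶠ (β *ᶠ d) -ᶠ γ *ᶠ (β *ᶠ α)
      ≡⟨ cong (_-ᶠ γ *ᶠ (β *ᶠ α)) (solve 4 (λ d c β α₁ → β :* (c :* (α₁ :+ d)) :- c :* (β :* d) := c :* (β :* α₁)) refl d c β α₁) ⟩
    c *ᶠ (β *ᶠ α₁) -ᶠ γ *ᶠ (β *ᶠ α)
      ≡⟨ cong (λ t → c *ᶠ t -ᶠ γ *ᶠ (β *ᶠ α)) eqB ⟩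
    c *ᶠ x -ᶠ γ *ᶠ (β *ᶠ α) ∎

  -- The scale β is recovered from the end point (βα , γ) of a move because γ ≠ c and d ≠ 0.
  same-scale : ∀ {x c d α₁ β α γ α₁′ β′ α′ γ′} → d ≢ 0ᶠ → γ ≢ c → β *ᶠ α₁ ≡ x → β′ *ᶠ α₁′ ≡ x →
               γ *ᶠ (α +ᶠ d) ≡ c *ᶠ (α₁ +ᶠ d) → γ′ *ᶠ (α′ +ᶠ d) ≡ c *ᶠ (α₁′ +ᶠ d) →
               γ ≡ γ′ → β *ᶠ α ≡ β′ *ᶠ α′ → β ≡ β′
  same-scale {x} {c} {γ = γ} d≢0 γ≢c eqB eqB′ eqC eqC′ refl eq = *-cancelˡ (*-≢0 d≢0 (γ≢c ∘ x-y≡0⇒x≡y))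
    (trans (scale eqB eqC) (trans (cong (λ t → c *ᶠ x -ᶠ γ *ᶠ t) eq) (sym (scale eqB′ eqC′))))

  cancel-scale : ∀ {x y β β′} → β ≢ 0ᶠ → β ≡ β′ → β *ᶠ x ≡ β′ *ᶠ y → x ≡ y
  cancel-scale β≢0 refl eq = *-cancelˡ β≢0 eq

  -- The shift d cancels in differences, so γ(α - α′) = c(α₁ - α₁′). Multiplied by β, the right side
  -- becomes c(ba - ba′).
  move-value : ∀ {a a′ b c d α₁ α₁′ β α α′ γ} → β *ᶠ α₁ ≡ b *ᶠ a → β *ᶠ α₁′ ≡ b *ᶠ a′ →
               γ *ᶠ (α +ᶠ d) ≡ c *ᶠ (α₁ +ᶠ d) → γ *ᶠ (α′ +ᶠ d) ≡ c *ᶠ (α₁′ +ᶠ d) →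
               γ *ᶠ (β *ᶠ α -ᶠ β *ᶠ α′) ≡ (a -ᶠ a′) *ᶠ (b *ᶠ c)
  move-value {a} {a′} {b} {c} {d} {α₁} {α₁′} {β} {α} {α′} {γ} B₁ B₂ C₁ C₂ = begin
    γ *ᶠ (β *ᶠ α -ᶠ β *ᶠ α′)
      ≡⟨ solve 5 (λ γ β α α′ d → γ :* (β :* α :- β :* α′) := β :* (γ :* (α :+ d) :- γ :* (α′ :+ d))) refl γ β α α′ d ⟩
    β *ᶠ (γ *ᶠ (α +ᶠ d) -ᶠ γ *ᶠ (α′ +ᶠ d))
      ≡⟨ cong (β *ᶠ_) (cong₂ _-ᶠ_ C₁ C₂) ⟩
    β *ᶠ (c *ᶠ (α₁ +ᶠ d) -ᶠ c *ᶠ (α₁′ +ᶠ d))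
      ≡⟨ solve 5 (λ c β α₁ α₁′ d → β :* (c :* (α₁ :+ d) :- c :* (α₁′ :+ d)) := c :* (β :* α₁ :- β :* α₁′)) refl c β α₁ α₁′ d ⟩
    c *ᶠ (β *ᶠ α₁ -ᶠ β *ᶠ α₁′)
      ≡⟨ cong (c *ᶠ_) (cong₂ _-ᶠ_ B₁ B₂) ⟩
    c *ᶠ (b *ᶠ a -ᶠ b *ᶠ a′)
      ≡⟨ solve 4 (λ c b a a′ → c :* (b :* a :- b :* a′) := (a :- a′) :* (b :* c)) refl c b a a′ ⟩
    (a -ᶠ a′) *ᶠ (b *ᶠ c) ∎

  translate-cancel : ∀ {c d x y} → c ≢ 0ᶠ → c *ᶠ (x +ᶠ d) ≡ c *ᶠ (y +ᶠ d) → x ≡ y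
  translate-cancel {c} {d} {x} {y} c≢0 eq = begin
    x            ≡⟨ solve 2 (λ x d → x := (x :+ d) :- d) refl x d ⟩
    x +ᶠ d -ᶠ d  ≡⟨ cong (_-ᶠ d) (*-cancelˡ c≢0 eq) ⟩
    y +ᶠ d -ᶠ d  ≡⟨ solve 2 (λ y d → (y :+ d) :- d := y) refl y d ⟩
    y            ∎

module _ (𝔽ₚ : PrimeField) where

  open PrimeField 𝔽ₚ

  -- `w` bounds the number of fibres of `πB` and of `πC`, so these have average size at least n³/w.
  -- A fibre counts as small below n³/k, the fraction 1/l of n³/w, and `large` makes this threshold
  -- at least 2.
  module MultiplicativeMoves
    {A B C X Y : List F} (A! : Unique A) (B! : Unique B) (C! : Unique C) (X! : Unique X) {n : ℕ}
    (A≡n : length A ≡ n) (B≡n : length B ≡ n) (C≡n : length C ≡ n) .{{_ : NonZero n}}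
    (B≢0 : ∀ {b} → b ∈ B → b ≢ 0ᶠ) (C≢0 : ∀ {c} → c ∈ C → c ≢ 0ᶠ) {d : F} (d≢0 : d ≢ 0ᶠ)
    (BA⊆X : ∀ {a b} → a ∈ A → b ∈ B → b *ᶠ a ∈ X) (CA⊆Y : ∀ {a c} → a ∈ A → c ∈ C → c *ᶠ (a +ᶠ d) ∈ Y)
    {w : ℕ} .{{_ : NonZero w}} (X²≤w : length X * length X ≤ w) (Y²≤w : length Y * length Y ≤ w)
    (l : ℕ) {k : ℕ} .{{_ : NonZero k}} (k≡lw : k ≡ l * w) (large : 2 * k ≤ n * (n * n))
    where

    Triple : Set
    Triple = F × F × F

    _≟²_ : DecidableEquality (F × F)
    _≟²_ = ≡-dec _≟_ _≟_

    _≟³_ : DecidableEquality Triple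
    _≟³_ = ≡-dec _≟_ _≟²_

    open Fibres _≟²_
    open MoveAlgebra 𝔽ₚ

    triples : List F → List Triple
    triples E = cartesianProduct A (cartesianProduct A E)

    TB TC : List Triple
    TB = triples B
    TC = triples C

    n³ : ℕ
    n³ = n * (n * n)

    length-triples : ∀ {E} → length E ≡ n → length (triples E) ≡ n³
    length-triples E≡n = trans (length-× A _) (cong₂ _*_ A≡n (trans (length-× A _) (cong₂ _*_ A≡n E≡n)))

    triples! : ∀ {E} → Unique E → Unique (triples E)
    triples! E! = Unique.cartesianProduct⁺ A! (Unique.cartesianProduct⁺ A! E!)

    triples⁻ : ∀ {E a a′ e} → (a , a′ , e) ∈ triples E → a ∈ A × a′ ∈ A × e ∈ E
    triples⁻ {E} t∈ = let a∈ , t∈′ = ∈-cartesianProduct⁻ A _ t∈ in a∈ , ∈-cartesianProduct⁻ A E t∈′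

    πB πC : Triple → F × F
    πB (a , a′ , b) = b *ᶠ a , b *ᶠ a′
    πC (a , a′ , c) = c *ᶠ (a +ᶠ d) , c *ᶠ (a′ +ᶠ d)

    πB∈ : ∀ {t} → t ∈ TB → πB t ∈ cartesianProduct X X
    πB∈ t∈ = let a∈ , a′∈ , b∈ = triples⁻ t∈ in ∈-cartesianProduct⁺ (BA⊆X a∈ b∈) (BA⊆X a′∈ b∈)

    πC∈ : ∀ {t} → t ∈ TC → πC t ∈ cartesianProduct Y Y
    πC∈ t∈ = let a∈ , a′∈ , c∈ = triples⁻ t∈ in ∈-cartesianProduct⁺ (CA⊆Y a∈ c∈) (CA⊆Y a′∈ c∈)

    smallB? : ∀ t → Dec (k * fibre TB πB (πB t) < length TB)
    smallB? t = k * fibre TB πB (πB t) <? length TB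

    smallC? : ∀ t → Dec (k * fibre TC πC (πC t) < length TC)
    smallC? t = k * fibre TC πC (πC t) <? length TC

    infixl 5 _⟨_⟩
    _⟨_⟩ : Triple → F → Triple
    (a , a′ , _) ⟨ c ⟩ = a , a′ , c

    -- At least half of the fibre of t falls into small fibres of `πC` once the last entry is
    -- replaced by c, so that the second move may have too little room.
    mostlySmall? : ∀ t c → Dec (fibre TB πB (πB t) ≤ 2 * (∑[ t′ ∈ TB ] (𝟙 (πB t′ ≟² πB t) * 𝟙 (smallC? (t′ ⟨ c ⟩)))))
    mostlySmall? t c = fibre TB πB (πB t) ≤? 2 * (∑[ t′ ∈ TB ] (𝟙 (πB t′ ≟² πB t) * 𝟙 (smallC? (t′ ⟨ c ⟩))))

    bad? : ∀ a a′ b c → Dec _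
    bad? a a′ b c = smallB? (a , a′ , b) ⊎-dec mostlySmall? (a , a′ , b) c

    -- Small fibres of `πB` contain at most n³/l triples, which spoil n⁴/l quadruples. By
    -- `majority-fibres`, applied for each c, the second condition holds at most twice as often as
    -- the triple with last entry c is in a small fibre of `πC`. This does not depend on b, so it
    -- adds at most 2n · n³/l.
    few-bad : l * (∑[ a ∈ A ] ∑[ a′ ∈ A ] ∑[ b ∈ B ] ∑[ c ∈ C ] 𝟙 (bad? a a′ b c)) ≤ 3 * (n * n³)
    few-bad = begin
      l * (∑[ a ∈ A ] ∑[ a′ ∈ A ] ∑[ b ∈ B ] ∑[ c ∈ C ] 𝟙 (bad? a a′ b c))
        ≡⟨ cong (l *_) (trans (∑-× A _ _) (∑-cong A (λ a → ∑-× A B _))) ⟨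
      l * (∑[ t ∈ TB ] ∑[ c ∈ C ] 𝟙 (bad? (proj₁ t) (proj₁ (proj₂ t)) (proj₂ (proj₂ t)) c))
        ≤⟨ ℕₚ.*-monoʳ-≤ l (∑-mono TB (λ {t} _ → ≤-trans (∑-mono C (λ {c} _ → 𝟙-⊎ (smallB? t) (mostlySmall? t c))) (≤-reflexive (∑-distrib-+ C _ _)))) ⟩
      l * (∑[ t ∈ TB ] ((∑[ c ∈ C ] 𝟙 (smallB? t)) + (∑[ c ∈ C ] 𝟙 (mostlySmall? t c))))
        ≡⟨ cong (l *_) (∑-distrib-+ TB _ _) ⟩
      l * ((∑[ t ∈ TB ] ∑[ c ∈ C ] 𝟙 (smallB? t)) + (∑[ t ∈ TB ] ∑[ c ∈ C ] 𝟙 (mostlySmall? t c)))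
        ≤⟨ ℕₚ.*-monoʳ-≤ l (ℕₚ.+-mono-≤ (≤-reflexive first) second) ⟩
      l * (n * sB + 2 * (n * sC))
        ≡⟨ solve 4 (λ l n x y → l :* (n :* x :+ con 2 :* (n :* y)) := n :* (l :* x) :+ con 2 :* (n :* (l :* y))) refl l n sB sC ⟩
      n * (l * sB) + 2 * (n * (l * sC))
        ≤⟨ ℕₚ.+-mono-≤ (ℕₚ.*-monoʳ-≤ n sB-small) (ℕₚ.*-monoʳ-≤ 2 (ℕₚ.*-monoʳ-≤ n sC-small)) ⟩
      n * n³ + 2 * (n * n³)
        ∎
      where
      open ℕₚ.≤-Reasoning
      open +-*-Solver
      sB sC : ℕ
      sB = ∑[ t ∈ TB ] 𝟙 (smallB? t)
      sC = ∑[ t ∈ TC ] 𝟙 (smallC? t)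
      sB-small : l * sB ≤ n³
      sB-small = ≤-trans (small-fibres TB (cartesianProduct X X) πB πB∈ l w (≤-trans (≤-reflexive (length-× X X)) X²≤w) k≡lw)
        (≤-reflexive (length-triples B≡n))
      sC-small : l * sC ≤ n³
      sC-small = ≤-trans (small-fibres TC (cartesianProduct Y Y) πC πC∈ l w (≤-trans (≤-reflexive (length-× Y Y)) Y²≤w) k≡lw)
        (≤-reflexive (length-triples C≡n))
      first : ∑[ t ∈ TB ] ∑[ c ∈ C ] 𝟙 (smallB? t) ≡ n * sB
      first = trans (∑-cong TB (λ t → trans (∑-const C _) (cong (_* 𝟙 (smallB? t)) C≡n))) (sym (*-∑ n TB _))
      second : ∑[ t ∈ TB ] ∑[ c ∈ C ] 𝟙 (mostlySmall? t c) ≤ 2 * (n * sC)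
      second = begin
        ∑[ t ∈ TB ] ∑[ c ∈ C ] 𝟙 (mostlySmall? t c)              ≡⟨ ∑-swap TB C _ ⟩
        ∑[ c ∈ C ] ∑[ t ∈ TB ] 𝟙 (mostlySmall? t c)
          ≤⟨ ∑-mono C (λ {c} _ → majority-fibres TB (Unique.cartesianProduct⁺ X! X!) πB πB∈ (λ t → 𝟙 (smallC? (t ⟨ c ⟩)))) ⟩
        ∑[ c ∈ C ] (2 * (∑[ t ∈ TB ] 𝟙 (smallC? (t ⟨ c ⟩))))      ≡⟨ *-∑ 2 C _ ⟨
        2 * (∑[ c ∈ C ] ∑[ t ∈ TB ] 𝟙 (smallC? (t ⟨ c ⟩)))        ≡⟨ cong (2 *_) (∑-cong C (λ c → trans (∑-× A _ _) (∑-cong A (λ a → ∑-× A B _)))) ⟩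
        2 * (∑[ c ∈ C ] ∑[ a ∈ A ] ∑[ a′ ∈ A ] ∑[ b ∈ B ] 𝟙 (smallC? (a , a′ , c)))
          ≡⟨ cong (2 *_) (∑-cong C (λ c → trans
              (∑-cong A (λ a → trans (∑-cong A (λ a′ → trans (∑-const B _) (cong (_* 𝟙 (smallC? (a , a′ , c))) B≡n))) (sym (*-∑ n A _))))
              (sym (*-∑ n A _)))) ⟩
        2 * (∑[ c ∈ C ] (n * (∑[ a ∈ A ] ∑[ a′ ∈ A ] 𝟙 (smallC? (a , a′ , c)))))
          ≡⟨ cong (2 *_) (*-∑ n C _) ⟨
        2 * (n * (∑[ c ∈ C ] ∑[ a ∈ A ] ∑[ a′ ∈ A ] 𝟙 (smallC? (a , a′ , c))))
          ≡⟨ cong (λ s → 2 * (n * s)) (trans (∑-swap C A _) (trans (∑-cong A (λ a → trans (∑-swap C A _) (sym (∑-× A C _)))) (sym (∑-× A _ _)))) ⟩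
        2 * (n * sC) ∎

    XXC : List Triple
    XXC = cartesianProduct X (cartesianProduct X C)

    value : Triple → F
    value (x , x′ , c) = c *ᶠ (x -ᶠ x′)

    rep : F → ℕ
    rep v = ∑[ q ∈ XXC ] 𝟙 (value q ≟ v)

    -- The threshold for `rep v` is (n³/2k)², with denominators cleared: n³/2k choices for each of
    -- the two moves.
    frequent? : ∀ v → Dec (n³ * n³ ≤ 2 * k * (2 * k * rep v))
    frequent? v = n³ * n³ ≤? 2 * k * (2 * k * rep v)

    V : List F
    V = filter frequent? elements

    V! : Unique V
    V! = Unique.filter⁺ frequent? elements!

    -- Each triple of `XXC` represents a single value, so all values together have at most wn
    -- representations, and every frequent one takes (n³/2k)² of them.
    few-frequent : length V * (n³ * n³) ≤ 2 * k * (2 * k * (w * n))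
    few-frequent = begin
      length V * (n³ * n³)                             ≤⟨ ∑-≥const V (n³ * n³) (λ v∈ → proj₂ (∈-filter⁻ frequent? {xs = elements} v∈)) ⟩
      ∑[ v ∈ V ] (2 * k * (2 * k * rep v))             ≡⟨ *-∑ (2 * k) V _ ⟨
      2 * k * (∑[ v ∈ V ] (2 * k * rep v))             ≡⟨ cong (2 * k *_) (*-∑ (2 * k) V rep) ⟨
      2 * k * (2 * k * (∑[ v ∈ V ] rep v))             ≤⟨ ℕₚ.*-monoʳ-≤ (2 * k) (ℕₚ.*-monoʳ-≤ (2 * k) total) ⟩
      2 * k * (2 * k * (w * n))                        ∎
      where
      open ℕₚ.≤-Reasoning
      total : ∑[ v ∈ V ] rep v ≤ w * n
      total = begin
        ∑[ v ∈ V ] rep v                                 ≡⟨ ∑-swap V XXC _ ⟩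
        ∑[ q ∈ XXC ] ∑[ v ∈ V ] 𝟙 (value q ≟ v)          ≤⟨ ∑-≤const XXC 1 (λ {q} _ → ∑-atMostOne (value q ≟_) V! (λ _ _ p q → trans (sym p) q)) ⟩
        length XXC * 1                                   ≡⟨ ℕₚ.*-identityʳ (length XXC) ⟩
        length XXC                                       ≡⟨ trans (length-× X _) (cong (length X *_) (length-× X C)) ⟩
        length X * (length X * length C)                 ≡⟨ ℕₚ.*-assoc (length X) (length X) (length C) ⟨
        length X * length X * length C                   ≤⟨ ℕₚ.*-mono-≤ X²≤w (≤-reflexive C≡n) ⟩
        w * n                                            ∎

    module Representations {a a′ b c : F} (a∈ : a ∈ A) (a′∈ : a′ ∈ A) (b∈ : b ∈ B) (c∈ : c ∈ C)
      (¬smallB : ¬ (k * fibre TB πB (πB (a , a′ , b)) < length TB))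
      (¬mostlySmall : ¬ (fibre TB πB (πB (a , a′ , b)) ≤
        2 * (∑[ t′ ∈ TB ] (𝟙 (πB t′ ≟² πB (a , a′ , b)) * 𝟙 (smallC? (t′ ⟨ c ⟩))))))
      where

      private
        t₀ : Triple
        t₀ = a , a′ , b

      -- A double move: from `t₀` to t₁ inside a fibre of `πB`, then, with the last entry exchanged
      -- for c, to t₂ inside a fibre of `πC`. That the last entry of t₂ differs from c makes the
      -- path recoverable from its end.
      Path : Triple × Triple → Set
      Path (t₁ , t₂) = πB t₁ ≡ πB t₀ × πC t₂ ≡ πC (t₁ ⟨ c ⟩) × proj₂ (proj₂ t₂) ≢ c

      path? : ∀ p → Dec (Path p)
      path? (t₁ , t₂) = (πB t₁ ≟² πB t₀) ×-dec ((πC t₂ ≟² πC (t₁ ⟨ c ⟩)) ×-dec ¬? (proj₂ (proj₂ t₂) ≟ c))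

      end : Triple × Triple → Triple
      end ((_ , _ , β) , (α , α′ , γ)) = β *ᶠ α , β *ᶠ α′ , γ

      -- First β is recovered by `same-scale`. Then β cancels: the fibre equations of the first move
      -- give α₁ and α₁′, and the end point itself gives α and α′.
      end-injective : ∀ {p q} → proj₂ (proj₂ (proj₁ p)) ≢ 0ᶠ → Path p → Path q → end p ≡ end q → p ≡ q
      end-injective {(α₁ , α₁′ , β) , (α , α′ , γ)} β≢0 (B₁ , C₁ , γ≢c) (B₂ , C₂ , _) eq =
        let βα≡ , eq′  = ,-injective eq
            βα′≡ , γ≡  = ,-injective eq′
            B₁α , B₁α′ = ,-injective B₁
            B₂α , B₂α′ = ,-injective B₂
            β≡         = same-scale d≢0 γ≢c B₁α B₂α (proj₁ (,-injective C₁)) (proj₁ (,-injective C₂)) γ≡ βα≡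
            cancel     = λ {x y} → cancel-scale {x} {y} β≢0 β≡
        in cong₂ _,_ (cong₂ _,_ (cancel (trans B₁α (sym B₂α))) (cong₂ _,_ (cancel (trans B₁α′ (sym B₂α′))) β≡))
                     (cong₂ _,_ (cancel βα≡) (cong₂ _,_ (cancel βα′≡) γ≡))

      end-value : ∀ {p} → Path p → value (end p) ≡ (a -ᶠ a′) *ᶠ (b *ᶠ c)
      end-value {(α₁ , α₁′ , β) , (α , α′ , γ)} (eqB , eqC , _) =
        let B₁ , B₂ = ,-injective eqB
            C₁ , C₂ = ,-injective eqC
        in move-value B₁ B₂ C₁ C₂

      paths : List (Triple × Triple)
      paths = filter path? (cartesianProduct TB TC)

      paths≤rep : length paths ≤ rep ((a -ᶠ a′) *ᶠ (b *ᶠ c))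
      paths≤rep = Injections.injection-≤ _≟³_ XXC end (λ q → value q ≟ _)
        (Unique.filter⁺ path? (Unique.cartesianProduct⁺ (triples! B!) (triples! C!)))
        end∈ (end-value ∘ is-path)
        (λ p∈ q∈ → end-injective (B≢0 (proj₂ (proj₂ (triples⁻ (proj₁ (in-lists p∈)))))) (is-path p∈) (is-path q∈))
        where
        is-path : ∀ {p} → p ∈ paths → Path p
        is-path = proj₂ ∘ ∈-filter⁻ path? {xs = cartesianProduct TB TC}
        in-lists : ∀ {p} → p ∈ paths → proj₁ p ∈ TB × proj₂ p ∈ TC
        in-lists = ∈-cartesianProduct⁻ TB TC ∘ proj₁ ∘ ∈-filter⁻ path? {xs = cartesianProduct TB TC}
        end∈ : ∀ {p} → p ∈ paths → end p ∈ XXC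
        end∈ p∈ = let t₁∈ , t₂∈ = in-lists p∈
                      _ , _ , β∈ = triples⁻ t₁∈
                      α∈ , α′∈ , γ∈ = triples⁻ t₂∈
                  in ∈-cartesianProduct⁺ (BA⊆X α∈ β∈) (∈-cartesianProduct⁺ (BA⊆X α′∈ β∈) γ∈)

      moves : Triple → ℕ
      moves t₁ = ∑[ t₂ ∈ TC ] 𝟙 ((πC t₂ ≟² πC (t₁ ⟨ c ⟩)) ×-dec ¬? (proj₂ (proj₂ t₂) ≟ c))

      -- The fibre has at least n³/k ≥ 2 elements. Only `t₁ ⟨ c ⟩` has last entry c in it, because c
      -- ≠ 0 cancels, and dropping this one leaves at least half.
      many-moves : ∀ t₁ → ¬ (k * fibre TC πC (πC (t₁ ⟨ c ⟩)) < length TC) → n³ ≤ 2 * k * moves t₁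
      many-moves t₁@(α₁ , α₁′ , β) ¬small = begin
        n³                                ≤⟨ n³≤k*fib ⟩
        k * fib                           ≤⟨ ℕₚ.*-monoʳ-≤ k (fib≤2moves (moves t₁) fib≤1+moves) ⟩
        k * (2 * moves t₁)                ≡⟨ solve 2 (λ k m → k :* (con 2 :* m) := con 2 :* k :* m) refl k (moves t₁) ⟩
        2 * k * moves t₁                  ∎
        where
        open ℕₚ.≤-Reasoning
        open +-*-Solver
        fib : ℕ
        fib = fibre TC πC (πC (t₁ ⟨ c ⟩))
        n³≤k*fib : n³ ≤ k * fib
        n³≤k*fib = ≤-trans (≤-reflexive (sym (length-triples C≡n))) (ℕₚ.≮⇒≥ ¬small)
        2≤fib : 2 ≤ fib
        2≤fib = ℕₚ.*-cancelˡ-≤ k (≤-trans (≤-reflexive (ℕₚ.*-comm k 2)) (≤-trans large n³≤k*fib))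
        stay? : ∀ t₂ → Dec (πC t₂ ≡ πC (t₁ ⟨ c ⟩) × proj₂ (proj₂ t₂) ≡ c)
        stay? t₂ = (πC t₂ ≟² πC (t₁ ⟨ c ⟩)) ×-dec (proj₂ (proj₂ t₂) ≟ c)
        stay≡ : ∀ {t₂} → πC t₂ ≡ πC (t₁ ⟨ c ⟩) × proj₂ (proj₂ t₂) ≡ c → t₂ ≡ t₁ ⟨ c ⟩
        stay≡ {α , α′ , _} (eq , refl) = cong₂ (λ u v → u , v , c) (translate-cancel (C≢0 c∈) (proj₁ (,-injective eq))) (translate-cancel (C≢0 c∈) (proj₂ (,-injective eq)))
        pointwise : ∀ t₂ → 𝟙 (πC t₂ ≟² πC (t₁ ⟨ c ⟩)) ≡ 𝟙 (stay? t₂) + 𝟙 ((πC t₂ ≟² πC (t₁ ⟨ c ⟩)) ×-dec ¬? (proj₂ (proj₂ t₂) ≟ c))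
        pointwise t₂ with πC t₂ ≟² πC (t₁ ⟨ c ⟩) | proj₂ (proj₂ t₂) ≟ c
        ... | yes _ | yes _ = refl
        ... | yes _ | no  _ = refl
        ... | no  _ | _     = refl
        fib≤1+moves : fib ≤ 1 + moves t₁
        fib≤1+moves = begin
          fib                                          ≡⟨ trans (∑-cong TC pointwise) (∑-distrib-+ TC _ _) ⟩
          (∑[ t₂ ∈ TC ] 𝟙 (stay? t₂)) + moves t₁       ≤⟨ ℕₚ.+-monoˡ-≤ (moves t₁) (∑-atMostOne stay? (triples! C!) (λ _ _ p q → trans (stay≡ p) (sym (stay≡ q)))) ⟩
          1 + moves t₁                                 ∎
        fib≤2moves : ∀ m → fib ≤ 1 + m → fib ≤ 2 * m
        fib≤2moves zero    fib≤1 = contradiction (≤-trans 2≤fib fib≤1) (ℕₚ.<-irrefl refl)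
        fib≤2moves (suc m) fib≤  = ≤-trans fib≤ (≤-trans (≤-reflexive (ℕₚ.+-comm 1 (suc m))) (ℕₚ.+-monoʳ-≤ (suc m) (s≤s z≤n)))

      -- The fibre of `t₀` has at least n³/k elements. At least half of them lead into fibres of
      -- `πC` that are not small, which gives n³/2k moves each, and distinct paths are distinct
      -- representations.
      frequent : n³ * n³ ≤ 2 * k * (2 * k * rep ((a -ᶠ a′) *ᶠ (b *ᶠ c)))
      frequent = begin
        n³ * n³                                      ≤⟨ ℕₚ.*-monoˡ-≤ n³ (≤-trans (≤-reflexive (sym (length-triples B≡n))) (ℕₚ.≮⇒≥ ¬smallB)) ⟩
        k * fib * n³                                 ≤⟨ ℕₚ.*-monoˡ-≤ n³ (ℕₚ.*-monoʳ-≤ k fib≤2g) ⟩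
        k * (2 * g) * n³                             ≡⟨ solve 3 (λ k g m → k :* (con 2 :* g) :* m := con 2 :* k :* (g :* m)) refl k g n³ ⟩
        2 * k * (g * n³)                             ≤⟨ ℕₚ.*-monoʳ-≤ (2 * k) g*n³≤ ⟩
        2 * k * (2 * k * length paths)               ≤⟨ ℕₚ.*-monoʳ-≤ (2 * k) (ℕₚ.*-monoʳ-≤ (2 * k) paths≤rep) ⟩
        2 * k * (2 * k * rep ((a -ᶠ a′) *ᶠ (b *ᶠ c))) ∎
        where
        open ℕₚ.≤-Reasoning
        open +-*-Solver
        fib g m : ℕ
        fib = fibre TB πB (πB t₀)
        g = ∑[ t₁ ∈ TB ] (𝟙 (πB t₁ ≟² πB t₀) * 𝟙 (¬? (smallC? (t₁ ⟨ c ⟩))))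
        m = ∑[ t₁ ∈ TB ] (𝟙 (πB t₁ ≟² πB t₀) * 𝟙 (smallC? (t₁ ⟨ c ⟩)))
        fib≡m+g : fib ≡ m + g
        fib≡m+g = trans (∑-cong TB (λ t₁ → trans (sym (ℕₚ.*-identityʳ _))
          (trans (cong (𝟙 (πB t₁ ≟² πB t₀) *_) (sym (𝟙+¬≡1 (smallC? (t₁ ⟨ c ⟩))))) (ℕₚ.*-distribˡ-+ (𝟙 (πB t₁ ≟² πB t₀)) _ _))))
          (∑-distrib-+ TB _ _)
        fib≤2g : fib ≤ 2 * g
        fib≤2g = ℕₚ.+-cancelˡ-≤ fib _ _ (begin
          fib + fib          ≡⟨ cong (λ f → f + f) fib≡m+g ⟩
          m + g + (m + g)    ≡⟨ solve 2 (λ m g → m :+ g :+ (m :+ g) := con 2 :* m :+ con 2 :* g) refl m g ⟩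
          2 * m + 2 * g      ≤⟨ ℕₚ.+-monoˡ-≤ (2 * g) (ℕₚ.<⇒≤ (ℕₚ.≰⇒> ¬mostlySmall)) ⟩
          fib + 2 * g        ∎)
        g*n³≤ : g * n³ ≤ 2 * k * length paths
        g*n³≤ = begin
          g * n³                                                                       ≡⟨ ∑-* TB _ n³ ⟩
          ∑[ t₁ ∈ TB ] (𝟙 (πB t₁ ≟² πB t₀) * 𝟙 (¬? (smallC? (t₁ ⟨ c ⟩))) * n³)        ≤⟨ ∑-mono TB (λ {t₁} _ → pointwise t₁) ⟩
          ∑[ t₁ ∈ TB ] (2 * k * (𝟙 (πB t₁ ≟² πB t₀) * moves t₁))                       ≡⟨ *-∑ (2 * k) TB _ ⟨
          2 * k * (∑[ t₁ ∈ TB ] (𝟙 (πB t₁ ≟² πB t₀) * moves t₁))                       ≡⟨ cong (2 * k *_) paths≡ ⟨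
          2 * k * length paths                                                         ∎
          where
          pointwise : ∀ t₁ → 𝟙 (πB t₁ ≟² πB t₀) * 𝟙 (¬? (smallC? (t₁ ⟨ c ⟩))) * n³ ≤ 2 * k * (𝟙 (πB t₁ ≟² πB t₀) * moves t₁)
          pointwise t₁ = begin
            e * 𝟙 (¬? (smallC? (t₁ ⟨ c ⟩))) * n³       ≡⟨ ℕₚ.*-assoc e _ n³ ⟩
            e * (𝟙 (¬? (smallC? (t₁ ⟨ c ⟩))) * n³)     ≤⟨ ℕₚ.*-monoʳ-≤ e (𝟙*≤ (¬? (smallC? (t₁ ⟨ c ⟩))) (many-moves t₁)) ⟩
            e * (2 * k * moves t₁)                     ≡⟨ solve 3 (λ e k m → e :* (con 2 :* k :* m) := con 2 :* k :* (e :* m)) refl e k (moves t₁) ⟩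
            2 * k * (e * moves t₁)                     ∎
            where
            e : ℕ
            e = 𝟙 (πB t₁ ≟² πB t₀)
          paths≡ : length paths ≡ ∑[ t₁ ∈ TB ] (𝟙 (πB t₁ ≟² πB t₀) * moves t₁)
          paths≡ = trans (length-filter-∑ path? (cartesianProduct TB TC)) (trans (∑-× TB TC _)
            (∑-cong TB (λ t₁ → trans
              (∑-cong TC (λ t₂ → 𝟙-× (πB t₁ ≟² πB t₀) ((πC t₂ ≟² πC (t₁ ⟨ c ⟩)) ×-dec ¬? (proj₂ (proj₂ t₂) ≟ c))))
              (sym (*-∑ (𝟙 (πB t₁ ≟² πB t₀)) TC _)))))

    good∈V : ∀ {a a′ b c} → a ∈ A → a′ ∈ A → b ∈ B → c ∈ C → ¬ _ → (a -ᶠ a′) *ᶠ (b *ᶠ c) ∈ V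
    good∈V {a} {a′} {b} {c} a∈ a′∈ b∈ c∈ good = ∈-filter⁺ frequent? (∈-elements _)
      (Representations.frequent a∈ a′∈ b∈ c∈ (good ∘ inj₁) (good ∘ inj₂))

-- Combining the inequalities

^-distribˡ-* : ∀ m n k → (m * n) ^ k ≡ m ^ k * n ^ k
^-distribˡ-* m n zero    = refl
^-distribˡ-* m n (suc k) = trans (cong (m * n *_) (^-distribˡ-* m n k))
  (solve 4 (λ m n a b → m :* n :* (a :* b) := m :* a :* (n :* b)) refl m n (m ^ k) (n ^ k))
  where open +-*-Solver

-- From n ≥ 4 follows a ≥ 2, hence 2a ≤ a². Doubling a² ≤ a + s then absorbs the linear term and
-- leaves a² ≤ 2s.
square-≤-8slopes : ∀ {n a s} → 4 ≤ n → n ≤ 2 * a → (2 ≤ a → a * a ≤ a + s) → n * n ≤ 8 * s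
square-≤-8slopes {n} {a} {s} 4≤n n≤2a a²≤a+s = begin
  n * n             ≤⟨ ℕₚ.*-mono-≤ n≤2a n≤2a ⟩
  2 * a * (2 * a)   ≡⟨ solve 1 (λ a → con 2 :* a :* (con 2 :* a) := con 4 :* (a :* a)) refl a ⟩
  4 * (a * a)       ≤⟨ ℕₚ.*-monoʳ-≤ 4 a²≤2s ⟩
  4 * (2 * s)       ≡⟨ ℕₚ.*-assoc 4 2 s ⟨
  8 * s             ∎
  where
  open ℕₚ.≤-Reasoning
  open +-*-Solver
  2≤a : 2 ≤ a
  2≤a = ℕₚ.*-cancelˡ-≤ 2 (≤-trans 4≤n n≤2a)
  a²≤2s : a * a ≤ 2 * s
  a²≤2s = ℕₚ.+-cancelˡ-≤ (a * a) _ _ (begin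
    a * a + a * a        ≤⟨ ℕₚ.+-mono-≤ (a²≤a+s 2≤a) (a²≤a+s 2≤a) ⟩
    a + s + (a + s)      ≡⟨ solve 2 (λ a s → a :+ s :+ (a :+ s) := con 2 :* a :+ con 2 :* s) refl a s ⟩
    2 * a + 2 * s        ≤⟨ ℕₚ.+-monoˡ-≤ (2 * s) (ℕₚ.*-monoˡ-≤ a 2≤a) ⟩
    a * a + 2 * s        ∎)

-- Here s, u and v count the slopes, `V⁺` and `V`. Eliminating s and u gives n⁵ ≤ 64v⁴, while the
-- last hypothesis amounts to vn⁵ ≤ 4k²w; so n²⁵ = n⁵(n⁵)⁴ ≤ 64(vn⁵)⁴.
combine : ∀ {n s u v k w} .{{_ : NonZero n}} → n * n ≤ 8 * s → s * n ≤ 2 * (u * u) → u * n ≤ 2 * (v * v) →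
          v * (n * (n * n) * (n * (n * n))) ≤ 2 * k * (2 * k * (w * n)) →
          n ^ 25 ≤ 64 * (4 * (k * k * w)) ^ 4
combine {n} {s} {u} {v} {k} {w} n²≤8s sn≤2u² un≤2v² vn⁶≤ = begin
  n ^ 25                              ≡⟨ ℕₚ.^-distribˡ-+-* n 5 20 ⟩
  n ^ 5 * n ^ 20                      ≡⟨ cong (n ^ 5 *_) (sym (ℕₚ.^-*-assoc n 5 4)) ⟩
  n ^ 5 * (n ^ 5) ^ 4                 ≤⟨ ℕₚ.*-monoˡ-≤ ((n ^ 5) ^ 4) n⁵≤64v⁴ ⟩
  64 * v ^ 4 * (n ^ 5) ^ 4            ≡⟨ trans (ℕₚ.*-assoc 64 (v ^ 4) ((n ^ 5) ^ 4)) (cong (64 *_) (sym (^-distribˡ-* v (n ^ 5) 4))) ⟩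
  64 * (v * n ^ 5) ^ 4                ≤⟨ ℕₚ.*-monoʳ-≤ 64 (ℕₚ.^-monoˡ-≤ 4 vn⁵≤) ⟩
  64 * (4 * (k * k * w)) ^ 4          ∎
  where
  open ℕₚ.≤-Reasoning
  open +-*-Solver
  n⁵≤64v⁴ : n ^ 5 ≤ 64 * v ^ 4
  n⁵≤64v⁴ = begin
    n ^ 5                             ≡⟨ solve 1 (λ n → n :^ 5 := n :* n :* (n :* (n :* n))) refl n ⟩
    n * n * (n * (n * n))             ≤⟨ ℕₚ.*-monoˡ-≤ (n * (n * n)) n²≤8s ⟩
    8 * s * (n * (n * n))             ≡⟨ solve 2 (λ s n → con 8 :* s :* (n :* (n :* n)) := con 8 :* ((s :* n) :* (n :* n))) refl s n ⟩
    8 * (s * n * (n * n))             ≤⟨ ℕₚ.*-monoʳ-≤ 8 (ℕₚ.*-monoˡ-≤ (n * n) sn≤2u²) ⟩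
    8 * (2 * (u * u) * (n * n))       ≡⟨ solve 2 (λ u n → con 8 :* (con 2 :* (u :* u) :* (n :* n)) := con 16 :* ((u :* n) :* (u :* n))) refl u n ⟩
    16 * (u * n * (u * n))            ≤⟨ ℕₚ.*-monoʳ-≤ 16 (ℕₚ.*-mono-≤ un≤2v² un≤2v²) ⟩
    16 * (2 * (v * v) * (2 * (v * v))) ≡⟨ solve 1 (λ v → con 16 :* (con 2 :* (v :* v) :* (con 2 :* (v :* v))) := con 64 :* v :^ 4) refl v ⟩
    64 * v ^ 4                        ∎
  vn⁵≤ : v * n ^ 5 ≤ 4 * (k * k * w)
  vn⁵≤ = ℕₚ.*-cancelʳ-≤ _ _ n (begin
    v * n ^ 5 * n                        ≡⟨ solve 2 (λ v n → v :* n :^ 5 :* n := v :* (n :* (n :* n) :* (n :* (n :* n)))) refl v n ⟩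
    v * (n * (n * n) * (n * (n * n)))    ≤⟨ vn⁶≤ ⟩
    2 * k * (2 * k * (w * n))            ≡⟨ solve 3 (λ k w n → con 2 :* k :* (con 2 :* k :* (w :* n)) := con 4 :* (k :* k :* w) :* n) refl k w n ⟩
    4 * (k * k * w) * n                  ∎)

-- l stands for 96 = 3 · 32: few-bad leaves at most 3n⁴/l bad quadruples and PopularDifferences allows
-- n⁴/32.  The numeral itself is kept out of the types, where it would be unfolded.
constant : ℕ → ℕ
constant l = 64 * (4 * (l * l)) ^ 4 + (2 * l) ^ 12 + 4 ^ 25

module _ (𝔽ₚ : PrimeField) where

  open PrimeField 𝔽ₚ

  module _
    {A B C X Y : List F} (A! : Unique A) (B! : Unique B) (C! : Unique C) (X! : Unique X) {n : ℕ}
    (A≡n : length A ≡ n) (B≡n : length B ≡ n) (C≡n : length C ≡ n) .{{_ : NonZero n}}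
    (B≢0 : ∀ {b} → b ∈ B → b ≢ 0ᶠ) (C≢0 : ∀ {c} → c ∈ C → c ≢ 0ᶠ) {d : F} (d≢0 : d ≢ 0ᶠ)
    (BA⊆X : ∀ {a b} → a ∈ A → b ∈ B → b *ᶠ a ∈ X) (CA⊆Y : ∀ {a c} → a ∈ A → c ∈ C → c *ᶠ (a +ᶠ d) ∈ Y)
    (n²≤p : n * n ≤ p)
    where

    large-bound : 4 ≤ n → ∀ {w} .{{_ : NonZero w}} → length X * length X ≤ w → length Y * length Y ≤ w →
                  ∀ {l k} .{{_ : NonZero k}} → l ≡ 96 → k ≡ l * w → 2 * k ≤ n * (n * n) → n ^ 25 ≤ 64 * (4 * (k * k * w)) ^ 4
    large-bound 4≤n {w} X²≤w Y²≤w {l} {k} l≡96 k≡lw large =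
      combine {s = length (slopes A′)} {length V⁺} {length V} {k} {w}
        (square-≤-8slopes 4≤n n≤2A′ λ 2≤A′ → many-slopes A′! 2≤A′ (≤-trans (ℕₚ.*-mono-≤ A′≤n A′≤n) n²≤p))
        few-slopes few-popular few-frequent
      where
      open RédeiSzőnyi 𝔽ₚ using (slopes; many-slopes)
      open MultiplicativeMoves 𝔽ₚ A! B! C! X! A≡n B≡n C≡n B≢0 C≢0 d≢0 BA⊆X CA⊆Y X²≤w Y²≤w l k≡lw large
      few-bad′ : ∀ {S} → l * S ≤ 3 * (n * (n * (n * n))) → 32 * S ≤ n * (n * (n * n))
      few-bad′ {S} le = ℕₚ.*-cancelˡ-≤ 3 (≤-trans (≤-reflexive (trans (sym (ℕₚ.*-assoc 3 32 S)) (cong (_* S) {3 * 32} {l} (sym l≡96)))) le)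
      open PopularDifferences 𝔽ₚ A! B! C! V! A≡n B≡n C≡n B≢0 C≢0 bad? good∈V (few-bad′ few-bad)
      A′≤n : length A′ ≤ n
      A′≤n = ≤-trans (length-filter (λ a → 16 * bads a ≤? n * (n * n)) A) (≤-reflexive A≡n)

  -- Each summand of `constant` serves one case. For n < 4 the term 4²⁵ suffices. If fibres are
  -- large, `large-bound` applies with w = m² and k = lm², so that k²w = l²m⁶. Otherwise n³ < 2lm²,
  -- which is stronger than required and is raised to the 12th power.
  power-bound : ∀ {A B C X Y : List F} →
    Unique A → Unique B → Unique C → Unique X → ∀ {n} →
    length A ≡ n → length B ≡ n → length C ≡ n → .{{_ : NonZero n}} →
    (∀ {b} → b ∈ B → b ≢ 0ᶠ) → (∀ {c} → c ∈ C → c ≢ 0ᶠ) → ∀ {d} → d ≢ 0ᶠ →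
    (∀ {a b} → a ∈ A → b ∈ B → b *ᶠ a ∈ X) → (∀ {a c} → a ∈ A → c ∈ C → c *ᶠ (a +ᶠ d) ∈ Y) →
    n * n ≤ p → ∀ {m} .{{_ : NonZero m}} → length X ≤ m → length Y ≤ m →
    ∀ {l} → l ≡ 96 → n ^ 25 ≤ constant l * m ^ 24
  power-bound A! B! C! X! {n} A≡n B≡n C≡n B≢0 C≢0 d≢0 BA⊆X CA⊆Y n²≤p {m} X≤m Y≤m {l} l≡96
    with 4 ≤? n | 2 * (l * (m * m)) ≤? n * (n * n)
  ... | no  4≰n | _ = begin
    n ^ 25                         ≤⟨ ℕₚ.^-monoˡ-≤ 25 (ℕₚ.<⇒≤ (ℕₚ.≰⇒> 4≰n)) ⟩
    4 ^ 25                         ≤⟨ ℕₚ.m≤n+m (4 ^ 25) _ ⟩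
    constant l                     ≤⟨ ℕₚ.m≤m*n (constant l) (m ^ 24) {{ℕₚ.m^n≢0 m 24}} ⟩
    constant l * m ^ 24            ∎
    where open ℕₚ.≤-Reasoning
  ... | yes 4≤n | yes large = begin
    n ^ 25                                                 ≤⟨ large-bound A! B! C! X! A≡n B≡n C≡n B≢0 C≢0 d≢0 BA⊆X CA⊆Y n²≤p 4≤n
                                                                {{ℕₚ.m*n≢0 m m}} (ℕₚ.*-mono-≤ X≤m X≤m) (ℕₚ.*-mono-≤ Y≤m Y≤m) {{k≢0}} l≡96 refl large ⟩
    64 * (4 * (k * k * (m * m))) ^ 4                       ≡⟨ cong (λ t → 64 * t ^ 4) (solve 2 (λ l m → con 4 :* (l :* (m :* m) :* (l :* (m :* m)) :* (m :* m)) := con 4 :* (l :* l) :* m :^ 6) refl l m) ⟩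
    64 * (4 * (l * l) * m ^ 6) ^ 4                         ≡⟨ cong (64 *_) (trans (^-distribˡ-* (4 * (l * l)) (m ^ 6) 4) (cong ((4 * (l * l)) ^ 4 *_) (ℕₚ.^-*-assoc m 6 4))) ⟩
    64 * ((4 * (l * l)) ^ 4 * m ^ 24)                      ≡⟨ ℕₚ.*-assoc 64 ((4 * (l * l)) ^ 4) (m ^ 24) ⟨
    64 * (4 * (l * l)) ^ 4 * m ^ 24                        ≤⟨ ℕₚ.*-monoˡ-≤ (m ^ 24) (≤-trans (ℕₚ.m≤m+n (64 * (4 * (l * l)) ^ 4) ((2 * l) ^ 12)) (ℕₚ.m≤m+n _ (4 ^ 25))) ⟩
    constant l * m ^ 24                                    ∎
    where
    open ℕₚ.≤-Reasoning
    open +-*-Solver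
    k : ℕ
    k = l * (m * m)
    l≢0 : NonZero l
    l≢0 = subst NonZero (sym l≡96) _
    k≢0 : NonZero k
    k≢0 = ℕₚ.m*n≢0 l (m * m) {{l≢0}} {{ℕₚ.m*n≢0 m m}}
  ... | yes 4≤n | no ¬large = begin
    n ^ 25                                                 ≤⟨ ℕₚ.^-monoʳ-≤ n (ℕₚ.m≤m+n 25 11) ⟩
    n ^ 36                                                 ≡⟨ ℕₚ.^-*-assoc n 3 12 ⟨
    (n ^ 3) ^ 12                                           ≤⟨ ℕₚ.^-monoˡ-≤ 12 n³≤ ⟩
    (2 * l * m ^ 2) ^ 12                                   ≡⟨ trans (^-distribˡ-* (2 * l) (m ^ 2) 12) (cong ((2 * l) ^ 12 *_) (ℕₚ.^-*-assoc m 2 12)) ⟩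
    (2 * l) ^ 12 * m ^ 24                                  ≤⟨ ℕₚ.*-monoˡ-≤ (m ^ 24) (≤-trans (ℕₚ.m≤n+m ((2 * l) ^ 12) (64 * (4 * (l * l)) ^ 4)) (ℕₚ.m≤m+n _ (4 ^ 25))) ⟩
    constant l * m ^ 24                                    ∎
    where
    open ℕₚ.≤-Reasoning
    open +-*-Solver
    n³≤ : n ^ 3 ≤ 2 * l * m ^ 2
    n³≤ = begin
      n ^ 3                  ≡⟨ solve 1 (λ n → n :^ 3 := n :* (n :* n)) refl n ⟩
      n * (n * n)            ≤⟨ ℕₚ.<⇒≤ (ℕₚ.≰⇒> ¬large) ⟩
      2 * (l * (m * m))      ≡⟨ solve 2 (λ l m → con 2 :* (l :* (m :* m)) := con 2 :* l :* m :^ 2) refl l m ⟩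
      2 * l * m ^ 2          ∎

-- Residues, rationals and subsets

module _ (p : ℕ) {{pr : Prime p}} where

  private
    instance
      p-nonZero : NonZero p
      p-nonZero = prime⇒nonZero pr

    [_] : ℕ → 𝔽 p
    [_] = residue p

    -ₚ_ : 𝔽 p → 𝔽 p
    -ₚ x = [ p ∸ toℕ x ]

    0%p≡0 : 0 % p ≡ 0
    0%p≡0 = m<n⇒m%n≡m (>-nonZero⁻¹ p)

    toℕ-[] : ∀ n → toℕ [ n ] ≡ n % p
    toℕ-[] n = Fin.toℕ-fromℕ< (m%n<n n p)

    []-cong : ∀ {m n} → m % p ≡ n % p → [ m ] ≡ [ n ]
    []-cong {m} {n} eq = Fin.toℕ-injective (trans (toℕ-[] m) (trans eq (sym (toℕ-[] n))))

    [toℕ] : ∀ x → [ toℕ x ] ≡ x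
    [toℕ] x = Fin.toℕ-injective (trans (toℕ-[] (toℕ x)) (m<n⇒m%n≡m (Fin.toℕ<n x)))

    []-+ : ∀ m n → [ m ] +ₚ [ n ] ≡ [ m + n ]
    []-+ m n = trans (cong₂ (λ i j → [ i + j ]) (toℕ-[] m) (toℕ-[] n)) ([]-cong (sym (%-distribˡ-+ m n p)))

    []-* : ∀ m n → [ m ] *ₚ [ n ] ≡ [ m * n ]
    []-* m n = trans (cong₂ (λ i j → [ i * j ]) (toℕ-[] m) (toℕ-[] n)) ([]-cong (sym (%-distribˡ-* m n p)))

    []-+ˡ : ∀ m x → [ m ] +ₚ x ≡ [ m + toℕ x ]
    []-+ˡ m x = trans (cong ([ m ] +ₚ_) (sym ([toℕ] x))) ([]-+ m (toℕ x))

    []-+ʳ : ∀ x m → x +ₚ [ m ] ≡ [ toℕ x + m ]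
    []-+ʳ x m = trans (cong (_+ₚ [ m ]) (sym ([toℕ] x))) ([]-+ (toℕ x) m)

    []-*ˡ : ∀ m x → [ m ] *ₚ x ≡ [ m * toℕ x ]
    []-*ˡ m x = trans (cong ([ m ] *ₚ_) (sym ([toℕ] x))) ([]-* m (toℕ x))

    []-*ʳ : ∀ x m → x *ₚ [ m ] ≡ [ toℕ x * m ]
    []-*ʳ x m = trans (cong (_*ₚ [ m ]) (sym ([toℕ] x))) ([]-* (toℕ x) m)

    []≡0 : ∀ {m} → [ m ] ≡ 0ₚ → m % p ≡ 0
    []≡0 {m} eq = trans (sym (toℕ-[] m)) (trans (cong toℕ eq) (trans (toℕ-[] 0) (0%p≡0)))

    +-commₚ : ∀ x y → x +ₚ y ≡ y +ₚ x
    +-commₚ x y = cong [_] (ℕₚ.+-comm (toℕ x) (toℕ y))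

    *-commₚ : ∀ x y → x *ₚ y ≡ y *ₚ x
    *-commₚ x y = cong [_] (ℕₚ.*-comm (toℕ x) (toℕ y))

    +-identityˡₚ : ∀ x → 0ₚ +ₚ x ≡ x
    +-identityˡₚ x = trans ([]-+ˡ 0 x) ([toℕ] x)

    *-identityˡₚ : ∀ x → 1ₚ *ₚ x ≡ x
    *-identityˡₚ x = trans ([]-*ˡ 1 x) (trans (cong [_] (ℕₚ.*-identityˡ (toℕ x))) ([toℕ] x))

    -‿inverseˡₚ : ∀ x → (-ₚ x) +ₚ x ≡ 0ₚ
    -‿inverseˡₚ x = trans ([]-+ˡ (p ∸ toℕ x) x) (trans (cong [_] (ℕₚ.m∸n+n≡m (ℕₚ.<⇒≤ (Fin.toℕ<n x))))
      ([]-cong (trans (n%n≡0 p) (sym (0%p≡0)))))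

    distribˡₚ : ∀ x y z → x *ₚ (y +ₚ z) ≡ x *ₚ y +ₚ x *ₚ z
    distribˡₚ x y z = trans ([]-*ʳ x (toℕ y + toℕ z))
      (trans (cong [_] (ℕₚ.*-distribˡ-+ (toℕ x) (toℕ y) (toℕ z))) (sym ([]-+ (toℕ x * toℕ y) (toℕ x * toℕ z))))

    isCommutativeRingₚ : IsCommutativeRing _≡_ _+ₚ_ _*ₚ_ -ₚ_ 0ₚ 1ₚ
    isCommutativeRingₚ = record
      { isRing = record
        { +-isAbelianGroup = record
          { isGroup = record
            { isMonoid = record
              { isSemigroup = record
                { isMagma = isMagma _+ₚ_
                ; assoc   = λ x y z → trans ([]-+ˡ (toℕ x + toℕ y) z)
                    (trans (cong [_] (ℕₚ.+-assoc (toℕ x) (toℕ y) (toℕ z))) (sym ([]-+ʳ x (toℕ y + toℕ z))))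
                }
              ; identity = +-identityˡₚ , λ x → trans (+-commₚ x 0ₚ) (+-identityˡₚ x)
              }
            ; inverse = -‿inverseˡₚ , λ x → trans (+-commₚ x (-ₚ x)) (-‿inverseˡₚ x)
            ; ⁻¹-cong = cong -ₚ_
            }
          ; comm = +-commₚ
          }
        ; *-cong     = cong₂ _*ₚ_
        ; *-assoc    = λ x y z → trans ([]-*ˡ (toℕ x * toℕ y) z)
            (trans (cong [_] (ℕₚ.*-assoc (toℕ x) (toℕ y) (toℕ z))) (sym ([]-*ʳ x (toℕ y * toℕ z))))
        ; *-identity = *-identityˡₚ , λ x → trans (*-commₚ x 1ₚ) (*-identityˡₚ x)
        ; distrib    = distribˡₚ , λ x y z → trans (*-commₚ (y +ₚ z) x)
            (trans (distribˡₚ x y z) (cong₂ _+ₚ_ (*-commₚ x y) (*-commₚ x z)))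
        }
      ; *-comm = *-commₚ
      }

    integralₚ : ∀ {x y} → x *ₚ y ≡ 0ₚ → x ≡ 0ₚ ⊎ y ≡ 0ₚ
    integralₚ {x} {y} xy≡0 = Sum.map ≡0 ≡0 (euclidsLemma (toℕ x) (toℕ y) pr (m%n≡0⇒n∣m _ p ([]≡0 xy≡0)))
      where
      ≡0 : ∀ {z} → p ∣ toℕ z → z ≡ 0ₚ
      ≡0 {z} p∣z = trans (sym ([toℕ] z)) ([]-cong (trans (n∣m⇒m%n≡0 (toℕ z) p p∣z) (sym (0%p≡0))))

    1<p : 1 < p
    1<p = nonTrivial⇒n>1 p {{prime⇒nonTrivial pr}}

    []-≢0 : ∀ {m} → 0 < m → m < p → [ m ] ≢ 0ₚ
    []-≢0 0<m m<p eq = ℕₚ.<⇒≢ 0<m (sym (trans (sym (m<n⇒m%n≡m m<p)) ([]≡0 eq)))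

    ×1≡[] : ∀ m → RawMonoid._×_ (record { _≈_ = _≡_ ; _∙_ = _+ₚ_ ; ε = 0ₚ }) m 1ₚ ≡ [ m ]
    ×1≡[] zero    = refl
    ×1≡[] (suc m) = trans (cong (1ₚ +ₚ_) (×1≡[] m)) ([]-+ 1 m)

  residueField : PrimeField
  residueField = record
    { F                 = 𝔽 p
    ; isCommutativeRing = isCommutativeRingₚ
    ; integral          = integralₚ
    ; 1≢0               = []-≢0 (s≤s z≤n) 1<p
    ; _≟_               = Fin._≟_
    ; elements          = allFin p
    ; elements!         = Unique.allFin⁺ p
    ; ∈-elements        = ∈-allFin
    ; p                 = p
    ; p-length          = length-tabulate id
    ; ×1-≢0             = λ {m} 0<m m<p → subst (_≢ 0ₚ) (sym (×1≡[] m)) ([]-≢0 0<m m<p)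
    }

-- Natural numbers as rationals and the rational constant

private
  toℚᵘ-fromℕ : ∀ n → toℚᵘ (fromℕ n) ℚᵘ.≃ ℚᵘ.mkℚᵘ (ℤ.+ n) 0
  toℚᵘ-fromℕ n = ℚ.toℚᵘ-fromℚᵘ (ℚᵘ.mkℚᵘ (ℤ.+ n) 0)

fromℕ-mono-≤ : ∀ {m n} → m ℕ.≤ n → fromℕ m ℚ.≤ fromℕ n
fromℕ-mono-≤ {m} {n} m≤n = ℚ.toℚᵘ-cancel-≤
  (ℚᵘ.≤-respˡ-≃ (ℚᵘ.≃-sym (toℚᵘ-fromℕ m)) (ℚᵘ.≤-respʳ-≃ (ℚᵘ.≃-sym (toℚᵘ-fromℕ n))
    (ℚᵘ.*≤* (ℤ.*-monoʳ-≤-nonNeg (ℤ.+ 1) (ℤ.+≤+ m≤n)))))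

fromℕ-* : ∀ m n → fromℕ (m ℕ.* n) ≡ fromℕ m ℚ.* fromℕ n
fromℕ-* m n = ℚ.toℚᵘ-injective (begin
  toℚᵘ (fromℕ (m ℕ.* n))                       ≈⟨ toℚᵘ-fromℕ (m ℕ.* n) ⟩
  ℚᵘ.mkℚᵘ (ℤ.+ (m ℕ.* n)) 0                      ≈⟨ ℚᵘ.*≡* (cong (ℤ._* ℤ.+ 1) (ℤ.pos-* m n)) ⟩
  ℚᵘ.mkℚᵘ (ℤ.+ m) 0 ℚᵘ.* ℚᵘ.mkℚᵘ (ℤ.+ n) 0         ≈⟨ ℚᵘ.*-cong (toℚᵘ-fromℕ m) (toℚᵘ-fromℕ n) ⟨
  toℚᵘ (fromℕ m) ℚᵘ.* toℚᵘ (fromℕ n)           ≈⟨ ℚ.toℚᵘ-homo-* (fromℕ m) (fromℕ n) ⟨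
  toℚᵘ (fromℕ m ℚ.* fromℕ n)                   ∎)
  where open import Relation.Binary.Reasoning.Setoid ℚᵘ.≃-setoid

fromℕ-^ : ∀ n k → fromℕ (n ℕ.^ k) ≡ fromℕ n ^ℚ k
fromℕ-^ n zero    = refl
fromℕ-^ n (suc k) = trans (fromℕ-* n (n ℕ.^ k)) (cong (fromℕ n ℚ.*_) (fromℕ-^ n k))

recip : ℕ → ℚ
recip k = ℤ.+ 1 ℚ./ suc k

recip-fromℕ : ∀ k → recip k ℚ.* fromℕ (suc k) ≡ 1ℚ
recip-fromℕ k = ℚ.toℚᵘ-injective (begin
  toℚᵘ (recip k ℚ.* fromℕ (suc k))                ≈⟨ ℚ.toℚᵘ-homo-* (recip k) (fromℕ (suc k)) ⟩
  toℚᵘ (recip k) ℚᵘ.* toℚᵘ (fromℕ (suc k))        ≈⟨ ℚᵘ.*-cong (ℚ.toℚᵘ-fromℚᵘ (ℚᵘ.mkℚᵘ (ℤ.+ 1) k)) (toℚᵘ-fromℕ (suc k)) ⟩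
  ℚᵘ.mkℚᵘ (ℤ.+ 1) k ℚᵘ.* ℚᵘ.mkℚᵘ (ℤ.+ suc k) 0        ≈⟨ ℚᵘ.*≡* (cong ℤ.+_ (trans (ℕₚ.*-identityʳ (1 ℕ.* suc k)) (cong (1 ℕ.*_) (sym (ℕₚ.*-identityʳ (suc k)))))) ⟩
  toℚᵘ 1ℚ                                         ∎)
  where open import Relation.Binary.Reasoning.Setoid ℚᵘ.≃-setoid

0<recip : ∀ k → 0ℚ ℚ.< recip k
0<recip k = ℚ.positive⁻¹ (recip k) {{ℚ.normalize-pos 1 (suc k)}}

-- With c = 1/(j + 1), multiplying the hypothesis by cᵏ cancels the factor (j + 1)ᵏ.
rational-bound : ∀ j n m k .{{_ : NonZero k}} → n ℕ.^ (k ℕ.+ 1) ℕ.≤ (suc j ℕ.* m) ℕ.^ k →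
                 recip j * n ^[1+1/ k ]≤ m
rational-bound j n m k n^≤ = begin
  recip j ^ℚ k ℚ.* fromℕ n ^ℚ (k ℕ.+ 1)         ≡⟨ cong (recip j ^ℚ k ℚ.*_) (fromℕ-^ n (k ℕ.+ 1)) ⟨
  recip j ^ℚ k ℚ.* fromℕ (n ℕ.^ (k ℕ.+ 1))      ≤⟨ ℚ.*-monoˡ-≤-nonNeg (recip j ^ℚ k) {{recip^-nonNeg k}} (fromℕ-mono-≤ n^≤) ⟩
  recip j ^ℚ k ℚ.* fromℕ ((suc j ℕ.* m) ℕ.^ k)  ≡⟨ cong (recip j ^ℚ k ℚ.*_) (fromℕ-^ (suc j ℕ.* m) k) ⟩
  recip j ^ℚ k ℚ.* fromℕ (suc j ℕ.* m) ^ℚ k     ≡⟨ ^-distrib-* (recip j) (fromℕ (suc j ℕ.* m)) k ⟨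
  (recip j ℚ.* fromℕ (suc j ℕ.* m)) ^ℚ k        ≡⟨ cong (_^ℚ k) cancel ⟩
  fromℕ m ^ℚ k                                  ∎
  where
  open ℚ.≤-Reasoning
  open Exp (CommutativeRing.commutativeSemiring ℚ.+-*-commutativeRing) using (^-distrib-*)
  cancel : recip j ℚ.* fromℕ (suc j ℕ.* m) ≡ fromℕ m
  cancel = trans (cong (recip j ℚ.*_) (fromℕ-* (suc j) m)) (trans (sym (ℚ.*-assoc (recip j) (fromℕ (suc j)) (fromℕ m)))
    (trans (cong (ℚ._* fromℕ m) (recip-fromℕ j)) (ℚ.*-identityˡ (fromℕ m))))
  recip^-nonNeg : ∀ k → ℚ.NonNegative (recip j ^ℚ k)
  recip^-nonNeg zero    = _
  recip^-nonNeg (suc k) = ℚ.nonNeg*nonNeg⇒nonNeg (recip j) {{ℚ.normalize-nonNeg 1 (suc j)}} (recip j ^ℚ k) {{recip^-nonNeg k}}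

-- Subsets as lists of their members

private
  variable
    n : ℕ

members : Subset n → List (Fin n)
members Vec.[]              = []
members (inside  Vec.∷ S)   = zero ∷ map suc (members S)
members (outside Vec.∷ S)   = map suc (members S)

length-members : (S : Subset n) → length (members S) ≡ ∣ S ∣
length-members Vec.[]            = refl
length-members (inside  Vec.∷ S) = cong suc (trans (length-map suc (members S)) (length-members S))
length-members (outside Vec.∷ S) = trans (length-map suc (members S)) (length-members S)

members! : (S : Subset n) → Unique (members S)
members! Vec.[]            = []
members! (inside  Vec.∷ S) = All.tabulate 0∉ ∷ Unique.map⁺ Fin.suc-injective (members! S)
  where
  0∉ : ∀ {x} → x ∈ map suc (members S) → zero ≢ x
  0∉ x∈ refl with ∈-map⁻ suc x∈
  ... | _ , _ , ()
members! (outside Vec.∷ S) = Unique.map⁺ Fin.suc-injective (members! S)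

∈-members⁺ : {S : Subset n} {x : Fin n} → x Subset.∈ S → x ∈ members S
∈-members⁺ {S = inside  Vec.∷ S} {zero}  x∈ = here refl
∈-members⁺ {S = inside  Vec.∷ S} {suc x} x∈ = there (∈-map⁺ suc (∈-members⁺ (drop-there x∈)))
∈-members⁺ {S = outside Vec.∷ S} {suc x} x∈ = ∈-map⁺ suc (∈-members⁺ (drop-there x∈))

∈-members⁻ : {S : Subset n} {x : Fin n} → x ∈ members S → x Subset.∈ S
∈-members⁻ {S = inside  Vec.∷ S} (here refl) = Vec.here
∈-members⁻ {S = inside  Vec.∷ S} (there x∈) with ∈-map⁻ suc x∈
... | _ , y∈ , refl = Vec.there (∈-members⁻ y∈)
∈-members⁻ {S = outside Vec.∷ S} x∈ with ∈-map⁻ suc x∈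
... | _ , y∈ , refl = Vec.there (∈-members⁻ y∈)

∃-sublist : {I : Set} {xs : List I} → Unique xs → ∀ {m} → m ≤ length xs →
            ∃[ ys ] (Unique ys × length ys ≡ m × (∀ {y} → y ∈ ys → y ∈ xs))
∃-sublist {xs = xs} xs! {m} m≤ = take m xs , Unique.take⁺ m xs! , trans (length-take m xs) (ℕₚ.m≤n⇒m⊓n≡m m≤) ,
  λ {y} y∈ → subst (y ∈_) (take++drop≡id m xs) (∈-++⁺ˡ y∈)

injection-∣∣ : ∀ {p} {S T : Subset p} (f : Fin p → Fin p) → (∀ {x} → x Subset.∈ S → f x Subset.∈ T) →
               (∀ {x y} → f x ≡ f y → x ≡ y) → ∣ S ∣ ≤ ∣ T ∣
injection-∣∣ {S = S} {T} f f∈ inj = begin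
  ∣ S ∣              ≡⟨ length-members S ⟨
  length (members S) ≤⟨ Injections.injection-length-≤ Fin._≟_ (members T) f (members! S) (∈-members⁺ ∘ f∈ ∘ ∈-members⁻) (λ _ _ → inj) ⟩
  length (members T) ≡⟨ length-members T ⟩
  ∣ T ∣              ∎
  where open ℕₚ.≤-Reasoning

module _ {p : ℕ} {{pr : Prime p}} where

  open PrimeField (residueField p) using (0ᶠ; _-ᶠ_; *-comm; *-cancelˡ; -ᶠ_; module 𝕊)

  ·-∈ : (S T : Subset p) → ∀ {x y} → x Subset.∈ S → y Subset.∈ T → x *ₚ y Subset.∈ S · T
  ·-∈ S T x∈ y∈ = Equivalence.from (∈-comprehension (isProduct? S T)) (_ , x∈ , _ , y∈ , refl)

  ⊕-∈ : (S : Subset p) (d : 𝔽 p) → ∀ {x} → x Subset.∈ S → x +ₚ d Subset.∈ S ⊕ d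
  ⊕-∈ S d x∈ = Equivalence.from (∈-comprehension (isTranslate? S d)) (_ , x∈ , refl)

  ∣·∣-comm : (S T : Subset p) → ∣ S · T ∣ ≤ ∣ T · S ∣
  ∣·∣-comm S T = injection-∣∣ (λ x → x) swapped (λ eq → eq)
    where
    swapped : ∀ {z} → z Subset.∈ S · T → z Subset.∈ T · S
    swapped z∈ with Equivalence.to (∈-comprehension (isProduct? S T)) z∈
    ... | x , x∈ , y , y∈ , refl = subst (Subset._∈ T · S) (*-comm y x) (·-∈ T S y∈ x∈)

  ∣⊕∣ : (S : Subset p) (d : 𝔽 p) → ∣ S ⊕ d ∣ ≡ ∣ S ∣
  ∣⊕∣ S d = ℕₚ.≤-antisym (injection-∣∣ (λ x → x -ᶠ d) back (injective (-ᶠ d)))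
    (injection-∣∣ (λ x → x +ₚ d) (⊕-∈ S d) (injective d))
    where
    open 𝕊
    cancel : ∀ x d → x +ₚ d -ᶠ d ≡ x
    cancel x d = solve 2 (λ x d → (x :+ d) :- d := x) refl x d
    injective : ∀ d {x y} → x +ₚ d ≡ y +ₚ d → x ≡ y
    injective d {x} {y} eq = trans (sym (cancel x d)) (trans (cong (λ z → z -ᶠ d) eq) (cancel y d))
    back : ∀ {z} → z Subset.∈ S ⊕ d → z -ᶠ d Subset.∈ S
    back z∈ with Equivalence.to (∈-comprehension (isTranslate? S d)) z∈
    ... | x , x∈ , refl = subst (Subset._∈ S) (sym (cancel x d)) x∈

  ∣·∣-positive : (S T : Subset p) → 0 < ∣ S ∣ → 0 < ∣ T ∣ → 0 < ∣ S · T ∣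
  ∣·∣-positive S T 0<S 0<T = subst (0 <_) (length-members (S · T))
    (nonempty (∈-members⁺ (·-∈ S T (∈-members⁻ (proj₂ (element (members S) (subst (0 <_) (sym (length-members S)) 0<S))))
      (∈-members⁻ (proj₂ (element (members T) (subst (0 <_) (sym (length-members T)) 0<T)))))))
    where
    element : {I : Set} (xs : List I) → 0 < length xs → ∃[ x ] x ∈ xs
    element (x ∷ xs) _ = x , here refl
    nonempty : {I : Set} {x : I} {xs : List I} → x ∈ xs → 0 < length xs
    nonempty {xs = x ∷ xs} _ = s≤s z≤n

  -- At most one member is zero, so at least m others exist. Exactly m are taken, whether or not
  -- zero belongs to `S`, to give all lists the same length.
  nonzero-members : (S : Subset p) → ∀ {m} → ∣ S ∣ ≡ suc m →
    ∃[ xs ] (Unique xs × length xs ≡ m × (∀ {x} → x ∈ xs → x Subset.∈ S) × (∀ {x} → x ∈ xs → x ≢ 0ₚ))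
  nonzero-members S {m} S≡1+m = let xs , xs! , xs≡m , ⊆xs = ∃-sublist (Unique.filter⁺ ≢0? (members! S)) m≤ in
    xs , xs! , xs≡m , ∈-members⁻ ∘ proj₁ ∘ ∈-filter⁻ ≢0? {xs = members S} ∘ ⊆xs , proj₂ ∘ ∈-filter⁻ ≢0? {xs = members S} ∘ ⊆xs
    where
    open ℕₚ.≤-Reasoning
    ≢0? : ∀ x → Dec (x ≢ 0ₚ)
    ≢0? x = ¬? (x Fin.≟ 0ₚ)
    m≤ : m ≤ length (filter ≢0? (members S))
    m≤ = ℕₚ.+-cancelˡ-≤ 1 _ _ (begin
      suc m                                                                  ≡⟨ trans (length-members S) S≡1+m ⟨
      length (members S)                                                     ≡⟨ length-∑ (members S) ⟩
      ∑[ _ ∈ members S ] 1                                                   ≡⟨ ∑-cong (members S) (λ x → 𝟙+¬≡1 (x Fin.≟ 0ₚ)) ⟨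
      ∑[ x ∈ members S ] (𝟙 (x Fin.≟ 0ₚ) + 𝟙 (≢0? x))                            ≡⟨ ∑-distrib-+ (members S) (λ x → 𝟙 (x Fin.≟ 0ₚ)) (λ x → 𝟙 (≢0? x)) ⟩
      (∑[ x ∈ members S ] 𝟙 (x Fin.≟ 0ₚ)) + (∑[ x ∈ members S ] 𝟙 (≢0? x))       ≤⟨ ℕₚ.+-mono-≤ (∑-atMostOne (Fin._≟ 0ₚ) (members! S) (λ _ _ x≡0 y≡0 → trans x≡0 (sym y≡0)))
                                                                                  (≤-reflexive (sym (length-filter-∑ ≢0? (members S)))) ⟩
      suc (length (filter ≢0? (members S)))                                  ∎)

  -- Zero is discarded from `B` and `C`, and `A` is shortened to match, so that `power-bound`
  -- applies with m = |A| - 1. Its exponents 25 and 24 become 27 and 26 through m² ≤ M², where m ≤ M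
  -- because `A · B` contains a dilate of the shortened `A` by a nonzero element.
  shortened-bound : (A B C : Subset p) → ∀ {m} .{{_ : NonZero m}} → ∣ A ∣ ≡ suc m → ∣ B ∣ ≡ suc m → ∣ C ∣ ≡ suc m →
    m * m ≤ p → ∀ {d} → d ≢ 0ₚ → ∀ {M} → ∣ A · B ∣ ≤ M → ∣ (A ⊕ d) · C ∣ ≤ M →
    ∀ {l} → l ≡ 96 → m ^ 27 ≤ constant l * M ^ 26
  shortened-bound A B C {m} A≡ B≡ C≡ m²≤p {d} d≢0 {M} AB≤M AdC≤M {l} l≡96 =
    let
      A⁻ , A⁻! , A⁻≡m , A⁻⊆A = ∃-sublist (members! A) (≤-trans (ℕₚ.n≤1+n m) (≤-reflexive (sym (trans (length-members A) A≡))))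
      B⁻ , B⁻! , B⁻≡m , B⁻⊆B , B⁻≢0 = nonzero-members B B≡
      C⁻ , C⁻! , C⁻≡m , C⁻⊆C , C⁻≢0 = nonzero-members C C≡
      BA⊆X : ∀ {a b} → a ∈ A⁻ → b ∈ B⁻ → b *ₚ a ∈ members (A · B)
      BA⊆X = λ {a} {b} a∈ b∈ → ∈-members⁺ (subst (Subset._∈ A · B) (*-comm a b) (·-∈ A B (∈-members⁻ (A⁻⊆A a∈)) (B⁻⊆B b∈)))
      CA⊆Y : ∀ {a c} → a ∈ A⁻ → c ∈ C⁻ → c *ₚ (a +ₚ d) ∈ members ((A ⊕ d) · C)
      CA⊆Y = λ {a} {c} a∈ c∈ → ∈-members⁺ (subst (Subset._∈ (A ⊕ d) · C) (*-comm (a +ₚ d) c)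
        (·-∈ (A ⊕ d) C (⊕-∈ A d (∈-members⁻ (A⁻⊆A a∈))) (C⁻⊆C c∈)))
      X≤M = ≤-trans (≤-reflexive (length-members (A · B))) AB≤M
      Y≤M = ≤-trans (≤-reflexive (length-members ((A ⊕ d) · C))) AdC≤M
      m≤M = ≤-trans (m≤X A⁻! A⁻≡m B⁻≡m B⁻≢0 BA⊆X) X≤M
    in finish m≤M (power-bound (residueField p) A⁻! B⁻! C⁻! (members! (A · B)) A⁻≡m B⁻≡m C⁻≡m B⁻≢0 C⁻≢0 d≢0 BA⊆X CA⊆Y
      m²≤p {{>-nonZero (≤-trans (>-nonZero⁻¹ m) m≤M)}} X≤M Y≤M l≡96)
    where
    open ℕₚ.≤-Reasoning
    open +-*-Solver
    m≤X : ∀ {xs ys zs} → Unique xs → length xs ≡ m → length ys ≡ m → (∀ {y} → y ∈ ys → y ≢ 0ₚ) →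
          (∀ {x y} → x ∈ xs → y ∈ ys → y *ₚ x ∈ zs) → m ≤ length zs
    m≤X {ys = []} _ _ 0≡m _ _ = contradiction (sym 0≡m) (≢-nonZero⁻¹ m)
    m≤X {ys = y ∷ _} {zs} xs! xs≡m _ ≢0 ⊆zs = ≤-trans (≤-reflexive (sym xs≡m)) (Injections.injection-length-≤ Fin._≟_ zs (y *ₚ_) xs!
      (λ x∈ → ⊆zs x∈ (here refl)) (λ _ _ → *-cancelˡ (≢0 (here refl))))
    finish : m ≤ M → m ^ 25 ≤ constant l * M ^ 24 → m ^ 27 ≤ constant l * M ^ 26
    finish m≤M m^25≤ = begin
      m ^ 27                              ≡⟨ ℕₚ.^-distribˡ-+-* m 25 2 ⟩
      m ^ 25 * m ^ 2                      ≤⟨ ℕₚ.*-mono-≤ m^25≤ (ℕₚ.^-monoˡ-≤ 2 m≤M) ⟩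
      constant l * M ^ 24 * M ^ 2         ≡⟨ ℕₚ.*-assoc (constant l) (M ^ 24) (M ^ 2) ⟩
      constant l * (M ^ 24 * M ^ 2)       ≡⟨ cong (constant l *_) (ℕₚ.^-distribˡ-+-* M 24 2) ⟨
      constant l * M ^ 26                 ∎

-- From m = n - 1 back to n, and the final bounds

enlarge : ∀ k .{{_ : NonZero k}} n {c M} → (0 < n → 0 < M) →
          (∀ {m} .{{_ : NonZero m}} → n ≡ suc m → m ^ (k + 1) ≤ c * M ^ k) →
          n ^ (k + 1) ≤ (suc (2 ^ (k + 1) * c) * M) ^ k
enlarge k zero              _   _   = ≤-trans (≤-reflexive (cong (0 ^_) (ℕₚ.+-comm k 1))) z≤n
-- Here m = 0, which the hypothesis excludes, so the bound rests on M > 0.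
enlarge k (suc zero) {c} {M} 0<M _  = begin
  1 ^ (k + 1)   ≡⟨ ℕₚ.^-zeroˡ (k + 1) ⟩
  1             ≤⟨ >-nonZero⁻¹ _ {{ℕₚ.m^n≢0 (suc (2 ^ (k + 1) * c) * M) k {{ℕₚ.m*n≢0 (suc (2 ^ (k + 1) * c)) M {{_}} {{>-nonZero (0<M (s≤s z≤n))}}}}}} ⟩
  (suc (2 ^ (k + 1) * c) * M) ^ k ∎
  where open ℕₚ.≤-Reasoning
-- As m ≥ 1, n ≤ 2m at the cost of 2^(k+1). Then j ≤ (j + 1)ᵏ, valid for k ≥ 1, moves the constant
-- under the k-th power.
enlarge k@(suc k-1) (suc m@(suc _)) {c} {M} _ m^≤ = begin
  suc m ^ (k + 1)                   ≤⟨ ℕₚ.^-monoˡ-≤ (k + 1) (≤-trans (ℕₚ.+-monoˡ-≤ m (s≤s z≤n)) (≤-reflexive (cong (m +_) (sym (ℕₚ.+-identityʳ m))))) ⟩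
  (2 * m) ^ (k + 1)                 ≡⟨ ^-distribˡ-* 2 m (k + 1) ⟩
  2 ^ (k + 1) * m ^ (k + 1)         ≤⟨ ℕₚ.*-monoʳ-≤ (2 ^ (k + 1)) (m^≤ refl) ⟩
  2 ^ (k + 1) * (c * M ^ k)         ≡⟨ ℕₚ.*-assoc (2 ^ (k + 1)) c (M ^ k) ⟨
  j * M ^ k                         ≤⟨ ℕₚ.*-monoˡ-≤ (M ^ k) (≤-trans (ℕₚ.n≤1+n j) (ℕₚ.m≤m*n (suc j) (suc j ^ k-1) {{ℕₚ.m^n≢0 (suc j) k-1}})) ⟩
  suc j ^ k * M ^ k                 ≡⟨ ^-distribˡ-* (suc j) M k ⟨
  (suc j * M) ^ k                   ∎
  where
  open ℕₚ.≤-Reasoning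
  j : ℕ
  j = 2 ^ (k + 1) * c

-- P n m stands for c * n ^[1+1/ 26 ]≤ m, kept abstract because its powers of rationals unfold badly.
Growth : (ℕ → ℕ → Set) → Set
Growth P = (p : ℕ) {{_ : Prime p}} (A B C : Subset p) →
  ∣ A ∣ ≡ ∣ B ∣ → ∣ B ∣ ≡ ∣ C ∣ → ∣ A ∣ ^ 2 ≤ p →
  (d : 𝔽 p) → d ≢ 0ₚ → P ∣ A ∣ (∣ A · B ∣ ⊔ ∣ (A ⊕ d) · C ∣)

-- The constant is 1/(1 + 2²⁷ · `constant l`), the reciprocal of the factor that `enlarge` puts in
-- front of M.
growth : ∀ {l} → l ≡ 96 → Growth (recip (2 ^ (26 + 1) * constant l) *_^[1+1/ 26 ]≤_)
growth {l} l≡96 p A B C A≡B B≡C A²≤p d d≢0 =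
  let M = ∣ A · B ∣ ⊔ ∣ (A ⊕ d) · C ∣
      AB≤M = ℕₚ.m≤m⊔n ∣ A · B ∣ ∣ (A ⊕ d) · C ∣
  in rational-bound (2 ^ (26 + 1) * constant l) ∣ A ∣ M 26 (enlarge 26 ∣ A ∣ {constant l} {M}
    (λ 0<A → ≤-trans (∣·∣-positive A B 0<A (subst (0 <_) A≡B 0<A)) AB≤M)
    (λ {m} A≡ → shortened-bound A B C {m} A≡ (trans (sym A≡B) A≡) (trans (sym B≡C) (trans (sym A≡B) A≡))
      (m²≤ m A≡ A²≤p) d≢0 {M} AB≤M (ℕₚ.m≤n⊔m ∣ A · B ∣ ∣ (A ⊕ d) · C ∣) l≡96))
  where
  m²≤ : ∀ {n p} m → n ≡ suc m → n ^ 2 ≤ p → m * m ≤ p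
  m²≤ m refl n²≤p = ≤-trans (≤-trans (ℕₚ.*-mono-≤ (ℕₚ.n≤1+n m) (ℕₚ.n≤1+n m))
    (≤-reflexive (cong (suc m *_) (sym (ℕₚ.*-identityʳ (suc m)))))) n²≤p

-- Take B = A + 1, C = A and d = 1: both products are A(A + 1) up to the order of factors, so the
-- maximum collapses.
shifted-product-growth : ∀ P → Growth P → (p : ℕ) {{_ : Prime p}} (A : Subset p) → ∣ A ∣ ^ 2 ≤ p →
                         P ∣ A ∣ ∣ A · (A ⊕ 1ₚ) ∣
shifted-product-growth P bound p A A²≤p = subst (P ∣ A ∣) (ℕₚ.m≥n⇒m⊔n≡m (∣·∣-comm (A ⊕ 1ₚ) A))
  (bound p A (A ⊕ 1ₚ) A (sym (∣⊕∣ A 1ₚ)) (∣⊕∣ A 1ₚ) A²≤p 1ₚ (PrimeField.1≢0 (residueField p)))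

-- Take B = A, C = A + 1 and d = 1; a translate has the same cardinality.
squares-growth : ∀ P → Growth P → (p : ℕ) {{_ : Prime p}} (A : Subset p) → ∣ A ∣ ^ 2 ≤ p →
                 P ∣ A ∣ (∣ A · A ∣ ⊔ ∣ (A ⊕ 1ₚ) · (A ⊕ 1ₚ) ∣)
squares-growth P bound p A A²≤p = bound p A A (A ⊕ 1ₚ) refl (sym (∣⊕∣ A 1ₚ)) A²≤p 1ₚ (PrimeField.1≢0 (residueField p))

∃-growth : ∃[ c ] (0ℚ <ℚ c × Growth (c *_^[1+1/ 26 ]≤_))
∃-growth = recip (2 ^ (26 + 1) * constant 96) , 0<recip (2 ^ (26 + 1) * constant 96) , growth {96} refl

theorem1 : (∃[ c ] (0ℚ <ℚ c ×
    ((p : ℕ) {{_ : Prime p}} (A B C : Subset p) →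
    ∣ A ∣ ≡ ∣ B ∣ → ∣ B ∣ ≡ ∣ C ∣ → ∣ A ∣ ^ 2 ≤ p →
    (d : 𝔽 p) → d ≢ 0ₚ →
    c * ∣ A ∣ ^[1+1/ 26 ]≤ (∣ A · B ∣ ⊔ ∣ (A ⊕ d) · C ∣))))
    ×
    (∃[ c ] (0ℚ <ℚ c ×
    ((p : ℕ) {{_ : Prime p}} (A : Subset p) → ∣ A ∣ ^ 2 ≤ p →
    c * ∣ A ∣ ^[1+1/ 26 ]≤ ∣ A · (A ⊕ 1ₚ) ∣)))
    ×
    (∃[ c ] (0ℚ <ℚ c ×
    ((p : ℕ) {{_ : Prime p}} (A : Subset p) → ∣ A ∣ ^ 2 ≤ p →
    c * ∣ A ∣ ^[1+1/ 26 ]≤ (∣ A · A ∣ ⊔ ∣ (A ⊕ 1ₚ) · (A ⊕ 1ₚ) ∣))))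
theorem1 = let c , 0<c , bound = ∃-growth in
  (c , 0<c , bound) ,
  (c , 0<c , shifted-product-growth (c *_^[1+1/ 26 ]≤_) bound) ,
  (c , 0<c , squares-growth (c *_^[1+1/ 26 ]≤_) bound)
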